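{- For every integer $m\ge 5$, \[ r(m,m)\ge m+r\left(\left\lceil\frac{2m}{5}\right\rceil-1,\left\lceil\frac{2m}{5}\right\rceil-1\right). \]
   Context: $G_{m,n}$ is the $m\times n$ grid graph $P_m\times P_n$. A $k$-ranking of a graph $G$ is a labeling $f:V(G)\to\{1,\dots,k\}$ such that every path between two distinct vertices with the same label contains a vertex with a larger label; $\chi_r(G)$ is the least such $k$, and $r(m,n)=\chi_r(G_{m,n})$. -}

module Defs where

open import Data.Nat using (ℕ; zero; suc; _+_; _*_; _≤_; _<_; _∸_; _/_)
open import Data.Fin using (Fin; toℕ)
open import Data.Product using (_×_; _,_; ∃; Σ-syntax)
open import Data.Sum using (_⊎_)
open import Data.List using (List; []; _∷_)
open import Data.List.Membership.Propositional using (_∈_)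
open import Data.List.Relation.Unary.Unique.Propositional using (Unique)
open import Relation.Binary.PropositionalEquality using (_≡_; _≢_)
open import Relation.Nullary using (¬_)

V : ℕ → ℕ → Set
V m n = Fin m × Fin n

AdjP : ∀ {k} → Fin k → Fin k → Set
AdjP i j = toℕ i ≡ suc (toℕ j) ⊎ toℕ j ≡ suc (toℕ i)

Adj : ∀ {m n} → V m n → V m n → Set
Adj {m} {n} (a , b) (c , d) = (a ≡ c × AdjP b d) ⊎ (AdjP a c × b ≡ d)

data Walk {m n : ℕ} : V m n → V m n → Set where
  here : (u : V m n) → Walk u u
  step : {u w v : V m n} → Adj u w → Walk w v → Walk u v

vertices : ∀ {m n} {u v : V m n} → Walk u v → List (V m n)
vertices (here u) = u ∷ []
vertices (step {u = u} _ p) = u ∷ vertices p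

IsPath : ∀ {m n} {u v : V m n} → Walk u v → Set
IsPath p = Unique (vertices p)

IsRanking : (m n k : ℕ) → (V m n → ℕ) → Set
IsRanking m n k f =
  (∀ x → 1 ≤ f x × f x ≤ k) ×
  (∀ (u v : V m n) → u ≢ v → f u ≡ f v →
     (p : Walk u v) → IsPath p →
     ∃ λ w → w ∈ vertices p × f u < f w)

Rankable : ℕ → ℕ → ℕ → Set
Rankable m n k = ∃ λ (f : V m n → ℕ) → IsRanking m n k f

IsRankNumber : ℕ → ℕ → ℕ → Set
IsRankNumber m n k = Rankable m n k × (∀ j → Rankable m n j → k ≤ j)

ceil2m/5 : ℕ → ℕ
ceil2m/5 m = (2 * m + 4) / 5

{-# OPTIONS --safe #-}

-- Let s = ⌈2m/5⌉ - 1, so that 5 s < 2 m ≤ 5 s + 5. Given a ranking of the m × m grid with a labels, delete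
-- again and again the vertex of largest label from the component M which joins all four sides. Each
-- deletion lowers the maximal label of M, and such a component persists until the deleted
-- set T either contains a king chain between opposite sides or has m + s - 1 elements.
--
-- In a square of side s containing fewer than s elements of T, the component of the complement of T that
-- contains the free rows and columns dominates: every other component is a minor of it, so that
-- its labels and one label for each element of T in the square rank the whole square.
-- If T has m elements outside of the square and this component lies in M, then
-- r(s, s) ≤ a - m. If it does not lie in M, then it lies in a pocket, a component which
-- cannot touch opposite sides of the grid and which has many boundary cells in T.
-- If this happened to each square with m elements of T outside, then the boundary cells
-- of the pockets together with the cells of the chain would exceed m + s - 1.

module Submission where

open import Data.Bool using (Bool; _xor_; _∧_; false; not; true)
open import Data.Bool.Properties using (xor-comm; xor-same; ∧-zeroʳ)
open import Data.Bool.Solver using (module xor-∧-Solver)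
open import Data.Empty using (⊥; ⊥-elim)
import Data.Fin
open import Data.Fin using (Fin; fromℕ<; inject≤; join; splitAt; toℕ)
open import Data.Fin.Properties using (injective⇒≤; inject≤-injective; join-splitAt; toℕ-fromℕ<; toℕ-injective; toℕ<n)
open import Data.List using (List; []; _∷_; cartesianProduct; filter; length; map; upTo)
open import Data.List.Membership.Propositional using (_∈_; _∉_)
open import Data.List.Membership.Propositional.Properties using (∈-cartesianProduct⁺; ∈-filter⁺; ∈-filter⁻; ∈-map⁺; ∈-upTo⁺)
open import Data.List.Properties using (length-map)
import Data.List.Relation.Unary.All as All
open import Data.List.Relation.Unary.All.Properties using (¬Any⇒All¬)
import Data.List.Relation.Unary.AllPairs as AllPairs
open import Data.List.Relation.Unary.Any using (here; index; there)
open import Data.List.Relation.Unary.Any.Properties using (lookup-index)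
open import Data.List.Relation.Unary.Unique.Propositional using (Unique)
open import Data.List.Relation.Unary.Unique.Propositional.Properties using (filter⁺; map⁻)
open import Data.Nat using (_%_; _*_; _+_; _/_; _<?_; _<_; _∸_; _≟_; _≤?_; _≤_; _⊔_; suc; s≤s; s≤s⁻¹; zero; z≤n; ℕ)
open import Data.Nat.DivMod using (m%n<n; m≡m%n+[m/n]*n)
open import Data.Nat.Properties
open import Data.Nat.Tactic.RingSolver using (solve)
open import Data.Product using (_,_; _×_; proj₁; proj₂; swap; Σ; Σ-syntax; ∃)
open import Data.Product.Properties using (≡-dec)
open import Data.Sum using ([_,_]′; _⊎_; inj₁; inj₂)
open import Data.Unit using (tt; ⊤)
import Defs
open import Defs using (IsPath; IsRankNumber; IsRanking; Rankable; V; ceil2m/5; vertices)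
open import Function using (_∘_; id)
open import Relation.Binary.Definitions using (tri<; tri>; tri≈)
open import Relation.Binary.PropositionalEquality using (_≡_; _≢_; cong; cong₂; refl; subst; subst₂; sym; trans)
open import Relation.Nullary using (Dec; does; no; yes; ¬_)
open import Relation.Nullary.Decidable using (_×-dec_; dec-false; dec-true; decidable-stable; ¬?)

-- The constant 2/5 comes from the chain. A king chain needs at least m - 2 s + 1 steps between the
-- first s and the last s columns, and a detour there and back has at least s cells strictly inside
-- as soon as 5 s < 2 m. These s cells supplement the m last visits of the chain to the rows. The
-- bound 2 m ≤ 5 s + 5 works in the other direction: boundaries of pockets come in multiples of s,
-- and it makes them reach m + s. The obstacle is that a chain has a cell in each row, but maybe
-- inside the square under study. Hence no square is fixed in advance: squares slide along the left
-- and the right side until m cells of `T` are outside, and then a pocket must eat the square. Two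
-- sets are needed because a step has to show that deleting one more vertex v leaves a component
-- joining all sides. Cells are counted in `T`, which contains v; pockets are components for `S`,
-- without v, since only the old `M` is known to reach all four sides. Pockets on opposite sides
-- share no boundary cell, so that their boundaries may be added.

infixr 6 _⊕_
infixr 7 _⊛_

-- Linear arithmetic, classical case distinctions and bounded search

_⊕_ : ∀ {a b c d} → a ≤ b → c ≤ d → a + c ≤ b + d
_⊕_ = +-mono-≤

_⊛_ : ∀ k {a b} → a ≤ b → k * a ≤ k * b
k ⊛ h = *-monoʳ-≤ k h

-- A linear inequality follows from others as soon as some nonnegative combination
-- of these and of its negation reads A ≤ B with A = B + k + 1.
clash : ∀ {A B} k → A ≤ B → A ≡ suc (k + B) → ⊥
clash k h refl = <-irrefl refl (≤-trans (s≤s (m≤n+m _ k)) h)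

by : ∀ {x y} → (suc y ≤ x → ⊥) → x ≤ y
by f = ≮⇒≥ f

NN : ∀ {ℓ} → Set ℓ → Set ℓ
NN A = (A → ⊥) → ⊥

-- The theorem is a negation, hence all case distinctions in its proof may be classical.
_>>=_ : ∀ {ℓ} {A : Set ℓ} → NN A → (A → ⊥) → ⊥
m >>= k = m k

em : ∀ {ℓ} (A : Set ℓ) → NN (Dec A)
em A k = k (no λ a → k (yes a))

-- Double negation passes through a bounded quantifier, so that sets of cells become decidable once
-- they are contained in the grid, see `decGrid`.
choice : ∀ n {A : ℕ → Set} → (∀ i → i < n → NN (A i)) → NN (∀ i → i < n → A i)
choice zero f k = k λ i ()
choice (suc n) {A} f k = do
  g ← choice n (λ i i<n → f i (m≤n⇒m≤1+n i<n))
  a ← f n ≤-refl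
  k λ i i<sn → pick g a i (m<1+n⇒m<n∨m≡n i<sn)
  where
  pick : (∀ i → i < n → A i) → A n → ∀ i → i < n ⊎ i ≡ n → A i
  pick g a i (inj₁ i<n) = g i i<n
  pick g a i (inj₂ refl) = a

least : ∀ {P : ℕ → Set} → (∀ i → Dec (P i)) → ∀ n → P n →
        Σ ℕ λ i → i ≤ n × P i × (∀ j → j < i → ¬ P j)
least P? zero p = zero , z≤n , p , λ j ()
least P? (suc n) p with P? zero
... | yes p₀ = zero , z≤n , p₀ , λ j ()
... | no ¬p₀ with least (P? ∘ suc) n p
...   | i , i≤n , pi , min = suc i , s≤s i≤n , pi , λ { zero _ → ¬p₀ ; (suc j) (s≤s j<i) → min j j<i }

greatest : ∀ {P : ℕ → Set} → (∀ i → Dec (P i)) → ∀ n i → i < n → P i →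
           Σ ℕ λ j → i ≤ j × j < n × P j × (∀ k → j < k → k < n → ¬ P k)
greatest {P} P? (suc n) i (s≤s i≤n) p with P? n
... | yes pn = n , i≤n , ≤-refl , pn , λ k n<k k<sn _ → <⇒≱ n<k (s≤s⁻¹ k<sn)
... | no ¬pn with m≤n⇒m<n∨m≡n i≤n
...   | inj₂ refl = ⊥-elim (¬pn p)
...   | inj₁ i<n with greatest P? n i i<n p
...     | j , i≤j , j<n , pj , max = j , i≤j , m≤n⇒m≤1+n j<n , pj , max′
  where
  max′ : ∀ k → j < k → k < suc n → ¬ P k
  max′ k j<k k<sn pk with m<1+n⇒m<n∨m≡n k<sn
  ... | inj₁ k<n = max k j<k k<n pk
  ... | inj₂ refl = ¬pn pk

-- Cells, adjacency and walks

Cell : Set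
Cell = ℕ × ℕ

row col : Cell → ℕ
row = proj₁
col = proj₂

_≟c_ : (x y : Cell) → Dec (x ≡ y)
_≟c_ = ≡-dec _≟_ _≟_

Grid : ℕ → Cell → Set
Grid n (r , c) = r < n × c < n

grid? : ∀ n x → Dec (Grid n x)
grid? n (r , c) = (r <? n) ×-dec (c <? n)

decGrid : (P : Cell → Set) → ∀ n → (∀ {x} → P x → Grid n x) → NN (∀ x → Dec (P x))
decGrid P n inG k = do
  d ← choice n (λ r _ → choice n (λ c _ → em (P (r , c))))
  k λ x → dec d x (grid? n x)
  where
  dec : (∀ r → r < n → ∀ c → c < n → Dec (P (r , c))) → ∀ x → Dec (Grid n x) → Dec (P x)
  dec d (r , c) (yes (r<n , c<n)) = d r r<n c c<n
  dec d x (no ¬g) = no (¬g ∘ inG)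

data Adj : Cell → Cell → Set where
  east  : ∀ {r c} → Adj (r , c) (r , suc c)
  west  : ∀ {r c} → Adj (r , suc c) (r , c)
  south : ∀ {r c} → Adj (r , c) (suc r , c)
  north : ∀ {r c} → Adj (suc r , c) (r , c)

adj-sym : ∀ {x y} → Adj x y → Adj y x
adj-sym east = west
adj-sym west = east
adj-sym south = north
adj-sym north = south

King : Cell → Cell → Set
King (r , c) (r′ , c′) = (r ≤ suc r′ × r′ ≤ suc r) × (c ≤ suc c′ × c′ ≤ suc c)

king-sym : ∀ {x y} → King x y → King y x
king-sym ((a , b) , (c , d)) = (b , a) , (d , c)

data Walk (R : Cell → Cell → Set) (P : Cell → Set) : Cell → Cell → Set where
  stop : ∀ {x} → P x → Walk R P x x
  go   : ∀ {x y z} → P x → R x y → Walk R P y z → Walk R P x z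

module _ {R : Cell → Cell → Set} {P : Cell → Set} where

  start∈ : ∀ {x y} → Walk R P x y → P x
  start∈ (stop p) = p
  start∈ (go p _ _) = p

  end∈ : ∀ {x y} → Walk R P x y → P y
  end∈ (stop p) = p
  end∈ (go _ _ w) = end∈ w

  _⊙_ : ∀ {x y z} → Walk R P x y → Walk R P y z → Walk R P x z
  stop _ ⊙ w′ = w′
  go p a w ⊙ w′ = go p a (w ⊙ w′)

  reverse : (∀ {x y} → R x y → R y x) → ∀ {x y} → Walk R P x y → Walk R P y x
  reverse R-sym (stop p) = stop p
  reverse R-sym (go p a w) = reverse R-sym w ⊙ go (start∈ w) (R-sym a) (stop p)

  mapWalk : {R′ : Cell → Cell → Set} {P′ : Cell → Set} (σ : Cell → Cell) →
            (∀ {x} → P x → P′ (σ x)) → (∀ {x y} → P x → P y → R x y → R′ (σ x) (σ y)) →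
            ∀ {x y} → Walk R P x y → Walk R′ P′ (σ x) (σ y)
  mapWalk σ f g (stop p) = stop (f p)
  mapWalk σ f g (go p a w) = go (f p) (g p (start∈ w) a) (mapWalk σ f g w)

  weaken : {P′ : Cell → Set} → (∀ {x} → P x → P′ x) → ∀ {x y} → Walk R P x y → Walk R P′ x y
  weaken f = mapWalk id f (λ _ _ a → a)

  -- An invariant preserved by single steps spreads along the walk; with membership in a component
  -- as `I`, the walk never leaves the component.
  confine : {I : Cell → Set} → (∀ {x y} → I x → P x → P y → R x y → I y) →
            ∀ {x y} → I x → Walk R P x y → Walk R (λ z → P z × I z) x y
  confine step i (stop p) = stop (p , i)
  confine step i (go p a w) = go (p , i) a (confine step (step i p (start∈ w) a) w)

  intermediate : (h : Cell → ℕ) → (∀ {x y} → R x y → h y ≤ suc (h x)) →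
                 ∀ {x y} → Walk R P x y → ∀ n → h x ≤ n → n ≤ h y → Σ Cell λ z → P z × h z ≡ n
  intermediate h lip (stop p) n a b = _ , p , ≤-antisym a b
  intermediate h lip {x} (go {y = y} p a w) n hx≤n n≤hz with h x ≟ n
  ... | yes e = x , p , e
  ... | no ¬e = intermediate h lip w n (≤-trans (lip a) (≤∧≢⇒< hx≤n ¬e)) n≤hz

adj-row : ∀ {x y} → Adj x y → row y ≤ suc (row x)
adj-row east = n≤1+n _
adj-row west = n≤1+n _
adj-row south = ≤-refl
adj-row north = ≤-trans (n≤1+n _) (n≤1+n _)

adj-col : ∀ {x y} → Adj x y → col y ≤ suc (col x)
adj-col east = ≤-refl
adj-col west = ≤-trans (n≤1+n _) (n≤1+n _)
adj-col south = n≤1+n _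
adj-col north = n≤1+n _

rowWalk : ∀ {P : Cell → Set} r c n → (∀ i → c ≤ i → i ≤ c + n → P (r , i)) →
          Walk Adj P (r , c) (r , c + n)
rowWalk r c zero f rewrite +-identityʳ c = stop (f c ≤-refl ≤-refl)
rowWalk {P} r c (suc n) f rewrite +-suc c n =
  go (f c ≤-refl (m≤n⇒m≤1+n (m≤m+n c n))) east
     (rowWalk r (suc c) n λ i lo hi → f i (≤-trans (n≤1+n c) lo) hi)

colWalk : ∀ {P : Cell → Set} r c n → (∀ i → r ≤ i → i ≤ r + n → P (i , c)) →
          Walk Adj P (r , c) (r + n , c)
colWalk r c zero f rewrite +-identityʳ r = stop (f r ≤-refl ≤-refl)
colWalk {P} r c (suc n) f rewrite +-suc r n =
  go (f r ≤-refl (m≤n⇒m≤1+n (m≤m+n r n))) south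
     (colWalk (suc r) c n λ i lo hi → f i (≤-trans (n≤1+n r) lo) hi)

eastWalk : ∀ {P : Cell → Set} r c c′ → c ≤ c′ → (∀ i → c ≤ i → i ≤ c′ → P (r , i)) →
           Walk Adj P (r , c) (r , c′)
eastWalk {P} r c c′ le f with rowWalk {P} r c (c′ ∸ c)
... | w rewrite m+[n∸m]≡n le = w f

southWalk : ∀ {P : Cell → Set} r r′ c → r ≤ r′ → (∀ i → r ≤ i → i ≤ r′ → P (i , c)) →
            Walk Adj P (r , c) (r′ , c)
southWalk {P} r r′ c le f with colWalk {P} r c (r′ ∸ r)
... | w rewrite m+[n∸m]≡n le = w f

lineWalk : ∀ {P : Cell → Set} n r → (∀ i → i < n → P (r , i)) → ∀ {c c′} → c < n → c′ < n →
           Walk Adj P (r , c) (r , c′)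
lineWalk n r f {c} {c′} c<n c′<n with ≤-total c c′
... | inj₁ le = eastWalk r c c′ le λ i _ hi → f i (≤-<-trans hi c′<n)
... | inj₂ le = reverse adj-sym (eastWalk r c′ c le λ i _ hi → f i (≤-<-trans hi c<n))

fileWalk : ∀ {P : Cell → Set} n c → (∀ i → i < n → P (i , c)) → ∀ {r r′} → r < n → r′ < n →
           Walk Adj P (r , c) (r′ , c)
fileWalk n c f {r} {r′} r<n r′<n with ≤-total r r′
... | inj₁ le = southWalk r r′ c le λ i _ hi → f i (≤-<-trans hi r′<n)
... | inj₂ le = reverse adj-sym (southWalk r′ r c le λ i _ hi → f i (≤-<-trans hi r<n))

-- Counting by injections

record Pack (n : ℕ) (P : Cell → Set) : Set where
  constructor mkPack
  field
    entry : Fin n → Cell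
    inj : ∀ {i j} → entry i ≡ entry j → i ≡ j
    sat : ∀ i → P (entry i)
open Pack public

-- A pack asserts that a set has at least n cells; the set need be neither decidable nor listed. All
-- counts form disjoint unions of packs and compare them with an upper bound.
module _ {P Q : Cell → Set} where

  packMap : ∀ {n} (σ : Cell → Cell) → (∀ {x} → P x → Q (σ x)) →
            (∀ {x y} → P x → P y → σ x ≡ σ y → x ≡ y) → Pack n P → Pack n Q
  packMap σ f σ-inj p = mkPack (σ ∘ entry p) (λ e → inj p (σ-inj (sat p _) (sat p _) e)) (f ∘ sat p)

  packWeaken : ∀ {n} → (∀ {x} → P x → Q x) → Pack n P → Pack n Q
  packWeaken f = packMap id f (λ _ _ e → e)

  packUnion : ∀ {a b} → Pack a P → Pack b Q → (∀ {x} → P x → Q x → ⊥) → Pack (a + b) (λ x → P x ⊎ Q x)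
  packUnion {a} {b} p q disj = mkPack (f ∘ splitAt a) inj′ (λ i → sat′ (splitAt a i))
    where
    f : Fin a ⊎ Fin b → Cell
    f = [ entry p , entry q ]′
    f-inj : ∀ u v → f u ≡ f v → u ≡ v
    f-inj (inj₁ i) (inj₁ j) e = cong inj₁ (inj p e)
    f-inj (inj₂ i) (inj₂ j) e = cong inj₂ (inj q e)
    f-inj (inj₁ i) (inj₂ j) e = ⊥-elim (disj (sat p i) (subst Q (sym e) (sat q j)))
    f-inj (inj₂ i) (inj₁ j) e = ⊥-elim (disj (sat p j) (subst Q e (sat q i)))
    inj′ : ∀ {i j} → f (splitAt a i) ≡ f (splitAt a j) → i ≡ j
    inj′ {i} {j} e = trans (sym (join-splitAt a b i)) (trans (cong (join a b) (f-inj (splitAt a i) (splitAt a j) e)) (join-splitAt a b j))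
    sat′ : ∀ u → P (f u) ⊎ Q (f u)
    sat′ (inj₁ i) = inj₁ (sat p i)
    sat′ (inj₂ j) = inj₂ (sat q j)

packTake : ∀ {P : Cell → Set} {a b} → a ≤ b → Pack b P → Pack a P
packTake le p = mkPack (λ i → entry p (inject≤ i le)) (λ e → inject≤-injective le le _ _ (inj p e)) (λ i → sat p (inject≤ i le))

packLength : ∀ {n} {L : List Cell} → Pack n (_∈ L) → n ≤ length L
packLength {L = L} p = injective⇒≤ {f = index ∘ sat p} λ {i} {j} e →
  inj p (trans (lookup-index (sat p i)) (trans (cong (Data.List.lookup L) e) (sym (lookup-index (sat p j)))))

packIndex : ∀ {P : Cell → Set} a n (f : ∀ i → a ≤ i → i < a + n → Cell) →
            (∀ i lo hi j lo′ hi′ → f i lo hi ≡ f j lo′ hi′ → i ≡ j) → (∀ i lo hi → P (f i lo hi)) → Pack n P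
packIndex a n f f-inj f-sat = mkPack g (λ e → toℕ-injective (+-cancelˡ-≡ a _ _ (f-inj _ _ _ _ _ _ e))) (λ i → f-sat _ _ _)
  where
  g : Fin n → Cell
  g i = f (a + toℕ i) (m≤m+n a _) (+-monoʳ-< a (toℕ<n i))

packRows : ∀ {P : Cell → Set} a n → (∀ r → a ≤ r → r < a + n → Σ ℕ λ c → P (r , c)) →
           Pack n (λ x → P x × (a ≤ row x × row x < a + n))
packRows a n f = packIndex a n (λ r lo hi → r , proj₁ (f r lo hi)) (λ _ _ _ _ _ _ → cong proj₁)
                   (λ r lo hi → proj₂ (f r lo hi) , lo , hi)

packCols : ∀ {P : Cell → Set} a n → (∀ c → a ≤ c → c < a + n → Σ ℕ λ r → P (r , c)) →
           Pack n (λ x → P x × (a ≤ col x × col x < a + n))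
packCols a n f = packIndex a n (λ c lo hi → proj₁ (f c lo hi) , c) (λ _ _ _ _ _ _ → cong proj₂)
                   (λ c lo hi → proj₂ (f c lo hi) , lo , hi)

packOne : ∀ {P : Cell → Set} x → P x → Pack 1 P
packOne x p = mkPack (λ _ → x) (λ { {Fin.zero} {Fin.zero} _ → refl }) (λ _ → p)

-- Symmetries of the square grid

record Symmetry (n : ℕ) : Set where
  field
    to     : Cell → Cell
    onGrid : ∀ {x} → Grid n x → Grid n (to x)
    onAdj  : ∀ {x y} → Grid n x → Grid n y → Adj x y → Adj (to x) (to y)
    onKing : ∀ {x y} → Grid n x → Grid n y → King x y → King (to x) (to y)
    invol  : ∀ {x} → Grid n x → to (to x) ≡ x
open Symmetry public

transpose : ∀ n → Symmetry n
transpose n = record { to = swap ; onGrid = swap ; onAdj = λ _ _ → tr ; onKing = λ _ _ → swap ; invol = λ _ → refl }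
  where
  tr : ∀ {x y} → Adj x y → Adj (swap x) (swap y)
  tr east = south
  tr west = north
  tr south = east
  tr north = west

-- On a line of n cells, mirror n is the reflection; it is junk outside of the line.
mirror : ℕ → ℕ → ℕ
mirror n c = n ∸ suc c

mirror-+ : ∀ {n c} → c < n → mirror n c + suc c ≡ n
mirror-+ c<n = m∸n+n≡m c<n

mirror-< : ∀ {n c} → c < n → mirror n c < n
mirror-< {n} {c} c<n = go′ (mirror n c) (mirror-+ c<n)
  where
  go′ : ∀ a → a + suc c ≡ n → a < n
  go′ a e = by λ neg → clash c (≤-reflexive e ⊕ neg) (solve (a ∷ n ∷ c ∷ []))

mirror-invol : ∀ {n c} → c < n → mirror n (mirror n c) ≡ c
mirror-invol {n} {c} c<n = go′ (mirror n c) (mirror n (mirror n c)) (mirror-+ c<n) (mirror-+ (mirror-< c<n))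
  where
  go′ : ∀ a b → a + suc c ≡ n → b + suc a ≡ n → b ≡ c
  go′ a b e e′ = ≤-antisym (by λ neg → clash 0 (≤-reflexive (sym e) ⊕ ≤-reflexive e′ ⊕ neg) (solve (a ∷ b ∷ n ∷ c ∷ []))) (by λ neg → clash 0 (≤-reflexive e ⊕ neg ⊕ ≤-reflexive (sym e′)) (solve (a ∷ b ∷ n ∷ c ∷ [])))

mirror-suc : ∀ {n c} → suc c < n → mirror n c ≡ suc (mirror n (suc c))
mirror-suc {n} {c} c<n = go′ (mirror n c) (mirror n (suc c)) (mirror-+ (<-trans ≤-refl c<n)) (mirror-+ c<n)
  where
  go′ : ∀ a b → a + suc c ≡ n → b + suc (suc c) ≡ n → a ≡ suc b
  go′ a b e e′ = ≤-antisym (by λ neg → clash 0 (≤-reflexive e ⊕ neg ⊕ ≤-reflexive (sym e′)) (solve (a ∷ b ∷ n ∷ c ∷ []))) (by λ neg → clash 0 (≤-reflexive e′ ⊕ neg ⊕ ≤-reflexive (sym e)) (solve (a ∷ b ∷ n ∷ c ∷ [])))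

mirror-≤ : ∀ {n c c′} → c < n → c′ < n → c′ ≤ suc c → mirror n c ≤ suc (mirror n c′)
mirror-≤ {n} {c} {c′} c<n c′<n = go′ (mirror n c) (mirror n c′) (mirror-+ c<n) (mirror-+ c′<n)
  where
  go′ : ∀ a b → a + suc c ≡ n → b + suc c′ ≡ n → c′ ≤ suc c → a ≤ suc b
  go′ a b e e′ h = by λ neg → clash 0 (≤-reflexive e ⊕ neg ⊕ ≤-reflexive (sym e′) ⊕ h) (solve (a ∷ b ∷ n ∷ c ∷ c′ ∷ []))

flip↔ : ∀ n → Symmetry n
flip↔ n = record { to = f ; onGrid = λ (a , b) → a , mirror-< b ; onAdj = ad
                 ; onKing = λ (_ , b) (_ , b′) (h , k , k′) → h , mirror-≤ b b′ k′ , mirror-≤ b′ b k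
                 ; invol = λ (a , b) → cong (_ ,_) (mirror-invol b) }
  where
  f : Cell → Cell
  f (r , c) = r , mirror n c
  ad : ∀ {x y} → Grid n x → Grid n y → Adj x y → Adj (f x) (f y)
  ad {r , c} _ (_ , b) east rewrite mirror-suc b = west
  ad {r , suc c} (_ , b) _ west rewrite mirror-suc b = east
  ad _ _ south = south
  ad _ _ north = north

open import Data.List.Membership.DecPropositional _≟c_ using (_∈?_)

-- Simple walks, rankings of sets of cells, and minors

module _ {R : Cell → Cell → Set} {P : Cell → Set} where

  cells : ∀ {x y} → Walk R P x y → List Cell
  cells (stop {x} _) = x ∷ []
  cells (go {x} _ _ w) = x ∷ cells w

  cells-P : ∀ {x y z} (w : Walk R P x y) → z ∈ cells w → P z
  cells-P (stop p) (here refl) = p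
  cells-P (go p _ _) (here refl) = p
  cells-P (go _ _ w) (there m) = cells-P w m

  suffix : ∀ {x y z} (w : Walk R P y z) → Unique (cells w) → x ∈ cells w →
           Σ[ w′ ∈ Walk R P x z ] Unique (cells w′)
  suffix w@(stop _) u (here refl) = w , u
  suffix w@(go _ _ _) u (here refl) = w , u
  suffix (go _ _ w) (_ AllPairs.∷ u) (there m) = suffix w u m

  -- Loop erasure: if the first cell occurs again later, the walk restarts at that occurrence.
  simple : ∀ {x y} → Walk R P x y → Σ[ w ∈ Walk R P x y ] Unique (cells w)
  simple (stop p) = stop p , All.[] AllPairs.∷ AllPairs.[]
  simple (go {x} p a w) with simple w
  ... | w′ , u with x ∈? cells w′
  ...   | yes m = suffix w′ u m
  ...   | no ¬m = go p a w′ , ¬Any⇒All¬ _ ¬m AllPairs.∷ u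

-- `sep` speaks of walks with labels at most `f u`, where a ranking speaks of paths: walks can be
-- mapped and concatenated without care for repetitions, and `simple` leads back to paths.
record Ranks (j : ℕ) (f : Cell → ℕ) (P : Cell → Set) : Set where
  field
    pos : ∀ {x} → P x → 1 ≤ f x
    ub  : ∀ {x} → P x → f x ≤ j
    sep : ∀ {u v} → P u → P v → u ≢ v → f u ≡ f v → ¬ Walk Adj (λ z → P z × f z ≤ f u) u v
open Ranks public

ranksPull : ∀ {j j′ f} {P X : Cell → Set} (σ : Cell → Cell) → (∀ {x} → X x → P (σ x)) →
            (∀ {x y} → X x → X y → Adj x y → Adj (σ x) (σ y)) → (∀ {x y} → X x → X y → σ x ≡ σ y → x ≡ y) →
            (∀ {x} → X x → f (σ x) ≤ j′) → Ranks j f P → Ranks j′ (f ∘ σ) X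
ranksPull σ into adj σ-inj bound ρ = record
  { pos = pos ρ ∘ into
  ; ub = bound
  ; sep = λ pu pv u≢v e w → sep ρ (into pu) (into pv) (u≢v ∘ σ-inj pu pv) e
            (mapWalk σ (λ (p , le) → into p , le) (λ p q → adj (proj₁ p) (proj₁ q)) w) }

ranksShrink : ∀ {j j′ f} {P X : Cell → Set} → (∀ {x} → X x → P x) → (∀ {x} → X x → f x ≤ j′) →
              Ranks j f P → Ranks j′ f X
ranksShrink sub = ranksPull id sub (λ _ _ a → a) (λ _ _ e → e)

choiceGrid : ∀ n {A : Cell → Set} → (∀ x → NN (A x)) → NN (∀ x → Grid n x → A x)
choiceGrid n f k = do
  g ← choice n (λ r _ → choice n (λ c _ → f (r , c)))
  k λ (r , c) (r<n , c<n) → g r r<n c c<n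

-- Each larger value uses up one unit of `fuel`, and no value exceeds `j`.
maximum : ∀ {B : Cell → Set} (f : Cell → ℕ) j → (∀ {y} → B y → f y ≤ j) → ∀ fuel y → B y → j ≤ fuel + f y →
          NN (Σ[ z ∈ Cell ] B z × (∀ {y} → B y → f y ≤ f z))
maximum {B} f j bound zero y b j≤ k = k (y , b , λ b′ → ≤-trans (bound b′) j≤)
maximum {B} f j bound (suc n) y b j≤ k = do
  yes (z , b′ , y<z) ← em (Σ[ z ∈ Cell ] B z × f y < f z)
    where no ¬z → k (y , b , λ b′ → ≮⇒≥ λ lt → ¬z (_ , b′ , lt))
  maximum f j bound n z b′ (≤-trans j≤ (≤-trans (≤-reflexive (sym (+-suc n _))) (+-monoʳ-≤ n y<z))) k

-- The sets `B x` are the branch sets of a minor of `M`, and x gets the largest label on `B x`. A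
-- forbidden walk between x and x′ would lift, branch set by branch set, to a forbidden walk in `M`
-- between the cells of the two maxima.
module Minor {j f} {M X : Cell → Set} (ρ : Ranks j f M) (n : ℕ) (inG : ∀ {x} → X x → Grid n x)
  (B : Cell → Cell → Set)
  (B-in : ∀ {x y} → X x → B x y → M y)
  (B-inhabited : ∀ {x} → X x → Σ Cell (B x))
  (B-disjoint : ∀ {x x′ y} → X x → X x′ → B x y → B x′ y → x ≡ x′)
  (B-connected : ∀ {x y y′} → X x → B x y → B x y′ → Walk Adj (B x) y y′)
  (B-adjacent : ∀ {x x′} → X x → X x′ → Adj x x′ → Σ[ y ∈ Cell ] Σ[ y′ ∈ Cell ] B x y × B x′ y′ × Adj y y′)
  where

  Top : Cell → Cell → Set
  Top x y = X x → B x y × (∀ {y′} → B x y′ → f y′ ≤ f y)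

  top : ∀ x → NN (Σ Cell (Top x))
  top x k = do
    yes p ← em (X x)
      where no ¬p → k (x , λ p → ⊥-elim (¬p p))
    let y , b = B-inhabited p
    z , b′ , max ← maximum f j (ub ρ ∘ B-in p) j y b (m≤m+n j (f y))
    k (z , λ _ → b′ , max)

  minor : NN (Σ[ g ∈ (Cell → ℕ) ] Ranks j g X)
  minor k = do
    t ← choiceGrid n top
    k (result t)
    where
    result : (∀ x → Grid n x → Σ Cell (Top x)) → Σ[ g ∈ (Cell → ℕ) ] Ranks j g X
    result t = f ∘ rep , record
      { pos = λ p → pos ρ (B-in p (rep∈ p))
      ; ub = λ p → ub ρ (B-in p (rep∈ p))
      ; sep = λ pu pv u≢v e w → sep ρ (B-in pu (rep∈ pu)) (B-in pv (rep∈ pv))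
                (λ e′ → u≢v (B-disjoint pu pv (rep∈ pu) (subst (B _) (sym e′) (rep∈ pv)))) e (lift w (rep∈ pu) (rep∈ pv)) }
      where
      rep : Cell → Cell
      rep x with grid? n x
      ... | yes g = proj₁ (t x g)
      ... | no _ = x
      rep-top : ∀ x → Grid n x → Top x (rep x)
      rep-top x g with grid? n x
      ... | yes g′ = proj₂ (t x g′)
      ... | no ¬g = ⊥-elim (¬g g)
      rep∈ : ∀ {x} → X x → B x (rep x)
      rep∈ p = proj₁ (rep-top _ (inG p) p)
      inside : ∀ {x y y′ l} → X x → f (rep x) ≤ l → Walk Adj (B x) y y′ → Walk Adj (λ z → M z × f z ≤ l) y y′
      inside p le = weaken λ b → B-in p b , ≤-trans (proj₂ (rep-top _ (inG p) p) b) le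
      lift : ∀ {l x x′ y y′} → Walk Adj (λ z → X z × f (rep z) ≤ l) x x′ → B x y → B x′ y′ →
             Walk Adj (λ z → M z × f z ≤ l) y y′
      lift (stop (p , le)) b b′ = inside p le (B-connected p b b′)
      lift (go (p , le) a w) b b′ with B-adjacent p (proj₁ (start∈ w)) a
      ... | y₁ , y₂ , b₁ , b₂ , a′ with inside p le (B-connected p b b₁)
      ...   | w₁ = w₁ ⊙ go (end∈ w₁) a′ (lift w b₂ b′)

module _ {j : ℕ} (n : ℕ) {P : Cell → Set} (inG : ∀ {x} → P x → Grid n x)
         (ranked : ∀ {x} → P x → NN (Σ[ g ∈ (Cell → ℕ) ] Ranks j g (Walk Adj P x))) where

  private
    Hull : List Cell → Cell → Set
    Hull [] y = ⊥
    Hull (x ∷ L) y = Walk Adj P x y ⊎ Hull L y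

    hull-P : ∀ L {y} → Hull L y → P y
    hull-P (x ∷ L) (inj₁ w) = end∈ w
    hull-P (x ∷ L) (inj₂ h) = hull-P L h

    hull-closed : ∀ L {y z} → Hull L y → Walk Adj P y z → Hull L z
    hull-closed (x ∷ L) (inj₁ w) w′ = inj₁ (w ⊙ w′)
    hull-closed (x ∷ L) (inj₂ h) w′ = inj₂ (hull-closed L h w′)

    -- Walks stay in one component, so that each may be labelled on its own. The hull grows by one
    -- component at a time, unless the new base point is off `P` or already covered.
    rankHull : ∀ L → NN (Σ[ g ∈ (Cell → ℕ) ] Ranks j g (Hull L))
    rankHull [] k = k ((λ _ → 0) , record { pos = λ () ; ub = λ () ; sep = λ () })
    rankHull (x ∷ L) k = do
      g , ρ ← rankHull L
      yes p ← em (P x)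
        where no ¬p → k (g , ranksShrink (λ { (inj₁ w) → ⊥-elim (¬p (start∈ w)) ; (inj₂ h) → h })
                               (λ { (inj₁ w) → ⊥-elim (¬p (start∈ w)) ; (inj₂ h) → ub ρ h }) ρ)
      no ¬h ← em (Hull L x)
        where yes h → k (g , ranksShrink (λ { (inj₁ w) → hull-closed L h w ; (inj₂ h) → h })
                               (λ { (inj₁ w) → ub ρ (hull-closed L h w) ; (inj₂ h) → ub ρ h }) ρ)
      W? ← decGrid (Walk Adj P x) n (inG ∘ end∈)
      g′ , ρ′ ← ranked p
      k (glue ρ p ¬h W? ρ′)
      where
      glue : ∀ {g g′} → Ranks j g (Hull L) → P x → ¬ Hull L x → (∀ y → Dec (Walk Adj P x y)) →
             Ranks j g′ (Walk Adj P x) → Σ[ g ∈ (Cell → ℕ) ] Ranks j g (Hull (x ∷ L))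
      glue {g} {g′} ρ p ¬h W? ρ′ = h , record
        { pos = pos′ ; ub = ub′ ; sep = sep′ }
        where
        h : Cell → ℕ
        h y with W? y
        ... | yes _ = g′ y
        ... | no _ = g y
        h-in : ∀ {y} → Walk Adj P x y → h y ≡ g′ y
        h-in {y} w with W? y
        ... | yes _ = refl
        ... | no ¬w = ⊥-elim (¬w w)
        h-out : ∀ {y} → Hull L y → h y ≡ g y
        h-out {y} hy with W? y
        ... | no _ = refl
        ... | yes w = ⊥-elim (¬h (hull-closed L hy (reverse adj-sym w)))
        pos′ : ∀ {y} → Hull (x ∷ L) y → 1 ≤ h y
        pos′ (inj₁ w) = subst (1 ≤_) (sym (h-in w)) (pos ρ′ w)
        pos′ (inj₂ hy) = subst (1 ≤_) (sym (h-out hy)) (pos ρ hy)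
        ub′ : ∀ {y} → Hull (x ∷ L) y → h y ≤ j
        ub′ (inj₁ w) = subst (_≤ j) (sym (h-in w)) (ub ρ′ w)
        ub′ (inj₂ hy) = subst (_≤ j) (sym (h-out hy)) (ub ρ hy)
        sep′ : ∀ {u v} → Hull (x ∷ L) u → Hull (x ∷ L) v → u ≢ v → h u ≡ h v →
               ¬ Walk Adj (λ z → Hull (x ∷ L) z × h z ≤ h u) u v
        sep′ (inj₁ w) _ u≢v e wk = sep ρ′ w (proj₂ (end∈ wk′)) u≢v (trans (sym (h-in w)) (trans e (h-in (proj₂ (end∈ wk′)))))
          (weaken (λ ((_ , le) , w′) → w′ , subst₂ _≤_ (h-in w′) (h-in w) le) wk′)
          where
          wk′ = confine {I = Walk Adj P x} (λ i _ (q , _) a → i ⊙ go (end∈ i) a (stop (hull-P (x ∷ L) q))) w wk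
        sep′ (inj₂ hu) _ u≢v e wk = sep ρ hu (proj₂ (end∈ wk′)) u≢v (trans (sym (h-out hu)) (trans e (h-out (proj₂ (end∈ wk′)))))
          (weaken (λ ((_ , le) , w′) → w′ , subst₂ _≤_ (h-out w′) (h-out hu) le) wk′)
          where
          wk′ = confine {I = Hull L} (λ i _ (q , _) a → hull-closed L i (go (hull-P L i) a (stop (hull-P (x ∷ L) q)))) hu wk

    allCells : List Cell
    allCells = cartesianProduct (upTo n) (upTo n)

    hull-all : ∀ L {y} → y ∈ L → P y → Hull L y
    hull-all (_ ∷ L) (here refl) p = inj₁ (stop p)
    hull-all (_ ∷ L) (there m) p = inj₂ (hull-all L m p)

    ∈-all : ∀ {y} → P y → Hull allCells y
    ∈-all p = let r<n , c<n = inG p in hull-all allCells (∈-cartesianProduct⁺ (∈-upTo⁺ r<n) (∈-upTo⁺ c<n)) p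

  ranksComponents : NN (Σ[ g ∈ (Cell → ℕ) ] Ranks j g P)
  ranksComponents k = do
    g , ρ ← rankHull allCells
    k (g , ranksShrink ∈-all (ub ρ ∘ ∈-all) ρ)

-- The head of the list gets a label above all others, so that no walk with smaller labels passes
-- through it.
ranksAdd : ∀ {j g} {P : Cell → Set} → Ranks j g P → ∀ L →
           Σ[ g′ ∈ (Cell → ℕ) ] Ranks (length L + j) g′ (λ x → P x ⊎ x ∈ L)
ranksAdd {g = g} ρ [] = g , ranksShrink (λ { (inj₁ p) → p }) (λ { (inj₁ p) → ub ρ p }) ρ
ranksAdd {j} {P = P} ρ₀ (v ∷ L) with ranksAdd ρ₀ L
... | g , ρ = h , record { pos = pos′ ; ub = ub′ ; sep = sep′ }
  where
  N = length L + j
  Q Q′ : Cell → Set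
  Q x = P x ⊎ x ∈ L
  Q′ x = P x ⊎ x ∈ v ∷ L
  h : Cell → ℕ
  h x with x ≟c v
  ... | yes _ = suc N
  ... | no _ = g x
  h-v : ∀ {x} → x ≡ v → h x ≡ suc N
  h-v {x} e with x ≟c v
  ... | yes _ = refl
  ... | no ¬e = ⊥-elim (¬e e)
  h-≢ : ∀ {x} → x ≢ v → h x ≡ g x
  h-≢ {x} ¬e with x ≟c v
  ... | yes e = ⊥-elim (¬e e)
  ... | no _ = refl
  rest : ∀ {x} → x ≢ v → Q′ x → Q x
  rest _ (inj₁ p) = inj₁ p
  rest ¬e (inj₂ (here e)) = ⊥-elim (¬e e)
  rest _ (inj₂ (there m)) = inj₂ m
  pos′ : ∀ {x} → Q′ x → 1 ≤ h x
  pos′ {x} q with x ≟c v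
  ... | yes _ = s≤s z≤n
  ... | no ¬e = pos ρ (rest ¬e q)
  ub′ : ∀ {x} → Q′ x → h x ≤ suc N
  ub′ {x} q with x ≟c v
  ... | yes _ = ≤-refl
  ... | no ¬e = m≤n⇒m≤1+n (ub ρ (rest ¬e q))
  sep′ : ∀ {x y} → Q′ x → Q′ y → x ≢ y → h x ≡ h y → ¬ Walk Adj (λ z → Q′ z × h z ≤ h x) x y
  sep′ {x} {y} qx qy x≢y e w with x ≟c v | y ≟c v
  ... | yes refl | yes refl = x≢y refl
  ... | yes refl | no ¬e = <⇒≱ (s≤s (ub ρ (rest ¬e qy))) (≤-reflexive e)
  ... | no ¬e | yes refl = <⇒≱ (s≤s (ub ρ (rest ¬e qx))) (≤-reflexive (sym e))
  ... | no x≢v | no y≢v = sep ρ (rest x≢v qx) (rest y≢v qy) x≢y e (weaken low w)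
    where
    low : ∀ {z} → Q′ z × h z ≤ g x → Q z × g z ≤ g x
    low {z} (q , le) = rest z≢v q , subst (_≤ g x) (h-≢ z≢v) le
      where
      z≢v : z ≢ v
      z≢v e = <⇒≱ (s≤s (ub ρ (rest x≢v qx))) (subst (_≤ g x) (h-v e) le)

-- Translation between the two forms of rankings

module _ {m : ℕ} where

  toV : ∀ x → Grid m x → V m m
  toV x (a , b) = fromℕ< a , fromℕ< b

  fromV : V m m → Cell
  fromV (i , j) = toℕ i , toℕ j

  fromV-grid : ∀ u → Grid m (fromV u)
  fromV-grid (i , j) = toℕ<n i , toℕ<n j

  fromV-inj : ∀ {u v} → fromV u ≡ fromV v → u ≡ v
  fromV-inj e = cong₂ _,_ (toℕ-injective (cong proj₁ e)) (toℕ-injective (cong proj₂ e))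

  fromV-toV : ∀ x g → fromV (toV x g) ≡ x
  fromV-toV x (a , b) = cong₂ _,_ (toℕ-fromℕ< a) (toℕ-fromℕ< b)

  toV-irrelevant : ∀ x g g′ → toV x g ≡ toV x g′
  toV-irrelevant x g g′ = fromV-inj (trans (fromV-toV x g) (sym (fromV-toV x g′)))

  adj-toV : ∀ {u v x y} → fromV u ≡ x → fromV v ≡ y → Adj x y → Defs.Adj u v
  adj-toV {u} {v} e e′ a = conv a (cong proj₁ e) (cong proj₂ e) (cong proj₁ e′) (cong proj₂ e′)
    where
    conv : ∀ {x y} → Adj x y → row (fromV u) ≡ row x → col (fromV u) ≡ col x →
           row (fromV v) ≡ row y → col (fromV v) ≡ col y → Defs.Adj u v
    conv east a b c d = inj₁ (toℕ-injective (trans a (sym c)) , inj₂ (trans d (cong suc (sym b))))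
    conv west a b c d = inj₁ (toℕ-injective (trans a (sym c)) , inj₁ (trans b (cong suc (sym d))))
    conv south a b c d = inj₂ (inj₂ (trans c (cong suc (sym a))) , toℕ-injective (trans b (sym d)))
    conv north a b c d = inj₂ (inj₁ (trans a (cong suc (sym c))) , toℕ-injective (trans b (sym d)))

  fromV-adj : ∀ {u v} → Defs.Adj u v → Adj (fromV u) (fromV v)
  fromV-adj {_ , b} {_ , d} (inj₁ (refl , inj₁ e)) rewrite e = west
  fromV-adj {_ , b} {_ , d} (inj₁ (refl , inj₂ e)) rewrite e = east
  fromV-adj (inj₂ (inj₁ e , refl)) rewrite e = north
  fromV-adj (inj₂ (inj₂ e , refl)) rewrite e = south

  module _ {P : Cell → Set} (inG : ∀ {x} → P x → Grid m x) where

    toDefs : ∀ {x y} (w : Walk Adj P x y) → Defs.Walk (toV x (inG (start∈ w))) (toV y (inG (end∈ w)))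
    toDefs (stop p) = Defs.here _
    toDefs (go p a w) = Defs.step (adj-toV (fromV-toV _ (inG p)) (fromV-toV _ (inG (start∈ w))) a) (toDefs w)

    toDefs-vertices : ∀ {x y} (w : Walk Adj P x y) → map fromV (vertices (toDefs w)) ≡ cells w
    toDefs-vertices (stop p) = cong (_∷ []) (fromV-toV _ (inG p))
    toDefs-vertices (go p a w) = cong₂ _∷_ (fromV-toV _ (inG p)) (toDefs-vertices w)

  fromDefs : ∀ {P : Cell → Set} {u v} (p : Defs.Walk u v) → (∀ {w} → w ∈ vertices p → P (fromV w)) →
             Walk Adj P (fromV u) (fromV v)
  fromDefs (Defs.here u) all = stop (all (here refl))
  fromDefs (Defs.step a p) all = go (all (here refl)) (fromV-adj a) (fromDefs p (all ∘ there))

ranking→Ranks : ∀ {m k f} → IsRanking m m k f → Σ[ g ∈ (Cell → ℕ) ] Ranks k g (Grid m)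
ranking→Ranks {m} {k} {f} (bounds , paths) = g , record
  { pos = λ {x} p → subst (1 ≤_) (sym (g-toV p)) (proj₁ (bounds _))
  ; ub = λ {x} p → subst (_≤ k) (sym (g-toV p)) (proj₂ (bounds _))
  ; sep = sep′ }
  where
  g : Cell → ℕ
  g x with grid? m x
  ... | yes p = f (toV x p)
  ... | no _ = 0
  g-toV : ∀ {x} p → g x ≡ f (toV x p)
  g-toV {x} p with grid? m x
  ... | yes p′ = cong f (toV-irrelevant x p′ p)
  ... | no ¬p = ⊥-elim (¬p p)
  sep′ : ∀ {u v} → Grid m u → Grid m v → u ≢ v → g u ≡ g v → ¬ Walk Adj (λ z → Grid m z × g z ≤ g u) u v
  sep′ {u} {v} _ _ u≢v e w₀ = contra (paths _ _ toV-≢ (trans (sym (g-toV gu)) (trans e (g-toV gv))) q q-path)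
    where
    w = proj₁ (simple w₀)
    gu = proj₁ (start∈ w)
    gv = proj₁ (end∈ w)
    q = toDefs proj₁ w
    q-path : IsPath q
    q-path = map⁻ (subst Unique (sym (toDefs-vertices proj₁ w)) (proj₂ (simple w₀)))
    toV-≢ : toV u gu ≢ toV v gv
    toV-≢ e′ = u≢v (trans (sym (fromV-toV u gu)) (trans (cong fromV e′) (fromV-toV v gv)))
    contra : (∃ λ z → z ∈ vertices q × f (toV u gu) < f z) → ⊥
    contra (z , z∈ , lt) = <⇒≱ lt (subst₂ _≤_ (trans (g-toV (fromV-grid z)) (cong f (fromV-inj (fromV-toV (fromV z) (fromV-grid z))))) (g-toV gu)
      (proj₂ (cells-P w (subst (fromV z ∈_) (toDefs-vertices proj₁ w) (∈-map⁺ fromV z∈)))))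

Ranks→rankable : ∀ {m k g} → Ranks k g (Grid m) → Rankable m m k
Ranks→rankable {m} {k} {g} ρ = g ∘ fromV , (λ x → pos ρ (fromV-grid x) , ub ρ (fromV-grid x)) , paths
  where
  open import Data.List.Relation.Unary.Any using (any?)
  open import Data.List.Membership.Propositional using (find; lose)
  paths : (u v : V m m) → u ≢ v → g (fromV u) ≡ g (fromV v) → (p : Defs.Walk u v) → IsPath p →
          ∃ λ w → w ∈ vertices p × g (fromV u) < g (fromV w)
  paths u v u≢v e p _ with any? (λ w → g (fromV u) <? g (fromV w)) (vertices p)
  ... | yes a = find a
  ... | no ¬a = ⊥-elim (sep ρ (fromV-grid u) (fromV-grid v) (u≢v ∘ fromV-inj) e
                  (fromDefs p λ {w} m → fromV-grid w , ≮⇒≥ λ lt → ¬a (lose m lt)))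

-- Crossing walks and duality in the grid

open xor-∧-Solver using (_:+_; _:*_; _:=_) renaming (solve to solveBool)

does-cong : ∀ {A B : Set} (a : Dec A) (b : Dec B) → (A → B) → (B → A) → does a ≡ does b
does-cong (yes a) b f g = sym (dec-true b (f a))
does-cong (no ¬a) b f g = sym (dec-false b (¬a ∘ g))

-- A walk from top to bottom meets every walk from left to right: the parity of the crossings
-- of the first walk to the left of a cell is constant along the second walk.

module Crossing {n : ℕ} {D : Cell → Set} (inG : ∀ {x} → D x → Grid n x) where

  private
    above : ℕ → Cell → Bool
    above r x = does (row x ≤? r)

    left : ℕ → Cell → Bool
    left c x = does (col x <? c)

    -- The walk is continued by one step to the south of its last cell, so that it leaves the grid.
    crossings : ℕ → ℕ → ∀ {x y} → Walk Adj D x y → Bool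
    crossings r c (stop {x} _) = above r x ∧ left c x
    crossings r c (go {x} {y} _ _ w) = ((above r x xor above r y) ∧ left c x) xor crossings r c w

    above-step : ∀ {r i c c′} → i ≢ r → above r (i , c) ≡ above r (suc i , c′)
    above-step {r} {i} i≢r = does-cong (i ≤? r) (suc i ≤? r) (λ le → ≤∧≢⇒< le i≢r) (≤-trans (n≤1+n i))

    above-next : ∀ {r} x → row x ≢ suc r → above r x ≡ above (suc r) x
    above-next {r} (i , c) i≢ = does-cong (i ≤? r) (i ≤? suc r) m≤n⇒m≤1+n (λ le → s≤s⁻¹ (≤∧≢⇒< le i≢))

    left-next : ∀ {c} x → col x ≢ c → left c x ≡ left (suc c) x
    left-next {c} (r , i) i≢ = does-cong (i <? c) (i <? suc c) m≤n⇒m≤1+n (λ lt → ≤∧≢⇒< (s≤s⁻¹ lt) i≢)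

    left-step : ∀ {c i r r′} → suc i ≢ c → left c (r , i) ≡ left c (r′ , suc i)
    left-step {c} {i} i≢ = does-cong (i <? c) (suc i <? c) (λ lt → ≤∧≢⇒< lt i≢) (≤-trans (n≤1+n _))

    -- `crossings r c` counts modulo 2 the steps between the rows r and r + 1 in the columns before
    -- c. A step between these rows in column c itself would use the cell (r , c).
    crossings-east : ∀ {r c x y} (w : Walk Adj D x y) → r ≤ row y → ¬ D (r , c) →
                     crossings r c w ≡ crossings r (suc c) w
    crossings-east {r} {c} (stop {x} d) r≤ ¬d with col x ≟ c
    ... | no ¬e = cong (above r x ∧_) (left-next x ¬e)
    ... | yes refl with row x ≟ r
    ...   | yes refl = ⊥-elim (¬d d)
    ...   | no ¬e rewrite dec-false (row x ≤? r) (λ le → ¬e (≤-antisym le r≤)) = refl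
    crossings-east {r} {c} (go {x} {y} d a w) r≤ ¬d = cong₂ _xor_ (same a d (start∈ w)) (crossings-east w r≤ ¬d)
      where
      vertical : ∀ {i j} → i ≢ r ⊎ j ≢ c →
                 (above r (i , j) xor above r (suc i , j)) ∧ left c (i , j) ≡
                 (above r (i , j) xor above r (suc i , j)) ∧ left (suc c) (i , j)
      vertical {i} {j} (inj₁ ne) rewrite above-step {c = j} {c′ = j} ne | xor-same (above r (suc i , j)) = refl
      vertical {i} {j} (inj₂ ne) = cong ((above r (i , j) xor above r (suc i , j)) ∧_) (left-next (i , j) ne)
      off : ∀ {x} → D x → row x ≢ r ⊎ col x ≢ c
      off {i , j} d with i ≟ r | j ≟ c
      ... | no ne | _ = inj₁ ne
      ... | yes _ | no ne = inj₂ ne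
      ... | yes refl | yes refl = ⊥-elim (¬d d)
      same : ∀ {x y} → Adj x y → D x → D y →
             (above r x xor above r y) ∧ left c x ≡ (above r x xor above r y) ∧ left (suc c) x
      same {x} east _ _ rewrite xor-same (above r x) = refl
      same {_} {y} west _ _ rewrite xor-same (above r y) = refl
      same south d _ = vertical (off d)
      same {suc i , j} north _ d = trans (cong (_∧ _) (xor-comm (above r (suc i , j)) (above r (i , j))))
        (trans (vertical (off d)) (cong (_∧ _) (xor-comm (above r (i , j)) (above r (suc i , j)))))

    enter : ℕ → ℕ → Cell → Bool
    enter r c x = (above r x xor above (suc r) x) ∧ left c x

    -- `enter` marks the cells of row r + 1 in the columns before c. Each step contributes the
    -- difference of `enter` at its two ends, because a horizontal step into or out of the marked
    -- set would use (r + 1 , c); the sum telescopes to the first cell.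
    crossings-south : ∀ {r c x y} (w : Walk Adj D x y) → ¬ D (suc r , c) →
                      crossings r c w xor crossings (suc r) c w ≡ enter r c x
    crossings-south {r} {c} (stop {x} d) ¬d =
      solveBool 3 (λ u v l → (u :* l) :+ (v :* l) := (u :+ v) :* l) refl (above r x) (above (suc r) x) (left c x)
    crossings-south {r} {c} (go {x} {y} d a w) ¬d =
      trans (solveBool 4 (λ p f q g → (p :+ f) :+ (q :+ g) := (p :+ q) :+ (f :+ g)) refl
              ((above r x xor above r y) ∧ left c x) (crossings r c w)
              ((above (suc r) x xor above (suc r) y) ∧ left c x) (crossings (suc r) c w))
      (trans (cong₂ _xor_ (step a d (start∈ w)) (crossings-south w ¬d))
             (solveBool 2 (λ p q → (p :+ q) :+ q := p) refl (enter r c x) (enter r c y)))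
      where
      vertical : ∀ x y → left c x ≡ left c y →
                 ((above r x xor above r y) ∧ left c x) xor ((above (suc r) x xor above (suc r) y) ∧ left c x)
                 ≡ enter r c x xor enter r c y
      vertical x y e rewrite e =
        solveBool 5 (λ p q u v l → ((p :+ q) :* l) :+ ((u :+ v) :* l) := ((p :+ u) :* l) :+ ((q :+ v) :* l)) refl
          (above r x) (above r y) (above (suc r) x) (above (suc r) y) (left c y)
      horizontal : ∀ i j → D (i , suc j) → enter r c (i , j) ≡ enter r c (i , suc j)
      horizontal i j d with i ≟ suc r | suc j ≟ c
      ... | yes refl | yes refl = ⊥-elim (¬d d)
      ... | _ | no ne = cong ((above r (i , j) xor above (suc r) (i , j)) ∧_) (left-step {r = i} {r′ = i} ne)
      ... | no ne | _ rewrite above-next {r} (i , j) ne | xor-same (above (suc r) (i , j)) = refl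
      flat : ∀ i j j′ → enter r c (i , j) ≡ enter r c (i , j′) →
             ((above r (i , j) xor above r (i , j′)) ∧ left c (i , j)) xor
             ((above (suc r) (i , j) xor above (suc r) (i , j′)) ∧ left c (i , j))
             ≡ enter r c (i , j) xor enter r c (i , j′)
      flat i j j′ e rewrite xor-same (above r (i , j)) | xor-same (above (suc r) (i , j)) | e =
        sym (xor-same (enter r c (i , j′)))
      step : ∀ {x y} → Adj x y → D x → D y →
             ((above r x xor above r y) ∧ left c x) xor ((above (suc r) x xor above (suc r) y) ∧ left c x)
             ≡ enter r c x xor enter r c y
      step {i , j} east _ d = flat i j (suc j) (horizontal i j d)
      step {i , suc j} west d _ = flat i (suc j) j (sym (horizontal i j d))
      step {x} {y} south _ _ = vertical x y refl
      step {x} {y} north _ _ = vertical x y refl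

    -- All crossings of the level r are counted, and the continued walk ends below the grid; hence
    -- their parity tells on which side of the level it starts.
    crossings-total : ∀ {r c x y} (w : Walk Adj D x y) → n ≤ c → crossings r c w ≡ above r x
    crossings-total {r} {c} (stop {x} d) n≤c rewrite dec-true (col x <? c) (<-≤-trans (proj₂ (inG d)) n≤c) =
      solveBool 1 (λ u → u :* xor-∧-Solver.con true := u) refl (above r x)
    crossings-total {r} {c} (go {x} {y} d a w) n≤c
      rewrite crossings-total {r} w n≤c | dec-true (col x <? c) (<-≤-trans (proj₂ (inG d)) n≤c) =
      solveBool 2 (λ u v → ((u :+ v) :* xor-∧-Solver.con true) :+ v := u) refl (above r x) (above r y)

    crossings-zero : ∀ {r x y} (w : Walk Adj D x y) → crossings r 0 w ≡ false
    crossings-zero {r} (stop {x} _) = ∧-zeroʳ (above r x)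
    crossings-zero {r} (go {x} {y} _ _ w) rewrite ∧-zeroʳ (above r x xor above r y) = crossings-zero {r} w

  crossing : ∀ {Γ : Cell → Set} → (∀ {x} → Γ x → Grid n x) → (∀ {x} → D x → Γ x → ⊥) →
             ∀ {x y} → Walk Adj D x y → row x ≡ 0 → suc (row y) ≡ n →
             ∀ {u v} → Walk Adj Γ u v → col u ≡ 0 → suc (col v) ≡ n → ⊥
  crossing {Γ} inG′ disj {x} {y} w top bottom {u} {v} w′ left₀ right =
    absurd (trans (sym (crossings-zero w)) (trans (subst (λ c → crossings (row u) 0 w ≡ crossings (row u) c w) (sym left₀) refl)
      (trans (constant w′) (trans (crossings-east w (s≤s⁻¹ (subst (row v <_) (sym bottom) (proj₁ (inG′ (end∈ w′))))) (λ d → disj d (end∈ w′)))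
        (trans (crossings-total w (≤-reflexive (sym right))) (subst (λ i → does (i ≤? row v) ≡ true) (sym top) refl))))))
    where
    absurd : false ≡ true → ⊥
    absurd ()
    xor-false : ∀ a b → a xor b ≡ false → a ≡ b
    xor-false true true _ = refl
    xor-false false false _ = refl
    le : ∀ {z} → Γ z → row z ≤ row y
    le g = s≤s⁻¹ (subst (_ <_) (sym bottom) (proj₁ (inG′ g)))
    south′ : ∀ {r c} → Γ (suc r , c) → crossings r c w ≡ crossings (suc r) c w
    south′ {r} {c} g = xor-false _ _ (trans (crossings-south w (λ d → disj d g)) enter-top)
      where
      enter-top : enter r c x ≡ false
      enter-top rewrite top = refl
    constant : ∀ {a b} → Walk Adj Γ a b → crossings (row a) (col a) w ≡ crossings (row b) (col b) w
    constant (stop _) = refl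
    constant (go g east w′) = trans (crossings-east w (le g) (λ d → disj d g)) (constant w′)
    constant (go g west w′) = trans (sym (crossings-east w (le (start∈ w′)) (λ d → disj d (start∈ w′)))) (constant w′)
    constant (go g south w′) = trans (south′ (start∈ w′)) (constant w′)
    constant (go g north w′) = trans (sym (south′ g)) (constant w′)

-- The duality lemma, in the manner of Sperner: white cells are labelled by whether they are joined to
-- the left side, black cells by whether they are joined to the top. Around each unit square
-- the number of edges between two cells with positive labels and distinct colours is even.

module Duality (N : ℕ) (w t : Cell → Bool)
  (white : ∀ {x y} → Grid (suc N) x → Grid (suc N) y → Adj x y → w x ≡ true → w y ≡ true → t x ≡ t y)
  (black : ∀ {x y} → Grid (suc N) x → Grid (suc N) y → King x y → w x ≡ false → w y ≡ false → t x ≡ t y)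
  (left : ∀ {r} → r < suc N → w (r , 0) ≡ true → t (r , 0) ≡ true)
  (right : ∀ {r} → r < suc N → w (r , N) ≡ true → t (r , N) ≡ false)
  (top : ∀ {c} → c < suc N → w (0 , c) ≡ false → t (0 , c) ≡ true)
  (bottom : ∀ {c} → c < suc N → w (N , c) ≡ false → t (N , c) ≡ false)
  where

  private
    e : Cell → Cell → Bool
    e x y = (w x xor w y) ∧ (t x ∧ t y)

    -- A potential for `e` on the top and on the left side, where one of the two colours always has
    -- a positive label.
    side : Cell → Bool
    side x = w x xor t x

    square : ∀ {r c} → suc r < suc N → suc c < suc N →
             e (r , c) (r , suc c) xor e (suc r , c) (suc r , suc c) ≡ e (r , c) (suc r , c) xor e (r , suc c) (suc r , suc c)
    square {r} {c} r< c< = cases (w a) (w b) (w f) (w d) refl refl refl refl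
      where
      a = r , c
      b = r , suc c
      f = suc r , c
      d = suc r , suc c
      r<′ = <-trans (n<1+n r) r<
      c<′ = <-trans (n<1+n c) c<
      ga = r<′ , c<′
      gb = r<′ , c<
      gf = r< , c<′
      gd = r< , c<
      sc : ∀ i → (i ≤ suc i × i ≤ suc i)
      sc i = n≤1+n i , n≤1+n i
      up : ∀ i → (i ≤ suc (suc i) × suc i ≤ suc i)
      up i = ≤-trans (n≤1+n i) (n≤1+n _) , ≤-refl
      dn : ∀ i → (suc i ≤ suc i × i ≤ suc (suc i))
      dn i = ≤-refl , ≤-trans (n≤1+n i) (n≤1+n _)
      cases : ∀ p q u v → w a ≡ p → w b ≡ q → w f ≡ u → w d ≡ v → e a b xor e f d ≡ e a f xor e b d
      cases true true true true wa wb wf wd rewrite wa | wb | wf | wd = refl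
      cases false false false false wa wb wf wd rewrite wa | wb | wf | wd = refl
      cases true true true false wa wb wf wd rewrite white ga gb east wa wb | sym (white ga gf south wa wf) | sym (white ga gb east wa wb) | wa | wb | wf | wd = refl
      cases true true false true wa wb wf wd rewrite white ga gb east wa wb | white gb gd south wb wd | wa | wb | wf | wd = ac (t d) (t f)
        where
        ac : ∀ p q → q ∧ p ≡ p ∧ q xor false
        ac true true = refl
        ac true false = refl
        ac false true = refl
        ac false false = refl
      cases true false true true wa wb wf wd rewrite white ga gf south wa wf | white gf gd east wf wd | wa | wb | wf | wd = ac (t d) (t b)
        where
        ac : ∀ p q → (p ∧ q) xor false ≡ q ∧ p
        ac true true = refl
        ac true false = refl
        ac false true = refl
        ac false false = refl
      cases false true true true wa wb wf wd rewrite white gb gd south wb wd | sym (white gf gd east wf wd) | wa | wb | wf | wd = refl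
      cases true true false false wa wb wf wd rewrite white ga gb east wa wb | black gf gd (sc _ , up _) wf wd | wa | wb | wf | wd = sym (xor-same (t b ∧ t d))
      cases false false true true wa wb wf wd rewrite black ga gb (sc _ , up _) wa wb | white gf gd east wf wd | wa | wb | wf | wd = sym (xor-same (t b ∧ t d))
      cases true false true false wa wb wf wd rewrite white ga gf south wa wf | black gb gd (up _ , sc _) wb wd | wa | wb | wf | wd = xor-same (t f ∧ t d)
      cases false true false true wa wb wf wd rewrite black ga gf (up _ , sc _) wa wf | white gb gd south wb wd | wa | wb | wf | wd = xor-same (t f ∧ t d)
      -- The two black cells touch only diagonally. Their labels agree because black cells are
      -- joined by king moves.
      cases true false false true wa wb wf wd rewrite black gb gf (up _ , dn _) wb wf | wa | wb | wf | wd = ac (t a ∧ t f) (t f) (t d)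
        where
        ac : ∀ p q u → p xor (q ∧ u) ≡ p xor (q ∧ u)
        ac _ _ _ = refl
      cases false true true false wa wb wf wd rewrite black ga gd (up _ , up _) wa wd | wa | wb | wf | wd = ac (t d) (t b) (t f)
        where
        ac : ∀ p q u → (p ∧ q) xor (u ∧ p) ≡ (p ∧ u) xor (q ∧ p)
        ac true true true = refl
        ac true true false = refl
        ac true false true = refl
        ac true false false = refl
        ac false true true = refl
        ac false true false = refl
        ac false false true = refl
        ac false false false = refl
      cases true false false false wa wb wf wd rewrite black gb gf (up _ , dn _) wb wf | wa | wb | wf | wd = refl
      cases false true false false wa wb wf wd rewrite black ga gd (up _ , up _) wa wd | wa | wb | wf | wd = ac (t d) (t b)
        where
        ac : ∀ p q → (p ∧ q) xor false ≡ q ∧ p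
        ac true true = refl
        ac true false = refl
        ac false true = refl
        ac false false = refl
      cases false false true false wa wb wf wd rewrite black ga gd (up _ , up _) wa wd | wa | wb | wf | wd = ac (t d) (t f)
        where
        ac : ∀ p q → q ∧ p ≡ (p ∧ q) xor false
        ac true true = refl
        ac true false = refl
        ac false true = refl
        ac false false = refl
      cases false false false true wa wb wf wd rewrite black gb gf (up _ , dn _) wb wf | wa | wb | wf | wd = refl

    rowSum : ℕ → ℕ → Bool
    rowSum r zero = false
    rowSum r (suc k) = rowSum r k xor e (r , k) (r , suc k)

    rowSums : ∀ {r} → suc r < suc N → ∀ k → k < suc N →
              rowSum r k xor rowSum (suc r) k ≡ e (r , 0) (suc r , 0) xor e (r , k) (suc r , k)
    rowSums {r} r< zero _ = sym (xor-same (e (r , 0) (suc r , 0)))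
    rowSums {r} r< (suc k) k< = begin
      (rowSum r k xor h) xor (rowSum (suc r) k xor h′)  ≡⟨ solveBool 4 (λ a b c d → (a :+ b) :+ (c :+ d) := (a :+ c) :+ (b :+ d)) refl (rowSum r k) h (rowSum (suc r) k) h′ ⟩
      (rowSum r k xor rowSum (suc r) k) xor (h xor h′)  ≡⟨ cong₂ _xor_ (rowSums r< k (<-trans (n<1+n k) k<)) (square r< k<) ⟩
      (v₀ xor v) xor (v xor v′)                         ≡⟨ solveBool 3 (λ a b c → (a :+ b) :+ (b :+ c) := a :+ c) refl v₀ v v′ ⟩
      v₀ xor v′                                         ∎
      where
      open Relation.Binary.PropositionalEquality.≡-Reasoning
      h = e (r , k) (r , suc k)
      h′ = e (suc r , k) (suc r , suc k)
      v₀ = e (r , 0) (suc r , 0)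
      v = e (r , k) (suc r , k)
      v′ = e (r , suc k) (suc r , suc k)

    right-edge : ∀ {r} → suc r < suc N → e (r , N) (suc r , N) ≡ false
    right-edge {r} r< = cases (w x) (w y) refl refl
      where
      x = r , N
      y = suc r , N
      cases : ∀ p q → w x ≡ p → w y ≡ q → e x y ≡ false
      cases true true wx wy rewrite wx | wy = refl
      cases false false wx wy rewrite wx | wy = refl
      cases true false wx wy rewrite right (<-trans (n<1+n r) r<) wx | wx | wy = refl
      cases false true wx wy rewrite right r< wy | wx | wy = ∧-zeroʳ (t x)

    left-edge : ∀ {r} → suc r < suc N → e (r , 0) (suc r , 0) ≡ side (r , 0) xor side (suc r , 0)
    left-edge {r} r< = cases (w x) (w y) refl refl
      where
      x = r , 0
      y = suc r , 0
      r<′ = <-trans (n<1+n r) r<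
      cases : ∀ p q → w x ≡ p → w y ≡ q → e x y ≡ side x xor side y
      cases true true wx wy rewrite left r<′ wx | left r< wy | wx | wy = refl
      cases false false wx wy rewrite black (r<′ , s≤s z≤n) (r< , s≤s z≤n) ((≤-trans (n≤1+n r) (n≤1+n _) , ≤-refl) , z≤n , z≤n) wx wy | wx | wy = sym (xor-same (t y))
      cases true false wx wy rewrite left r<′ wx | wx | wy = refl
      cases false true wx wy rewrite left r< wy | wx | wy = solveBool 1 (λ u → u :* xor-∧-Solver.con true := u :+ xor-∧-Solver.con false) refl (t x)

    top-edge : ∀ {c} → suc c < suc N → e (0 , c) (0 , suc c) ≡ side (0 , c) xor side (0 , suc c)
    top-edge {c} c< = cases (w x) (w y) refl refl
      where
      x = 0 , c
      y = 0 , suc c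
      c<′ = <-trans (n<1+n c) c<
      cases : ∀ p q → w x ≡ p → w y ≡ q → e x y ≡ side x xor side y
      cases true true wx wy rewrite white (s≤s z≤n , c<′) (s≤s z≤n , c<) east wx wy | wx | wy = sym (xor-same (not (t y)))
      cases false false wx wy rewrite top c<′ wx | top c< wy | wx | wy = refl
      cases true false wx wy rewrite top c< wy | wx | wy = cs (t x)
        where
        cs : ∀ u → u ∧ true ≡ not u xor true
        cs true = refl
        cs false = refl
      cases false true wx wy rewrite top c<′ wx | wx | wy = cs (t y)
        where
        cs : ∀ u → u ≡ not (not u)
        cs true = refl
        cs false = refl

    bottom-edge : ∀ {c} → suc c < suc N → e (N , c) (N , suc c) ≡ false
    bottom-edge {c} c< = cases (w x) (w y) refl refl
      where
      x = N , c
      y = N , suc c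
      cases : ∀ p q → w x ≡ p → w y ≡ q → e x y ≡ false
      cases true true wx wy rewrite wx | wy = refl
      cases false false wx wy rewrite wx | wy = refl
      cases true false wx wy rewrite bottom c< wy | wx | wy = ∧-zeroʳ (t x)
      cases false true wx wy rewrite bottom (<-trans (n<1+n c) c<) wx | wx | wy = refl

    topSum : ∀ k → k < suc N → rowSum 0 k ≡ side (0 , 0) xor side (0 , k)
    topSum zero _ = sym (xor-same (side (0 , 0)))
    topSum (suc k) k< rewrite topSum k (<-trans (n<1+n k) k<) | top-edge k< =
      solveBool 3 (λ a b c → (a :+ b) :+ (b :+ c) := a :+ c) refl (side (0 , 0)) (side (0 , k)) (side (0 , suc k))

    bottomSum : ∀ k → k < suc N → rowSum N k ≡ false
    bottomSum zero _ = refl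
    bottomSum (suc k) k< rewrite bottomSum k (<-trans (n<1+n k) k<) | bottom-edge k< = refl

    leftSum : ∀ r → r < suc N → rowSum 0 N xor rowSum r N ≡ side (0 , 0) xor side (r , 0)
    leftSum zero _ = trans (xor-same (rowSum 0 N)) (sym (xor-same (side (0 , 0))))
    leftSum (suc r) r< = begin
      a xor c                  ≡⟨ solveBool 3 (λ a b c → a :+ c := (a :+ b) :+ (b :+ c)) refl a b c ⟩
      (a xor b) xor (b xor c)  ≡⟨ cong₂ _xor_ (leftSum r (<-trans (n<1+n r) r<)) (trans (rowSums r< N ≤-refl) (cong₂ _xor_ (left-edge r<) (right-edge r<))) ⟩
      (σ₀ xor σ₁) xor ((σ₁ xor σ₂) xor false) ≡⟨ solveBool 3 (λ x y z → (x :+ y) :+ ((y :+ z) :+ xor-∧-Solver.con false) := x :+ z) refl σ₀ σ₁ σ₂ ⟩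
      σ₀ xor σ₂                ∎
      where
      open Relation.Binary.PropositionalEquality.≡-Reasoning
      a = rowSum 0 N
      b = rowSum r N
      c = rowSum (suc r) N
      σ₀ = side (0 , 0)
      σ₁ = side (r , 0)
      σ₂ = side (suc r , 0)

  -- The bottom and the right side contribute nothing, so that `side` would agree at the north-east
  -- and the south-west corner. Each of these corners lies on two sides, which force its value
  -- whatever its colour: true at the first, false at the second.
  contradictory : ⊥
  contradictory = absurd (trans (sym side-sw) (trans (cancel (side (0 , 0)) (trans (sym sw) ne)) side-ne))
    where
    absurd : false ≡ true → ⊥
    absurd ()
    xor-false : ∀ a → a xor false ≡ a
    xor-false true = refl
    xor-false false = refl
    cancel : ∀ a {b c} → a xor b ≡ a xor c → b ≡ c
    cancel false e = e
    cancel true {true} {true} _ = refl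
    cancel true {false} {false} _ = refl
    ne : rowSum 0 N ≡ side (0 , 0) xor side (0 , N)
    ne = topSum N ≤-refl
    sw : rowSum 0 N ≡ side (0 , 0) xor side (N , 0)
    sw = trans (sym (xor-false _)) (trans (cong (rowSum 0 N xor_) (sym (bottomSum N ≤-refl))) (leftSum N ≤-refl))
    side-sw : side (N , 0) ≡ false
    side-sw = cases (w (N , 0)) refl
      where
      cases : ∀ p → w (N , 0) ≡ p → side (N , 0) ≡ false
      cases true e rewrite left {N} ≤-refl e | e = refl
      cases false e rewrite bottom {0} (s≤s z≤n) e | e = refl
    side-ne : side (0 , N) ≡ true
    side-ne = cases (w (0 , N)) refl
      where
      cases : ∀ p → w (0 , N) ≡ p → side (0 , N) ≡ true
      cases true e rewrite right {0} (s≤s z≤n) e | e = refl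
      cases false e rewrite top {N} ≤-refl e | e = refl

duality : ∀ n {S : Cell → Set} → 0 < n → (∀ x → Dec (S x)) →
          (∀ {x y} → row x ≡ 0 → suc (row y) ≡ n → ¬ Walk King (λ z → Grid n z × S z) x y) →
          NN (Σ[ x ∈ Cell ] Σ[ y ∈ Cell ] col x ≡ 0 × suc (col y) ≡ n × Walk Adj (λ z → Grid n z × ¬ S z) x y)
duality (suc N) {S} _ S? noTB k = do
  W? ← decGrid FromLeft (suc N) (proj₁ ∘ end∈ ∘ proj₂)
  B? ← decGrid FromTop (suc N) (proj₁ ∘ end∈ ∘ proj₂)
  contra W? B?
  where
  White Black FromLeft FromTop : Cell → Set
  White z = Grid (suc N) z × ¬ S z
  Black z = Grid (suc N) z × S z
  FromLeft x = Σ[ r ∈ ℕ ] Walk Adj White (r , 0) x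
  FromTop x = Σ[ c ∈ ℕ ] Walk King Black (0 , c) x
  contra : (∀ x → Dec (FromLeft x)) → (∀ x → Dec (FromTop x)) → ⊥
  contra W? B? = Duality.contradictory N w t
    (λ gx gy a wx wy → trans (t-white wx) (trans (does-cong (W? _) (W? _)
        (λ (r , p) → r , p ⊙ go (end∈ p) a (stop (gy , isWhite wy)))
        (λ (r , p) → r , p ⊙ go (end∈ p) (adj-sym a) (stop (gx , isWhite wx)))) (sym (t-white wy))))
    (λ gx gy a wx wy → trans (t-black wx) (trans (does-cong (B? _) (B? _)
        (λ (r , p) → r , p ⊙ go (end∈ p) a (stop (gy , isBlack wy)))
        (λ (r , p) → r , p ⊙ go (end∈ p) (king-sym a) (stop (gx , isBlack wx)))) (sym (t-black wy))))
    (λ r< wx → trans (t-white wx) (dec-true (W? _) (_ , stop ((r< , s≤s z≤n) , isWhite wx))))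
    (λ r< wx → trans (t-white wx) (dec-false (W? _) (λ (r , p) → k (_ , _ , refl , refl , p))))
    (λ c< wx → trans (t-black wx) (dec-true (B? _) (_ , stop ((s≤s z≤n , c<) , isBlack wx))))
    (λ c< wx → trans (t-black wx) (dec-false (B? _) (λ (c , p) → noTB refl refl p)))
    where
    w t : Cell → Bool
    w x = not (does (S? x))
    t x with S? x
    ... | yes _ = does (B? x)
    ... | no _ = does (W? x)
    isWhite : ∀ {x} → w x ≡ true → ¬ S x
    isWhite {x} e with S? x
    isWhite () | yes _
    ... | no ¬s = ¬s
    isBlack : ∀ {x} → w x ≡ false → S x
    isBlack {x} e with S? x
    isBlack () | no _
    ... | yes s = s
    t-white : ∀ {x} → w x ≡ true → t x ≡ does (W? x)
    t-white {x} e with S? x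
    t-white () | yes _
    ... | no _ = refl
    t-black : ∀ {x} → w x ≡ false → t x ≡ does (B? x)
    t-black {x} e with S? x
    t-black () | no _
    ... | yes _ = refl

-- Components of a complement and their outermost boundary cells

-- X is a component of the complement of S in the grid.

record Region (n : ℕ) (S X : Cell → Set) : Set where
  field
    inGrid : ∀ {x} → X x → Grid n x
    dec    : ∀ x → Dec (X x)
    off    : ∀ {x} → X x → ¬ S x
    closed : ∀ {x y} → X x → Adj x y → Grid n y → ¬ X y → S y
    joined : ∀ {x y} → X x → X y → Walk Adj X x y
open Region public

pull : ∀ {n} → Symmetry n → (Cell → Set) → Cell → Set
pull {n} σ P x = Grid n x × P (to σ x)

pull-to : ∀ {n} (σ : Symmetry n) {P x} → Grid n x → P x → pull σ P (to σ x)
pull-to σ {P} g p = onGrid σ g , subst P (sym (invol σ g)) p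

pull? : ∀ {n} (σ : Symmetry n) {P} → (∀ x → Dec (P x)) → ∀ x → Dec (pull σ P x)
pull? {n} σ P? x = grid? n x ×-dec P? (to σ x)

to-inj : ∀ {n} (σ : Symmetry n) {x y} → Grid n x → Grid n y → to σ x ≡ to σ y → x ≡ y
to-inj σ gx gy e = trans (sym (invol σ gx)) (trans (cong (to σ) e) (invol σ gy))

pullWalk : ∀ {n} (σ : Symmetry n) {P} → (∀ {x} → P x → Grid n x) → ∀ {x y} →
           Walk Adj P x y → Walk Adj (pull σ P) (to σ x) (to σ y)
pullWalk σ {P} inG = mapWalk (to σ) (λ p → pull-to σ {P} (inG p) p) (λ p q → onAdj σ (inG p) (inG q))

pullPack : ∀ {n k} (σ : Symmetry n) {P Q} → (∀ {x} → P x → Grid n x) → (∀ {x} → P x → Q (to σ x)) → Pack k P → Pack k Q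
pullPack σ inG f = packMap (to σ) f (λ p q → to-inj σ (inG p) (inG q))

pullRegion : ∀ {n} (σ : Symmetry n) {S X} → Region n S X → Region n (pull σ S) (pull σ X)
pullRegion {n} σ {S} {X} R = record
  { inGrid = proj₁
  ; dec = pull? σ (dec R)
  ; off = λ (_ , x) (_ , s) → off R x s
  ; closed = λ (gx , x) a gy ¬y → gy , closed R x (onAdj σ gx gy a) (onGrid σ gy) (λ y → ¬y (gy , y))
  ; joined = λ (gx , x) (gy , y) → subst₂′ (invol σ gx) (invol σ gy) (pullWalk σ (inGrid R) (joined R x y)) }
  where
  subst₂′ : ∀ {a a′ b b′ P} → a ≡ a′ → b ≡ b′ → Walk Adj P a b → Walk Adj P a′ b′
  subst₂′ refl refl w = w

module _ {n : ℕ} {S X : Cell → Set} (R : Region n S X) where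

  meetsRow : ∀ {x y} → X x → X y → ∀ r → row x ≤ r → r ≤ row y → Σ[ c ∈ ℕ ] X (r , c)
  meetsRow p q r lo hi with intermediate row adj-row (joined R p q) r lo hi
  ... | (_ , c) , z , refl = c , z

  meetsCol : ∀ {x y} → X x → X y → ∀ c → col x ≤ c → c ≤ col y → Σ[ r ∈ ℕ ] X (r , c)
  meetsCol p q c lo hi with intermediate col adj-col (joined R p q) c lo hi
  ... | (r , _) , z , refl = r , z

  -- Only the outermost boundary cells of a row or column are taken, with no cell of `X` on the ray
  -- beyond them. They are counted by their rows or columns, and the empty rays keep the ends of
  -- different kinds apart.
  East South West North : ℕ → ℕ → Set
  East r c = Σ[ k ∈ ℕ ] c ≡ suc k × X (r , k) × S (r , c) × c < n × (∀ j → c ≤ j → ¬ X (r , j))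
  South r c = Σ[ k ∈ ℕ ] r ≡ suc k × X (k , c) × S (r , c) × r < n × (∀ j → r ≤ j → ¬ X (j , c))
  West r c = X (r , suc c) × S (r , c) × (∀ j → j ≤ c → ¬ X (r , j))
  North r c = X (suc r , c) × S (r , c) × (∀ j → j ≤ r → ¬ X (j , c))

  east-end : (∀ {x} → X x → suc (col x) < n) → ∀ {r c} → X (r , c) → Σ[ k ∈ ℕ ] c < k × East r k
  east-end avoid {r} {c} x with greatest (λ i → dec R (r , i)) n c (proj₂ (inGrid R x)) x
  ... | k , c≤k , k<n , xk , max = suc k , s≤s c≤k , k , refl , xk
        , closed R xk east (proj₁ (inGrid R x) , avoid xk) (max (suc k) ≤-refl (avoid xk)) , avoid xk
        , λ j lt xj → max j lt (proj₂ (inGrid R xj)) xj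

  south-end : (∀ {x} → X x → suc (row x) < n) → ∀ {r c} → X (r , c) → Σ[ k ∈ ℕ ] r < k × South k c
  south-end avoid {r} {c} x with greatest (λ i → dec R (i , c)) n r (proj₁ (inGrid R x)) x
  ... | k , r≤k , k<n , xk , max = suc k , s≤s r≤k , k , refl , xk
        , closed R xk south (avoid xk , proj₂ (inGrid R x)) (max (suc k) ≤-refl (avoid xk)) , avoid xk
        , λ j lt xj → max j lt (proj₁ (inGrid R xj)) xj

  west-end : (∀ {x} → X x → 0 < col x) → ∀ {r c} → X (r , c) → Σ[ k ∈ ℕ ] k < c × West r k
  west-end avoid {r} {c} x with least (λ i → dec R (r , i)) c x
  ... | zero , _ , xk , _ = ⊥-elim (<-irrefl refl (avoid xk))
  ... | suc k , k<c , xk , min = k , k<c , xk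
        , closed R xk west (proj₁ (inGrid R x) , <-trans k<c (proj₂ (inGrid R x))) (min k ≤-refl)
        , λ j le → min j (s≤s le)

  north-end : (∀ {x} → X x → 0 < row x) → ∀ {r c} → X (r , c) → Σ[ k ∈ ℕ ] k < r × North k c
  north-end avoid {r} {c} x with least (λ i → dec R (i , c)) r x
  ... | zero , _ , xk , _ = ⊥-elim (<-irrefl refl (avoid xk))
  ... | suc k , k<r , xk , min = k , k<r , xk
        , closed R xk north (<-trans k<r (proj₁ (inGrid R x)) , proj₂ (inGrid R x)) (min k ≤-refl)
        , λ j le → min j (s≤s le)

  -- The two rays to the east and to the south of (r , c) cut off the quadrant between them.
  quadrant : ∀ {r c} → (∀ j → c ≤ j → ¬ X (r , j)) → (∀ i → r ≤ i → ¬ X (i , c)) →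
             ∀ {i j} → X (i , j) → r < i → c < j → ∀ {x} → X x → r < row x × c < col x
  quadrant {r} {c} ¬e ¬s x r<i c<j y = proj₂ (end∈ (confine step (r<i , c<j) (joined R x y)))
    where
    step : ∀ {x y} → r < row x × c < col x → X x → X y → Adj x y → r < row y × c < col y
    step (a , b) _ _ east = a , m≤n⇒m≤1+n b
    step (a , b) _ y west = a , ≤∧≢⇒< (s≤s⁻¹ b) λ { refl → ¬s _ (<⇒≤ a) y }
    step (a , b) _ _ south = m≤n⇒m≤1+n a , b
    step (a , b) _ y north = ≤∧≢⇒< (s≤s⁻¹ a) (λ { refl → ¬e _ (<⇒≤ b) y }) , b

  -- `X` would be confined to the quadrant, but the cell to the west of (r , c) belongs to `X`.
  east-south : ∀ {r c} → East r c → South r c → ∀ {i j} → X (i , j) → r ≤ i → c ≤ j → ⊥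
  east-south {r} {c} (k , refl , xk , _ , _ , ¬e) (_ , _ , _ , _ , _ , ¬s) {i} {j} x r≤i c≤j
    with r ≟ i | suc k ≟ j
  ... | yes refl | _ = ¬e j c≤j x
  ... | _ | yes refl = ¬s i r≤i x
  ... | no r≢i | no c≢j = <⇒≱ (proj₂ (quadrant ¬e ¬s x (≤∧≢⇒< r≤i r≢i) (≤∧≢⇒< c≤j c≢j) xk)) (n≤1+n k)

-- Selected rows and columns, and minors in their sublattice

Increasing : (ℕ → ℕ) → Set
Increasing ρ = ∀ i → ρ i < ρ (suc i)

module _ {ρ : ℕ → ℕ} (inc : Increasing ρ) where

  increasing-≤ : ∀ {i j} → i ≤ j → ρ i ≤ ρ j
  increasing-≤ {i} {j} i≤j with m≤n⇒m<n∨m≡n i≤j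
  ... | inj₂ refl = ≤-refl
  increasing-≤ {i} {suc j} _ | inj₁ (s≤s i≤j) = ≤-trans (increasing-≤ i≤j) (<⇒≤ (inc j))

  increasing-id : ∀ i → i ≤ ρ i
  increasing-id zero = z≤n
  increasing-id (suc i) = ≤-<-trans (increasing-id i) (inc i)

  increasing-interval : ∀ {i j x} → ρ i ≤ x → x < ρ (suc i) → ρ j ≤ x → x < ρ (suc j) → i ≡ j
  increasing-interval {i} {j} a b a′ b′ with <-cmp i j
  ... | tri< lt _ _ = ⊥-elim (<⇒≱ b (≤-trans (increasing-≤ lt) a′))
  ... | tri≈ _ e _ = e
  ... | tri> _ _ gt = ⊥-elim (<⇒≱ b′ (≤-trans (increasing-≤ gt) a))

-- `nth` goes on beyond `num`, since `Lattice` wants a function increasing on all of ℕ. The indices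
-- which fail are kept as an injection, ready to be counted.
record Selection (good : ℕ → Set) (s : ℕ) : Set where
  field
    num bads : ℕ
    total    : num + bads ≡ s
    nth      : ℕ → ℕ
    inc      : Increasing nth
    sound    : ∀ i → i < num → nth i < s × good (nth i)
    bad      : Fin bads → ℕ
    bad-inj  : ∀ {i j} → bad i ≡ bad j → i ≡ j
    bad-ok   : ∀ i → bad i < s × ¬ good (bad i)

select : ∀ {good : ℕ → Set} → (∀ i → Dec (good i)) → ∀ s → Selection good s
select {good} good? s = proj₁ (sel s)
  where
  open Selection
  sel : ∀ s → Σ[ S ∈ Selection good s ] (∀ i → nth S (num S + i) ≡ s + i)
  sel zero = record { num = 0 ; bads = 0 ; total = refl ; nth = id ; inc = λ _ → ≤-refl ; sound = λ _ ()
                    ; bad = λ () ; bad-inj = λ { {()} } ; bad-ok = λ () } , λ _ → refl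
  sel (suc s) with sel s | good? s
  ... | S , tail | yes g = record
        { num = suc (num S) ; bads = bads S ; total = cong suc (total S) ; nth = nth S ; inc = inc S
        ; sound = sound′ ; bad = bad S ; bad-inj = bad-inj S
        ; bad-ok = λ i → m≤n⇒m≤1+n (proj₁ (bad-ok S i)) , proj₂ (bad-ok S i) }
        , λ i → trans (cong (nth S) (sym (+-suc (num S) i))) (trans (tail (suc i)) (+-suc s i))
    where
    at-num : nth S (num S) ≡ s
    at-num = trans (cong (nth S) (sym (+-identityʳ _))) (trans (tail 0) (+-identityʳ s))
    sound′ : ∀ i → i < suc (num S) → nth S i < suc s × good (nth S i)
    sound′ i lt with m<1+n⇒m<n∨m≡n lt
    ... | inj₁ lt′ = m≤n⇒m≤1+n (proj₁ (sound S i lt′)) , proj₂ (sound S i lt′)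
    ... | inj₂ refl rewrite at-num = ≤-refl , g
  ... | S , tail | no ¬g = record
        { num = num S ; bads = suc (bads S) ; total = trans (+-suc (num S) (bads S)) (cong suc (total S))
        ; nth = nth′ ; inc = inc′ ; sound = sound′ ; bad = bad′ ; bad-inj = inj′ ; bad-ok = ok′ }
        , λ i → trans (nth-≥ (m≤m+n (num S) i)) (cong suc (tail i))
    where
    nth′ : ℕ → ℕ
    nth′ i with i <? num S
    ... | yes _ = nth S i
    ... | no _ = suc (nth S i)
    nth-< : ∀ {i} → i < num S → nth′ i ≡ nth S i
    nth-< {i} lt with i <? num S
    ... | yes _ = refl
    ... | no ¬lt = ⊥-elim (¬lt lt)
    nth-≥ : ∀ {i} → num S ≤ i → nth′ i ≡ suc (nth S i)
    nth-≥ {i} le with i <? num S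
    ... | yes lt = ⊥-elim (<⇒≱ lt le)
    ... | no _ = refl
    inc′ : Increasing nth′
    inc′ i with i <? num S | suc i <? num S
    ... | yes _ | yes _ = inc S i
    ... | yes _ | no _ = m≤n⇒m≤1+n (inc S i)
    ... | no _ | no _ = s≤s (inc S i)
    ... | no ¬a | yes b = ⊥-elim (¬a (<-trans ≤-refl b))
    sound′ : ∀ i → i < num S → nth′ i < suc s × good (nth′ i)
    sound′ i lt rewrite nth-< lt = m≤n⇒m≤1+n (proj₁ (sound S i lt)) , proj₂ (sound S i lt)
    bad′ : Fin (suc (bads S)) → ℕ
    bad′ Fin.zero = s
    bad′ (Fin.suc i) = bad S i
    inj′ : ∀ {i j} → bad′ i ≡ bad′ j → i ≡ j
    inj′ {Fin.zero} {Fin.zero} _ = refl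
    inj′ {Fin.zero} {Fin.suc j} e = ⊥-elim (<-irrefl (sym e) (proj₁ (bad-ok S j)))
    inj′ {Fin.suc i} {Fin.zero} e = ⊥-elim (<-irrefl e (proj₁ (bad-ok S i)))
    inj′ {Fin.suc i} {Fin.suc j} e = cong Fin.suc (bad-inj S e)
    ok′ : ∀ i → bad′ i < suc s × ¬ good (bad′ i)
    ok′ Fin.zero = ≤-refl , ¬g
    ok′ (Fin.suc i) = m≤n⇒m≤1+n (proj₁ (bad-ok S i)) , proj₂ (bad-ok S i)

-- X is a minor of M: M contains a copy of X in the sublattice of the rows ρ r and the columns κ c.

module Lattice {j f} {M X : Cell → Set} (R : Ranks j f M) (n : ℕ) (inG : ∀ {x} → X x → Grid n x)
  {ρ κ : ℕ → ℕ} (ρ-inc : Increasing ρ) (κ-inc : Increasing κ)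
  (point : ∀ {r c} → X (r , c) → M (ρ r , κ c))
  (horizontal : ∀ {r c} → X (r , c) → X (r , suc c) → ∀ i → κ c ≤ i → i < κ (suc c) → M (ρ r , i))
  (vertical : ∀ {r c} → X (r , c) → X (suc r , c) → ∀ i → ρ r ≤ i → i < ρ (suc r) → M (i , κ c))
  where

  private
    -- The branch set of a cell is its lattice point with the segments leading east and south, up to
    -- the next lattice points. A segment is included only if the next cell is in `X`, as only then
    -- it is known to lie in `M`.
    data B : Cell → Cell → Set where
      along : ∀ {r c i} → κ c ≤ i → i < κ (suc c) → i ≡ κ c ⊎ X (r , suc c) → B (r , c) (ρ r , i)
      down  : ∀ {r c i} → ρ r ≤ i → i < ρ (suc r) → i ≡ ρ r ⊎ X (suc r , c) → B (r , c) (i , κ c)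

    box : ∀ {r c x} → B (r , c) x → (ρ r ≤ row x × row x < ρ (suc r)) × (κ c ≤ col x × col x < κ (suc c))
    box (along a b _) = (≤-refl , ρ-inc _) , (a , b)
    box (down a b _) = (a , b) , (≤-refl , κ-inc _)

    centre : ∀ {r c} → B (r , c) (ρ r , κ c)
    centre = along ≤-refl (κ-inc _) (inj₁ refl)

    B-in : ∀ {x y} → X x → B x y → M y
    B-in x (along _ _ (inj₁ refl)) = point x
    B-in x (along a b (inj₂ x′)) = horizontal x x′ _ a b
    B-in x (down _ _ (inj₁ refl)) = point x
    B-in x (down a b (inj₂ x′)) = vertical x x′ _ a b

    toCentre : ∀ {r c y} → B (r , c) y → Walk Adj (B (r , c)) (ρ r , κ c) y
    toCentre (along _ _ (inj₁ refl)) = stop centre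
    toCentre (along a b (inj₂ x)) = eastWalk _ _ _ a λ i lo hi → along lo (≤-<-trans hi b) (inj₂ x)
    toCentre (down _ _ (inj₁ refl)) = stop centre
    toCentre (down a b (inj₂ x)) = southWalk _ _ _ a λ i lo hi → down lo (≤-<-trans hi b) (inj₂ x)

    disjoint : ∀ {x x′ y} → B x y → B x′ y → x ≡ x′
    disjoint b b′ with box b | box b′
    ... | (p , q) , (u , v) | (p′ , q′) , (u′ , v′) =
      cong₂ _,_ (increasing-interval ρ-inc p q p′ q′) (increasing-interval κ-inc u v u′ v′)

    Link : Cell → Cell → Set
    Link x x′ = Σ[ y ∈ Cell ] Σ[ y′ ∈ Cell ] B x y × B x′ y′ × Adj y y′

    link-sym : ∀ {x x′} → Link x x′ → Link x′ x
    link-sym (y , y′ , b , b′ , a) = y′ , y , b′ , b , adj-sym a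

    linkEast : ∀ {r c} → X (r , suc c) → Link (r , c) (r , suc c)
    linkEast {r} {c} x with κ (suc c) in e
    ... | zero = ⊥-elim (n≮0 (subst (κ c <_) e (κ-inc c)))
    ... | suc k = (ρ r , k) , (ρ r , suc k)
                , along (s≤s⁻¹ (subst (κ c <_) e (κ-inc c))) (subst (k <_) (sym e) ≤-refl) (inj₂ x)
                , subst (λ i → B (r , suc c) (ρ r , i)) e centre , east

    linkSouth : ∀ {r c} → X (suc r , c) → Link (r , c) (suc r , c)
    linkSouth {r} {c} x with ρ (suc r) in e
    ... | zero = ⊥-elim (n≮0 (subst (ρ r <_) e (ρ-inc r)))
    ... | suc k = (k , κ c) , (suc k , κ c)
                , down (s≤s⁻¹ (subst (ρ r <_) e (ρ-inc r))) (subst (k <_) (sym e) ≤-refl) (inj₂ x)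
                , subst (λ i → B (suc r , c) (i , κ c)) e centre , south

    link : ∀ {x x′} → X x → X x′ → Adj x x′ → Link x x′
    link _ x′ east = linkEast x′
    link x _ west = link-sym (linkEast x)
    link _ x′ south = linkSouth x′
    link x _ north = link-sym (linkSouth x)

  ranks : NN (Σ[ g ∈ (Cell → ℕ) ] Ranks j g X)
  ranks = Minor.minor R n inG B B-in (λ _ → _ , centre) (λ _ _ → disjoint)
            (λ _ b b′ → reverse adj-sym (toCentre b) ⊙ toCentre b′) link

-- Domination: the other components in a square are minors of the main one

-- Fewer than s cells of the square of side s are blocked. Then some rows and columns are free of blocked
-- cells, and M contains them all; it will turn out that every other component X is a minor of M.

record Setup (s j : ℕ) : Set₁ where
  field
    T M X   : Cell → Set
    f       : Cell → ℕ
    T?      : ∀ x → Dec (T x)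
    scarce  : ∀ {n} → Pack n (λ x → Grid s x × T x) → n < s
    rowM    : ∀ {r} → r < s → (∀ c → c < s → ¬ T (r , c)) → ∀ c → c < s → M (r , c)
    colM    : ∀ {c} → c < s → (∀ r → r < s → ¬ T (r , c)) → ∀ r → r < s → M (r , c)
    closedM : ∀ {x y} → M x → Adj x y → Grid s y → ¬ T y → M y
    ranksM  : Ranks j f M
    region  : Region s T X
    apart   : ∀ {x} → M x → X x → ⊥

Ranked : ∀ {s j} → Setup s j → Set
Ranked {j = j} S = NN (Σ[ g ∈ (Cell → ℕ) ] Ranks j g (Setup.X S))

module _ {s j : ℕ} where

  pullRanks : (σ : Symmetry s) {f : Cell → ℕ} {P : Cell → Set} → Ranks j f P → Ranks j (f ∘ to σ) (pull σ P)
  pullRanks σ R = ranksPull (to σ) proj₂ (λ p q → onAdj σ (proj₁ p) (proj₁ q)) (λ p q → to-inj σ (proj₁ p) (proj₁ q)) (ub R ∘ proj₂) R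

  pullRanks⁻ : (σ : Symmetry s) {P : Cell → Set} → (∀ {x} → P x → Grid s x) →
               NN (Σ[ g ∈ (Cell → ℕ) ] Ranks j g (pull σ P)) → NN (Σ[ g ∈ (Cell → ℕ) ] Ranks j g P)
  pullRanks⁻ σ {P} inG m k = do
    g , R ← m
    k (g ∘ to σ , ranksPull (to σ) (λ p → pull-to σ {P} (inG p) p) (λ p q → onAdj σ (inG p) (inG q))
         (λ p q → to-inj σ (inG p) (inG q)) (λ p → ub R (pull-to σ {P} (inG p) p)) R)

  pullScarce : (σ : Symmetry s) {T : Cell → Set} {P : ℕ → Set} →
               (∀ {n} → Pack n (λ x → Grid s x × T x) → P n) → ∀ {n} → Pack n (λ x → Grid s x × pull σ T x) → P n
  pullScarce σ h p = h (pullPack σ proj₁ (λ (g , _ , t) → onGrid σ g , t) p)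

  transposedSetup : Setup s j → Setup s j
  transposedSetup S = record
    { T = pull σ T ; M = pull σ M ; X = pull σ X ; f = f ∘ to σ ; T? = pull? σ T? ; scarce = pullScarce σ scarce
    ; rowM = λ r<s h c c<s → (r<s , c<s) , colM r<s (λ i i<s t → h i i<s ((r<s , i<s) , t)) c c<s
    ; colM = λ c<s h r r<s → (r<s , c<s) , rowM c<s (λ i i<s t → h i i<s ((i<s , c<s) , t)) r r<s
    ; closedM = λ (gx , m) a gy ¬t → gy , closedM m (onAdj σ gx gy a) (onGrid σ gy) (λ t → ¬t (gy , t))
    ; ranksM = pullRanks σ ranksM ; region = pullRegion σ region ; apart = λ (_ , m) (_ , x) → apart m x }
    where
    open Setup S
    σ = transpose s

  flippedSetup : Setup s j → Setup s j
  flippedSetup S = record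
    { T = pull σ T ; M = pull σ M ; X = pull σ X ; f = f ∘ to σ ; T? = pull? σ T? ; scarce = pullScarce σ scarce
    ; rowM = λ {r} r<s h c c<s → (r<s , c<s) , rowM r<s (λ i i<s t → h (mirror s i) (mirror-< i<s) ((r<s , mirror-< i<s) ,
                                subst (λ k → T (r , k)) (sym (mirror-invol i<s)) t)) (mirror s c) (mirror-< c<s)
    ; colM = λ c<s h r r<s → (r<s , c<s) , colM (mirror-< c<s) (λ i i<s t → h i i<s ((i<s , c<s) , t)) r r<s
    ; closedM = λ (gx , m) a gy ¬t → gy , closedM m (onAdj σ gx gy a) (onGrid σ gy) (λ t → ¬t (gy , t))
    ; ranksM = pullRanks σ ranksM ; region = pullRegion σ region ; apart = λ (_ , m) (_ , x) → apart m x }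
    where
    open Setup S
    σ = flip↔ s

  untranspose : ∀ S → Ranked (transposedSetup S) → Ranked S
  untranspose S = pullRanks⁻ (transpose s) (inGrid (Setup.region S))

  unflip : ∀ S → Ranked (flippedSetup S) → Ranked S
  unflip S = pullRanks⁻ (flip↔ s) (inGrid (Setup.region S))

module _ {s : ℕ} {good : ℕ → Set} (Sel : Selection good s) where
  open Selection Sel

  badRows : ∀ {P : Cell → Set} → (∀ r → r < s → ¬ good r → Σ[ c ∈ ℕ ] P (r , c)) → Pack bads P
  badRows f = mkPack (λ i → bad i , proj₁ (pick i)) (bad-inj ∘ cong proj₁) (λ i → proj₂ (pick i))
    where pick = λ i → f (bad i) (proj₁ (bad-ok i)) (proj₂ (bad-ok i))

  badCols : ∀ {P : Cell → Set} → (∀ c → c < s → ¬ good c → Σ[ r ∈ ℕ ] P (r , c)) → Pack bads P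
  badCols f = mkPack (λ i → proj₁ (pick i) , bad i) (bad-inj ∘ cong proj₂) (λ i → proj₂ (pick i))
    where pick = λ i → f (bad i) (proj₁ (bad-ok i)) (proj₂ (bad-ok i))

module Facts {s j : ℕ} (S : Setup s j) where
  open Setup S public

  Free : Cell → Set
  Free x = Grid s x × ¬ T x

  reach : ∀ {x y} → M x → Walk Adj Free x y → M y
  reach m w = proj₂ (end∈ (confine (λ m _ (g , ¬t) a → closedM m a g ¬t) m w))

  -- A free column lies in `M`, which does not meet `X`.
  colBlocked : ∀ {r c} → X (r , c) → ∃ λ i → i < s × T (i , c)
  colBlocked {r} {c} x with anyUpTo? (λ i → T? (i , c)) s
  ... | yes t = t
  ... | no ¬t = ⊥-elim (apart (colM (proj₂ (inGrid region x)) (λ i i<s t → ¬t (i , i<s , t)) r (proj₁ (inGrid region x))) x)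

  -- X cannot touch two opposite sides, because it would meet s columns, all of them blocked.
  avoidsEast : ∀ {r} → X (r , 0) → ∀ {x} → X x → suc (col x) < s
  avoidsEast x₀ {y} x with suc (col y) <? s
  ... | yes lt = lt
  ... | no ¬lt = ⊥-elim (<-irrefl refl (scarce (packWeaken proj₁ (packCols {P = λ z → Grid s z × T z} 0 s pt))))
    where
    pt : ∀ c → 0 ≤ c → c < s → Σ[ r ∈ ℕ ] Grid s (r , c) × T (r , c)
    pt c _ c<s with meetsCol region x₀ x c z≤n (s≤s⁻¹ (≤-trans c<s (≮⇒≥ ¬lt)))
    ... | r , y with colBlocked y
    ...   | i , i<s , t = i , (i<s , c<s) , t

  extent : ∀ {x} → X x → Σ[ a ∈ ℕ ] Σ[ b ∈ ℕ ] Σ[ r ∈ ℕ ] Σ[ r′ ∈ ℕ ] X (r , a) × X (r′ , b) ×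
           (∀ {y} → X y → a ≤ col y × col y ≤ b)
  extent {r , c} x with least meets? c (r , proj₁ (inGrid region x) , x) | greatest meets? s c (proj₂ (inGrid region x)) (r , proj₁ (inGrid region x) , x)
    where
    meets? : ∀ c → Dec (∃ λ r → r < s × X (r , c))
    meets? c = anyUpTo? (λ r → dec region (r , c)) s
  ... | a , _ , (r₁ , _ , x₁) , min | b , _ , _ , (r₂ , _ , x₂) , max =
    a , b , r₁ , r₂ , x₁ , x₂ , λ {y} x′ →
      ≮⇒≥ (λ lt → min (col y) lt (row y , proj₁ (inGrid region x′) , x′)) ,
      ≮⇒≥ (λ lt → max (col y) lt (proj₂ (inGrid region x′)) (row y , proj₁ (inGrid region x′) , x′))

-- X touches the top and the left side. With β = 2 + max (r + c) over the cells of X, at least β blocked cells lie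
-- on r + c < β, so that the lines free of blocked cells on r + c ≥ β are at least β + 1
-- in both directions, and they carry a copy of X turned by 180 degrees.

module Corner {s j : ℕ} (S : Setup s j) {c₀ r₀} (top : Setup.X S (0 , c₀)) (left : Setup.X S (r₀ , 0)) where
  open Facts S

  private
    avoidE : ∀ {x} → X x → suc (col x) < s
    avoidE = avoidsEast left

    avoidS : ∀ {x} → X x → suc (row x) < s
    avoidS {y} p = Facts.avoidsEast (transposedSetup S) {r = c₀} (swap (inGrid region top) , top) {swap y} (swap (inGrid region p) , p)

    module Build (i k : ℕ) (x : X (i , k)) (max : ∀ {y} → X y → row y + col y ≤ i + k) where

      β = suc i + suc k

      -- `X` touches the top and the left side and contains (i , k), so that it meets the rows 0 to
      -- i and the columns 0 to k. Each of these rows has an eastern end and each of these columns a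
      -- southern one; no cell is both, because (i , k) lies in its quadrant.
      near : Pack β (λ x → Grid s x × T x × row x + col x < β)
      near = packWeaken ok (packUnion
        (packRows {P = λ (r , c) → East region r c} 0 (suc i) λ r _ r≤i →
           let c , z = meetsRow region top x r z≤n (s≤s⁻¹ r≤i); c′ , _ , e = east-end region avoidE z in c′ , e)
        (packCols {P = λ (r , c) → South region r c} 0 (suc k) λ c _ c≤k →
           let r , z = meetsCol region left x c z≤n (s≤s⁻¹ c≤k); r′ , _ , e = south-end region avoidS z in r′ , e)
        (λ (e , _ , r≤i) (e′ , _ , c≤k) → east-south region e e′ x (s≤s⁻¹ r≤i) (s≤s⁻¹ c≤k)))
        where
        ok : ∀ {x} → (East region (row x) (col x) × _) ⊎ (South region (row x) (col x) × _) →
             Grid s x × T x × row x + col x < β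
        ok {r , .(suc c)} (inj₁ ((c , refl , y , t , g , _) , _)) = (proj₁ (inGrid region y) , g) , t , lem r c (max y)
          where
          lem : ∀ r c → r + c ≤ i + k → r + suc c < suc i + suc k
          lem r c h = by λ neg → clash 0 (h ⊕ neg) (solve (r ∷ c ∷ i ∷ k ∷ []))
        ok {.(suc r) , c} (inj₂ ((r , refl , y , t , g , _) , _)) = (g , proj₂ (inGrid region y)) , t , lem r c (max y)
          where
          lem : ∀ r c → r + c ≤ i + k → suc r + c < suc i + suc k
          lem r c h = by λ neg → clash 0 (h ⊕ neg) (solve (r ∷ c ∷ i ∷ k ∷ []))

      Far : ℕ → ℕ → Set
      Far r c = T (r , c) × β ≤ r + c

      far? : ∀ r c → Dec (Far r c)
      far? r c = T? (r , c) ×-dec (β ≤? r + c)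

      rows : Selection (λ r → ¬ ∃ λ c → c < s × Far r c) s
      rows = select (λ r → ¬? (anyUpTo? (far? r) s)) s

      cols : Selection (λ c → ¬ ∃ λ r → r < s × Far r c) s
      cols = select (λ c → ¬? (anyUpTo? (λ r → far? r c) s)) s

      open Selection

      -- The β near cells and one far cell for each bad line are fewer than s together; so more than
      -- β of the s lines are good.
      enough : ∀ {n k} → n + k ≡ s → Pack k (λ x → Grid s x × T x × β ≤ row x + col x) → β < n
      enough {n} {k} e p = lem β n k e (scarce (packWeaken [ (λ (g , t , _) → g , t) , (λ (g , t , _) → g , t) ]′
        (packUnion near p λ (_ , _ , lt) (_ , _ , le) → <⇒≱ lt le)))
        where
        lem : ∀ β n k → n + k ≡ s → β + k < s → β < n
        lem β n k e h = by λ neg → clash 0 (h ⊕ neg ⊕ ≤-reflexive (sym e)) (solve (β ∷ n ∷ k ∷ s ∷ []))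

      enoughRows : β < num rows
      enoughRows = enough (total rows) (badRows rows λ r r<s ¬g →
        let c , c<s , t , far = decidable-stable (anyUpTo? (far? r) s) ¬g in c , (r<s , c<s) , t , far)

      enoughCols : β < num cols
      enoughCols = enough (total cols) (badCols cols λ c c<s ¬g →
        let r , r<s , t , far = decidable-stable (anyUpTo? (λ r → far? r c) s) ¬g in r , (r<s , c<s) , t , far)

      ρ κ : ℕ → ℕ
      ρ = nth rows
      κ = nth cols

      ρ< : ∀ {u} → u ≤ β → ρ u < s
      ρ< u≤β = proj₁ (sound rows _ (≤-<-trans u≤β enoughRows))

      κ< : ∀ {u} → u ≤ β → κ u < s
      κ< u≤β = proj₁ (sound cols _ (≤-<-trans u≤β enoughCols))

      freeRow : ∀ {u c} → u ≤ β → c < s → β ≤ ρ u + c → ¬ T (ρ u , c)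
      freeRow u≤β c<s le t = proj₂ (sound rows _ (≤-<-trans u≤β enoughRows)) (_ , c<s , t , le)

      freeCol : ∀ {v r} → v ≤ β → r < s → β ≤ r + κ v → ¬ T (r , κ v)
      freeCol v≤β r<s le t = proj₂ (sound cols _ (≤-<-trans v≤β enoughCols)) (_ , r<s , t , le)

      -- β ≤ ρ β makes this row free over its whole length; the other free pieces of lines are
      -- reached from it.
      lastRow : ∀ c → c < s → M (ρ β , c)
      lastRow = rowM (ρ< ≤-refl) λ c c<s → freeRow ≤-refl c<s (≤-trans (increasing-id (inc rows) β) (m≤m+n _ c))

      beyond : ∀ {u v r c} → β ≤ u + v → ρ u ≤ r → κ v ≤ c → β ≤ r + c
      beyond {u} {v} le a b = ≤-trans le (+-mono-≤ (≤-trans (increasing-id (inc rows) u) a) (≤-trans (increasing-id (inc cols) v) b))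

      inCol : ∀ {u v} → u ≤ β → v ≤ β → β ≤ u + v → ∀ r → ρ u ≤ r → r ≤ ρ β → M (r , κ v)
      inCol {u} {v} u≤β v≤β le r a b = reach (lastRow (κ v) (κ< v≤β)) (reverse adj-sym (southWalk r (ρ β) (κ v) b λ r′ lo hi →
        (≤-<-trans hi (ρ< ≤-refl) , κ< v≤β) , freeCol v≤β (≤-<-trans hi (ρ< ≤-refl)) (beyond {u} {v} le (≤-trans a lo) ≤-refl)))

      inRow : ∀ {u v} → u ≤ β → v ≤ β → β ≤ u + v → ∀ c → κ v ≤ c → c < s → M (ρ u , c)
      inRow {u} {v} u≤β v≤β le c a b = reach (inCol u≤β v≤β le (ρ u) ≤-refl (increasing-≤ (inc rows) u≤β))
        (eastWalk (ρ u) (κ v) c a λ c′ lo hi → (ρ< u≤β , ≤-<-trans hi b) , freeRow u≤β (≤-<-trans hi b) (beyond {u} {v} le ≤-refl lo))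

      Turned : Cell → Set
      Turned (u , v) = u ≤ β × v ≤ β × X (β ∸ u , β ∸ v)

      -- The half turn takes r + c ≤ β - 2 to a sum of at least β + 2, and ρ and κ never decrease a
      -- coordinate; so the copy lies where the chosen lines are free.
      sum≥ : ∀ {u v} → Turned (u , v) → β ≤ u + v
      sum≥ {u} {v} (a , b , y) = lem (β ∸ u) (β ∸ v) u v (m∸n+n≡m a) (m∸n+n≡m b) (max y)
        where
        lem : ∀ p q u v → p + u ≡ suc i + suc k → q + v ≡ suc i + suc k → p + q ≤ i + k → suc i + suc k ≤ u + v
        lem p q u v e e′ h = by λ neg → clash 2 (neg ⊕ h ⊕ ≤-reflexive (sym e) ⊕ ≤-reflexive (sym e′)) (solve (p ∷ q ∷ u ∷ v ∷ i ∷ k ∷ []))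

      ranked : Ranked S
      ranked K = do
        g , R ← Lattice.ranks {X = Turned} ranksM (suc β) (λ (a , b , _) → s≤s a , s≤s b) (inc rows) (inc cols)
          (λ y@(a , b , _) → inRow a b (sum≥ y) _ ≤-refl (κ< b))
          (λ y@(a , b , _) (_ , b′ , _) c lo hi → inRow a b (sum≥ y) c lo (<-trans hi (κ< b′)))
          (λ y@(a , b , _) (a′ , _ , _) r lo hi → inCol a b (sum≥ y) r lo (≤-trans (<⇒≤ hi) (increasing-≤ (inc rows) a′)))
        K (g ∘ turn , ranksPull turn turned turn-adj turn-inj (ub R ∘ turned) R)
        where
        turn : Cell → Cell
        turn (r , c) = β ∸ r , β ∸ c
        ≤β : ∀ {r c} → X (r , c) → r ≤ β × c ≤ β
        ≤β {r} {c} y = lem r c (max y)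
          where
          lem : ∀ r c → r + c ≤ i + k → r ≤ suc i + suc k × c ≤ suc i + suc k
          lem r c h = (by λ neg → clash (2 + c) (h ⊕ neg) (solve (r ∷ c ∷ i ∷ k ∷ []))) , (by λ neg → clash (2 + r) (h ⊕ neg) (solve (r ∷ c ∷ i ∷ k ∷ [])))
        turn-turn : ∀ {x} → X x → turn (turn x) ≡ x
        turn-turn y = cong₂ _,_ (m∸[m∸n]≡n (proj₁ (≤β y))) (m∸[m∸n]≡n (proj₂ (≤β y)))
        turned : ∀ {x} → X x → Turned (turn x)
        turned {x} y = m∸n≤m β (row x) , m∸n≤m β (col x) , subst X (sym (turn-turn y)) y
        turn-inj : ∀ {x y} → X x → X y → turn x ≡ turn y → x ≡ y
        turn-inj p q e = trans (sym (turn-turn p)) (trans (cong turn e) (turn-turn q))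
        ∸-suc : ∀ {a} → suc a ≤ β → β ∸ a ≡ suc (β ∸ suc a)
        ∸-suc le = +-∸-assoc 1 le
        turn-adj : ∀ {x y} → X x → X y → Adj x y → Adj (turn x) (turn y)
        turn-adj _ q east rewrite ∸-suc (proj₂ (≤β q)) = west
        turn-adj p _ west rewrite ∸-suc (proj₂ (≤β p)) = east
        turn-adj _ q south rewrite ∸-suc (proj₁ (≤β q)) = north
        turn-adj p _ north rewrite ∸-suc (proj₁ (≤β p)) = south

  ranked : Ranked S
  ranked K = do
    (i , k) , x , max ← maximum {X} (λ x → row x + col x) (s + s)
      (λ x → +-mono-≤ (<⇒≤ (proj₁ (inGrid region x))) (<⇒≤ (proj₂ (inGrid region x)))) (s + s) (0 , c₀) top (m≤m+n _ _)
    Build.ranked i k x max K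

-- X avoids the top and the bottom, so that each of its columns contains two blocked cells.

module Strip {s j : ℕ} (S : Setup s j) where
  open Facts S
  open Selection

  freeCols : Selection (λ c → ¬ ∃ λ r → r < s × T (r , c)) s
  freeCols = select (λ c → ¬? (anyUpTo? (λ r → T? (r , c)) s)) s

  -- Each blocked column yields one blocked cell above all cells of `X` in it, and each column from
  -- a to b a second one below some cell of `X`. Hence the number of blocked columns plus the width
  -- of `X` is less than s.
  manyFreeCols : (∀ {x} → X x → 0 < row x) → (∀ {x} → X x → suc (row x) < s) →
                 ∀ {r r′ a b} → X (r , a) → X (r′ , b) → a ≤ b → suc (b ∸ a) < num freeCols
  manyFreeCols avoidN avoidS {a = a} {b} x x′ a≤b = lem (suc (b ∸ a)) (num freeCols) (bads freeCols) (total freeCols)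
    (scarce (packWeaken [ (λ (g , t , _) → g , t) , (λ (g , t , _) → g , t) ]′ (packUnion
      (badCols freeCols {λ (r , c) → Grid s (r , c) × T (r , c) × (∀ i → X (i , c) → r < i)} upper)
      (packWeaken proj₁ (packCols {P = λ (r , c) → Grid s (r , c) × T (r , c) × ∃ λ i → X (i , c) × i < r} a (suc (b ∸ a)) lower))
      (λ (_ , _ , h) (_ , _ , i , y , lt) → <-asym lt (h i y)))))
    where
    lem : ∀ w n k → n + k ≡ s → k + w < s → w < n
    lem w n k e h = by λ neg → clash 0 (h ⊕ neg ⊕ ≤-reflexive (sym e)) (solve (w ∷ n ∷ k ∷ s ∷ []))
    upper : ∀ c → c < s → ¬ ¬ (∃ λ r → r < s × T (r , c)) →
            Σ[ r ∈ ℕ ] Grid s (r , c) × T (r , c) × (∀ i → X (i , c) → r < i)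
    upper c c<s bad with anyUpTo? (λ i → dec region (i , c)) s
    ... | yes (i , _ , y) = let k , _ , z , t , above = north-end region avoidN y in
          k , (<-trans (n<1+n k) (proj₁ (inGrid region z)) , c<s) , t , λ i′ y′ → ≰⇒> λ le → above i′ le y′
    ... | no ¬y = let r , r<s , t = decidable-stable (anyUpTo? (λ r → T? (r , c)) s) bad in
          r , (r<s , c<s) , t , λ i y → ⊥-elim (¬y (i , proj₁ (inGrid region y) , y))
    lower : ∀ c → a ≤ c → c < a + suc (b ∸ a) → Σ[ r ∈ ℕ ] Grid s (r , c) × T (r , c) × ∃ λ i → X (i , c) × i < r
    lower c a≤c c< with meetsCol region x x′ c a≤c (s≤s⁻¹ (subst (c <_) (trans (+-suc a (b ∸ a)) (cong suc (m+[n∸m]≡n a≤b))) c<))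
    ... | i , y = let k , lt , _ , _ , _ , t , k<s , _ = south-end region avoidS y in k , (k<s , proj₂ (inGrid region y)) , t , i , y , lt

  -- The bounding box of `X` is moved to the first good rows and columns. A row need only be free
  -- from the chosen columns eastward, because these columns are entirely free and belong to `M`.
  module Embed {ρ κ : ℕ → ℕ} (ρ-inc : Increasing ρ) (κ-inc : Increasing κ) (a h b w : ℕ)
    (range : ∀ {x} → X x → (a ≤ row x × row x < a + h) × (b ≤ col x × col x < b + w))
    (ρ< : ∀ {u} → u < h → ρ u < s) (κ< : ∀ {v} → v < w → κ v < s)
    (freeCol : ∀ {v} → v < w → ∀ r → r < s → ¬ T (r , κ v))
    (freeRow : ∀ {u v c} → u < h → v < w → κ v ≤ c → c < s → ¬ T (ρ u , c)) where

    private
      X′ : Cell → Set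
      X′ (u , v) = X (a + u , b + v)

      bounds : ∀ {u v} → X′ (u , v) → u < h × v < w
      bounds x = let (_ , p) , (_ , q) = range x in +-cancelˡ-< a _ _ p , +-cancelˡ-< b _ _ q

      inM : ∀ {u v} → u < h → v < w → ∀ c → κ v ≤ c → c < s → M (ρ u , c)
      inM u<h v<w c lo hi = reach (colM (κ< v<w) (freeCol v<w) _ (ρ< u<h))
        (eastWalk _ _ c lo λ c′ lo′ hi′ → (ρ< u<h , ≤-<-trans hi′ hi) , freeRow u<h v<w lo′ (≤-<-trans hi′ hi))

      back : Cell → Cell
      back (r , c) = r ∸ a , c ∸ b

      forth : ∀ {x} → X x → (a + (row x ∸ a) , b + (col x ∸ b)) ≡ x
      forth x = let (p , _) , (q , _) = range x in cong₂ _,_ (m+[n∸m]≡n p) (m+[n∸m]≡n q)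

      into : ∀ {x} → X x → X′ (back x)
      into x = subst X (sym (forth x)) x

      back-inj : ∀ {x y} → X x → X y → back x ≡ back y → x ≡ y
      back-inj x y e = trans (sym (forth x)) (trans (cong₂ _,_ (cong ((a +_) ∘ proj₁) e) (cong ((b +_) ∘ proj₂) e)) (forth y))

      back-adj : ∀ {x y} → X x → X y → Adj x y → Adj (back x) (back y)
      back-adj x _ east rewrite +-∸-assoc 1 (proj₁ (proj₂ (range x))) = east
      back-adj _ y west rewrite +-∸-assoc 1 (proj₁ (proj₂ (range y))) = west
      back-adj x _ south rewrite +-∸-assoc 1 (proj₁ (proj₁ (range x))) = south
      back-adj _ y north rewrite +-∸-assoc 1 (proj₁ (proj₁ (range y))) = north

    ranked : Ranked S
    ranked K = do
      g , R ← Lattice.ranks {X = X′} ranksM s (λ x → ≤-<-trans (m≤n+m _ a) (proj₁ (inGrid region x)) , ≤-<-trans (m≤n+m _ b) (proj₂ (inGrid region x)))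
        ρ-inc κ-inc
        (λ x → let u< , v< = bounds x in inM u< v< _ ≤-refl (κ< v<))
        (λ x x′ c lo hi → let u< , v< = bounds x in inM u< v< c lo (<-trans hi (κ< (proj₂ (bounds x′)))))
        (λ x x′ r lo hi → let _ , v< = bounds x in colM (κ< v<) (freeCol v<) r (<-trans hi (ρ< (proj₁ (bounds x′)))))
      K (g ∘ back , ranksPull back into back-adj back-inj (ub R ∘ into) R)

  range : ∀ {a a′ b b′} → a ≤ a′ → b ≤ b′ → (∀ {x} → X x → (a ≤ row x × row x ≤ a′) × (b ≤ col x × col x ≤ b′)) →
          ∀ {x} → X x → (a ≤ row x × row x < a + suc (a′ ∸ a)) × (b ≤ col x × col x < b + suc (b′ ∸ b))
  range {a} {a′} {b} {b′} le le′ f {y} x = let (p , q) , (u , v) = f x in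
    (p , subst (row y <_) (shift le) (s≤s q)) , (u , subst (col y <_) (shift le′) (s≤s v))
    where
    shift : ∀ {a b} → a ≤ b → suc b ≡ a + suc (b ∸ a)
    shift {a} {b} le = sym (trans (+-suc a (b ∸ a)) (cong suc (m+[n∸m]≡n le)))

-- X touches the left side only: the free columns lie to the east of X, and so do enough long pieces of rows.

module Side {s j : ℕ} (S : Setup s j) (avoidN : ∀ {x} → Setup.X S x → 0 < row x)
            (avoidS : ∀ {x} → Setup.X S x → suc (row x) < s) {r₀} (left : Setup.X S (r₀ , 0)) where
  open Facts S
  open Strip S
  open Selection

  ranked : Ranked S
  ranked with extent left | Facts.extent (transposedSetup S) {0 , r₀} (swap (inGrid region left) , left)
  ... | b , b′ , rb , rb′ , xb , xb′ , colRange | a , a′ , ca , ca′ , (_ , xa) , (_ , xa′) , rowRange′ =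
    Embed.ranked (inc rows) (inc freeCols) a (suc (a′ ∸ a)) b (suc (b′ ∸ b))
      (range a≤a′ b≤b′ λ x → rowRange x , colRange x)
      (λ u< → proj₁ (sound rows _ (<-trans u< enough)))
      (λ v< → proj₁ (sound freeCols _ (<-trans v< enoughCols)))
      (λ v< r r<s t → proj₂ (sound freeCols _ (<-trans v< enoughCols)) (r , r<s , t))
      (λ u< v< lo c<s t → proj₂ (sound rows _ (<-trans u< enough)) (_ , c<s , t , <-≤-trans (outside v<) lo))
    where
    rowRange : ∀ {x} → X x → a ≤ row x × row x ≤ a′
    rowRange {x} p = rowRange′ {swap x} (swap (inGrid region p) , p)
    a≤a′ : a ≤ a′
    a≤a′ = proj₁ (rowRange xa′)
    b≤b′ : b ≤ b′
    b≤b′ = proj₁ (colRange xb′)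
    avoidE : ∀ {x} → X x → suc (col x) < s
    avoidE = avoidsEast left
    enoughCols : suc (b′ ∸ b) < num freeCols
    enoughCols = manyFreeCols avoidN avoidS xb xb′ b≤b′
    far? : ∀ r c → Dec (T (r , c) × suc b′ < c)
    far? r c = T? (r , c) ×-dec (suc b′ <? c)
    rows : Selection (λ r → ¬ ∃ λ c → c < s × T (r , c) × suc b′ < c) s
    rows = select (λ r → ¬? (anyUpTo? (far? r) s)) s
    enough : suc (a′ ∸ a) < num rows
    enough = lem (suc (a′ ∸ a)) (num rows) (bads rows) (total rows) (scarce (packWeaken [ (λ (g , t , _) → g , t) , (λ (g , t , _) → g , t) ]′
      (packUnion
        (badRows rows {λ x → Grid s x × T x × suc b′ < col x} λ r r<s ¬g →
          let c , c<s , t , lt = decidable-stable (anyUpTo? (far? r) s) ¬g in c , (r<s , c<s) , t , lt)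
        (packWeaken proj₁ (packRows {P = λ x → Grid s x × T x × col x ≤ suc b′} a (suc (a′ ∸ a)) ends))
        (λ (_ , _ , lt) (_ , _ , le) → <⇒≱ lt le))))
      where
      lem : ∀ w n k → n + k ≡ s → k + w < s → w < n
      lem w n k e h = by λ neg → clash 0 (h ⊕ neg ⊕ ≤-reflexive (sym e)) (solve (w ∷ n ∷ k ∷ s ∷ []))
      ends : ∀ r → a ≤ r → r < a + suc (a′ ∸ a) → Σ[ c ∈ ℕ ] Grid s (r , c) × T (r , c) × c ≤ suc b′
      ends r a≤r r< with meetsRow region xa xa′ r a≤r (s≤s⁻¹ (subst (r <_) (trans (+-suc a (a′ ∸ a)) (cong suc (m+[n∸m]≡n a≤a′))) r<))
      ... | c , y = let k , _ , k′ , e , z , t , k<s , _ = east-end region avoidE y in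
            k , (proj₁ (inGrid region y) , k<s) , t , subst (_≤ suc b′) (sym e) (s≤s (proj₂ (colRange z)))
    -- The columns 0 to b′ meet `X` and are blocked; column b′ + 1 contains the eastern neighbour of
    -- a cell of `X` in column b′.
    outside : ∀ {v} → v < suc (b′ ∸ b) → suc b′ < nth freeCols v
    outside {v} v< = ≰⇒> λ le → proj₂ (sound freeCols v (<-trans v< enoughCols)) (blocked (m≤n⇒m<n∨m≡n le))
      where
      blocked : nth freeCols v < suc b′ ⊎ nth freeCols v ≡ suc b′ → ∃ λ r → r < s × T (r , nth freeCols v)
      blocked (inj₁ lt) = colBlocked (proj₂ (meetsCol region left xb′ _ z≤n (s≤s⁻¹ lt)))
      blocked (inj₂ e) = rb′ , proj₁ (inGrid region xb′) , subst (λ c → T (rb′ , c)) (sym e)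
        (closed region xb′ east (proj₁ (inGrid region xb′) , avoidE xb′) λ y → <⇒≱ (proj₂ (colRange y)) ≤-refl)

module Loop {s j : ℕ} (S : Setup s j) (avoidN : ∀ {x} → Setup.X S x → 0 < row x)
            (avoidS : ∀ {x} → Setup.X S x → suc (row x) < s) (avoidW : ∀ {x} → Setup.X S x → 0 < col x)
            (avoidE : ∀ {x} → Setup.X S x → suc (col x) < s) {x₀} (x : Setup.X S x₀) where
  open Facts S
  open Strip S
  open Selection

  ranked : Ranked S
  ranked with extent x | Facts.extent (transposedSetup S) {swap x₀} (swap (inGrid region x) , x)
  ... | b , b′ , rb , rb′ , xb , xb′ , colRange | a , a′ , ca , ca′ , xa , xa′ , rowRange′ =
    Embed.ranked (inc rows) (inc freeCols) a (suc (a′ ∸ a)) b (suc (b′ ∸ b))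
      (range a≤a′ b≤b′ λ x → rowRange x , colRange x)
      (λ u< → proj₁ (sound rows _ (<-trans u< enough)))
      (λ v< → proj₁ (sound freeCols _ (<-trans v< enoughCols)))
      (λ v< r r<s t → proj₂ (sound freeCols _ (<-trans v< enoughCols)) (r , r<s , t))
      (λ {u} u< v< lo c<s t → proj₂ (sound rows u (<-trans u< enough))
         (_ , c<s , (c<s , proj₁ (sound rows u (<-trans u< enough))) , t))
    where
    rows = Strip.freeCols (transposedSetup S)
    rowRange : ∀ {x} → X x → a ≤ row x × row x ≤ a′
    rowRange {x} p = rowRange′ {swap x} (swap (inGrid region p) , p)
    a≤a′ : a ≤ a′
    a≤a′ = proj₁ (rowRange (proj₂ xa′))
    b≤b′ : b ≤ b′
    b≤b′ = proj₁ (colRange xb′)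
    enoughCols : suc (b′ ∸ b) < num freeCols
    enoughCols = manyFreeCols avoidN avoidS xb xb′ b≤b′
    enough : suc (a′ ∸ a) < num rows
    enough = Strip.manyFreeCols (transposedSetup S) (λ (_ , y) → avoidW y) (λ (_ , y) → avoidE y) xa xa′ a≤a′

private
  >0 : ∀ {n} → n ≢ 0 → 0 < n
  >0 = n≢0⇒n>0

  last< : ∀ {s i} → i < s → suc i ≢ s → suc i < s
  last< = ≤∧≢⇒<

module _ {s j : ℕ} where

  private
    upsideSetup : Setup s j → Setup s j
    upsideSetup S = transposedSetup (flippedSetup (transposedSetup S))

    un-upside : ∀ S → Ranked (upsideSetup S) → Ranked S
    un-upside S = untranspose S ∘ unflip (transposedSetup S) ∘ untranspose (flippedSetup (transposedSetup S))

    mirrored : ∀ {i} → i < s → suc i ≡ s → mirror s 0 ≡ i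
    mirrored _ refl = refl

    withLeft : (S : Setup s j) → ∀ {r} → Setup.X S (r , 0) → Ranked S
    withLeft S {r} x K = do
      no ¬top ← em (Σ[ c ∈ ℕ ] X (0 , c))
        where yes (_ , y) → Corner.ranked S y x K
      no ¬bottom ← em (Σ[ y ∈ Cell ] X y × suc (row y) ≡ s)
        where
        yes (y , p , e) → un-upside S (Corner.ranked (upsideSetup S) {c₀ = col y} {r₀ = mirror s r} (top p e) (lft x)) K
      Side.ranked S (λ {y} p → >0 λ e → ¬top (col y , subst (λ i → X (i , col y)) e p))
                    (λ {y} p → last< (proj₁ (inGrid region p)) λ e → ¬bottom (y , p , e)) x K
      where
      open Setup S
      lft : ∀ {r} → X (r , 0) → Setup.X (upsideSetup S) (mirror s r , 0)
      lft {r} x = let a , b = inGrid region x in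
        (mirror-< a , b) , (b , mirror-< a) , (b , mirror-< (mirror-< a)) , subst (λ i → X (i , 0)) (sym (mirror-invol a)) x
      top : ∀ {y} → X y → suc (row y) ≡ s → Setup.X (upsideSetup S) (0 , col y)
      top {y} p e = let a , b = inGrid region p; m = mirrored a e; z = ≤-<-trans z≤n a in
        (z , b) , (b , z) , (b , subst (_< s) (sym m) a) , subst (λ i → X (i , col y)) (sym m) p

    withLeftOrRight : (S : Setup s j) → ∀ {x} → Setup.X S x → col x ≡ 0 ⊎ suc (col x) ≡ s → Ranked S
    withLeftOrRight S p (inj₁ refl) = withLeft S p
    withLeftOrRight S {r , c} p (inj₂ e) = unflip S (withLeft (flippedSetup S) {r}
      ((a , ≤-<-trans z≤n b) , subst (λ i → X (r , i)) (sym (mirrored b e)) p))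
      where
      open Setup S
      a = proj₁ (inGrid region p)
      b = proj₂ (inGrid region p)

  setupRanked : (S : Setup s j) → ∀ {x} → Setup.X S x → Ranked S
  setupRanked S {x₀} x K = do
    no ¬h ← em (Σ[ y ∈ Cell ] X y × (col y ≡ 0 ⊎ suc (col y) ≡ s))
      where yes (y , p , e) → withLeftOrRight S p e K
    no ¬v ← em (Σ[ y ∈ Cell ] X y × (row y ≡ 0 ⊎ suc (row y) ≡ s))
      where yes (y , p , e) → untranspose S (withLeftOrRight (transposedSetup S) {swap y} (swap (inGrid region p) , p) e) K
    Loop.ranked S (λ p → >0 λ e → ¬v (_ , p , inj₁ e)) (λ p → last< (proj₁ (inGrid region p)) λ e → ¬v (_ , p , inj₂ e))
      (λ p → >0 λ e → ¬h (_ , p , inj₁ e)) (λ p → last< (proj₂ (inGrid region p)) λ e → ¬h (_ , p , inj₂ e)) x K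
    where open Setup S

module _ {s j : ℕ} {T M : Cell → Set} {f : Cell → ℕ} (T? : ∀ x → Dec (T x)) (L : List Cell)
  (complete : ∀ {x} → Grid s x → T x → x ∈ L) (short : length L < s)
  (rowM : ∀ {r} → r < s → (∀ c → c < s → ¬ T (r , c)) → ∀ c → c < s → M (r , c))
  (colM : ∀ {c} → c < s → (∀ r → r < s → ¬ T (r , c)) → ∀ r → r < s → M (r , c))
  (closedM : ∀ {x y} → M x → Adj x y → Grid s y → ¬ T y → M y)
  (ranksM : Ranks j f M) where

  private
    Free : Cell → Set
    Free x = Grid s x × ¬ T x

    walkM : ∀ {x y} → M x → Walk Adj Free x y → M y
    walkM m w = proj₂ (end∈ (confine (λ m _ (g , ¬t) a → closedM m a g ¬t) m w))

    component : ∀ {x} → Free x → NN (Σ[ g ∈ (Cell → ℕ) ] Ranks j g (Walk Adj Free x))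
    component {x} free K = do
      no ¬m ← em (M x)
        where yes m → K (f , ranksShrink (walkM m) (ub ranksM ∘ walkM m) ranksM)
      W? ← decGrid (Walk Adj Free x) s (proj₁ ∘ end∈)
      setupRanked (record
        { T = T ; M = M ; X = Walk Adj Free x ; f = f ; T? = T?
        ; scarce = λ p → ≤-<-trans (packLength (packWeaken (λ (g , t) → complete g t) p)) short
        ; rowM = rowM ; colM = colM ; closedM = closedM ; ranksM = ranksM
        ; region = record
            { inGrid = proj₁ ∘ end∈
            ; dec = W?
            ; off = proj₂ ∘ end∈
            ; closed = λ {_} {y} w a g ¬w → decidable-stable (T? y) λ ¬t → ¬w (w ⊙ go (end∈ w) a (stop (g , ¬t)))
            ; joined = λ w w′ → proj₂′ (confine {I = Walk Adj Free x} (λ i p q a → i ⊙ go p a (stop q)) w (reverse adj-sym w ⊙ w′)) }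
        ; apart = λ m w → ¬m (walkM m (reverse adj-sym w)) }) (stop free) K
      where
      proj₂′ : ∀ {I : Cell → Set} {y z} → Walk Adj (λ v → Free v × I v) y z → Walk Adj I y z
      proj₂′ = weaken proj₂

  dominate : NN (Σ[ g ∈ (Cell → ℕ) ] Ranks (length L + j) g (Grid s))
  dominate K = do
    g , R ← ranksComponents s proj₁ component
    let g′ , R′ = ranksAdd R L
    K (g′ , ranksShrink into (ub R′ ∘ into) R′)
    where
    into : ∀ {x} → Grid s x → Free x ⊎ x ∈ L
    into {x} g with T? x
    ... | yes t = inj₂ (complete g t)
    ... | no ¬t = inj₁ (g , ¬t)

-- Boards, pockets and their symmetries

Square : ℕ → ℕ → ℕ → Cell → Set
Square s p q (r , c) = (p ≤ r × r < p + s) × (q ≤ c × c < q + s)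

Out : ℕ → (Cell → Set) → ℕ → ℕ → Cell → Set
Out s T p q x = T x × ¬ Square s p q x

record Eats (s : ℕ) (T P : Cell → Set) (p q : ℕ) : Set where
  field
    eatsRow : ∀ {r} → p ≤ r → r < p + s → (∀ c → q ≤ c → c < q + s → ¬ T (r , c)) → ∀ c → q ≤ c → c < q + s → P (r , c)
    eatsCol : ∀ {c} → q ≤ c → c < q + s → (∀ r → p ≤ r → r < p + s → ¬ T (r , c)) → ∀ r → p ≤ r → r < p + s → P (r , c)
    someRow : Σ[ r ∈ ℕ ] p ≤ r × r < p + s × (∀ c → q ≤ c → c < q + s → P (r , c))
    someCol : Σ[ c ∈ ℕ ] q ≤ c × c < q + s × (∀ r → p ≤ r → r < p + s → P (r , c))
open Eats public

-- S is the set of the vertices deleted so far and M the main component of the rest; T is S with at most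
-- one further vertex. A pocket is any other component of the complement of S. It eats a square
-- if it contains the rows and columns of the square which are free of T.

record Board (m s : ℕ) : Set₁ where
  field
    S T M  : Cell → Set
    T?     : ∀ x → Dec (T x)
    S⊆T    : ∀ {x} → S x → T x
    T-grid : ∀ {x} → T x → Grid m x
    few    : ∀ {n} → Pack n T → n < m + s
    M-off  : ∀ {x} → M x → ¬ S x
    noLR   : ∀ {x y} → col x ≡ 0 → suc (col y) ≡ m → ¬ Walk Adj (λ z → Grid m z × ¬ M z) x y
    noTB   : ∀ {x y} → row x ≡ 0 → suc (row y) ≡ m → ¬ Walk Adj (λ z → Grid m z × ¬ M z) x y
    small  : suc (5 * s) ≤ 2 * m
    large  : 2 * m ≤ 5 * s + 5
    s>0    : 1 ≤ s

  Pocket : (Cell → Set) → Set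
  Pocket P = Region m S P × (∀ {x} → M x → P x → ⊥)

  Outside : ℕ → ℕ → Cell → Set
  Outside = Out s T

  field
    eaten : ∀ p q → p + s ≤ m → q + s ≤ m → Pack m (Outside p q) →
            NN (Σ[ P ∈ (Cell → Set) ] Pocket P × Eats s T P p q)

module _ {m s : ℕ} where

  open Board

  mirror-window : ∀ {q q′ c} → q + q′ + s ≡ m → c < m → q ≤ c → c < q + s → q′ ≤ mirror m c × mirror m c < q′ + s
  mirror-window {q} {q′} {c} e c<m lo hi = lem (mirror m c) (mirror-+ c<m)
    where
    lem : ∀ d → d + suc c ≡ m → q′ ≤ d × d < q′ + s
    lem d e′ = (by λ neg → clash 0 (≤-reflexive (sym e′) ⊕ ≤-reflexive e ⊕ hi ⊕ neg) (solve (q ∷ q′ ∷ c ∷ d ∷ m ∷ s ∷ [])))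
             , (by λ neg → clash 0 (neg ⊕ ≤-reflexive e′ ⊕ lo ⊕ ≤-reflexive (sym e)) (solve (q ∷ q′ ∷ c ∷ d ∷ m ∷ s ∷ [])))

  packTransposed : ∀ {k T p q} → Pack k (Out s (pull (transpose m) T) p q) → Pack k (Out s T q p)
  packTransposed = pullPack (transpose m) (proj₁ ∘ proj₁) (λ ((_ , t) , ¬sq) → t , ¬sq ∘ swap)

  packFlipped : ∀ {k T p q q′} → q + q′ + s ≡ m → Pack k (Out s (pull (flip↔ m) T) p q′) → Pack k (Out s T p q)
  packFlipped {T = T} {p} {q} {q′} e = pullPack (flip↔ m) (proj₁ ∘ proj₁) out
    where
    out : ∀ {x} → Out s (pull (flip↔ m) T) p q′ x → Out s T p q (to (flip↔ m) x)
    out {r , c} (((_ , c<m) , t) , ¬sq) = t , λ (a , (lo , hi)) → ¬sq (a ,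
      let u , v = mirror-window e (mirror-< c<m) lo hi in subst (λ k → q′ ≤ k × k < q′ + s) (mirror-invol c<m) (u , v))

  transposed : Board m s → Board m s
  transposed B = record
    { S = pull σ (S B) ; T = pull σ (T B) ; M = pull σ (M B) ; T? = pull? σ (T? B)
    ; S⊆T = λ (g , x) → g , S⊆T B x ; T-grid = proj₁
    ; few = λ p → few B (pullPack σ proj₁ proj₂ p)
    ; M-off = λ (_ , x) (_ , y) → M-off B x y
    ; noLR = λ l r w → noTB B l r (mapWalk swap push (λ p q → onAdj σ (proj₁ p) (proj₁ q)) w)
    ; noTB = λ l r w → noLR B l r (mapWalk swap push (λ p q → onAdj σ (proj₁ p) (proj₁ q)) w)
    ; small = small B ; large = large B ; s>0 = s>0 B
    ; eaten = λ p q p≤ q≤ pk K → eaten B q p q≤ p≤ (packTransposed pk)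
        λ (P , (R , apart) , E) → K (pull σ P , (pullRegion σ R , λ (_ , x) (_ , y) → apart x y) , record
          { eatsRow = λ {r} a b h c lo hi → (<-≤-trans b p≤ , <-≤-trans hi q≤) , eatsCol E a b
              (λ i lo′ hi′ t → h i lo′ hi′ ((<-≤-trans b p≤ , <-≤-trans hi′ q≤) , t)) c lo hi
          ; eatsCol = λ a b h r lo hi → (<-≤-trans hi p≤ , <-≤-trans b q≤) , eatsRow E a b
              (λ i lo′ hi′ t → h i lo′ hi′ ((<-≤-trans hi′ p≤ , <-≤-trans b q≤) , t)) r lo hi
          ; someRow = let c , a , b , f = someCol E in c , a , b , λ i lo hi → (<-≤-trans b p≤ , <-≤-trans hi q≤) , f i lo hi
          ; someCol = let r , a , b , f = someRow E in r , a , b , λ i lo hi → (<-≤-trans hi p≤ , <-≤-trans b q≤) , f i lo hi }) }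
    where
    σ = transpose m
    push : ∀ {z} → Grid m z × ¬ pull σ (M B) z → Grid m (swap z) × ¬ M B (swap z)
    push (g , ¬x) = swap g , λ x → ¬x (g , x)

  flipped : Board m s → Board m s
  flipped B = record
    { S = pull σ (S B) ; T = pull σ (T B) ; M = pull σ (M B) ; T? = pull? σ (T? B)
    ; S⊆T = λ (g , x) → g , S⊆T B x ; T-grid = proj₁
    ; few = λ p → few B (pullPack σ proj₁ proj₂ p)
    ; M-off = λ (_ , x) (_ , y) → M-off B x y
    ; noLR = λ {x} {y} l r w → noLR B (trans (cong (mirror m) (suc-injective (trans r (sym (mirror-0 (end∈ w)))))) (mirror-invol (0<m (end∈ w))))
        (trans (cong (suc ∘ mirror m) l) (mirror-0 (start∈ w))) (reverse adj-sym (push w))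
    ; noTB = λ l r w → noTB B l r (push w)
    ; small = small B ; large = large B ; s>0 = s>0 B
    ; eaten = eaten′ }
    where
    σ = flip↔ m
    0<m : ∀ {z} → Grid m z × ¬ pull σ (M B) z → 0 < m
    0<m (g , _) = ≤-<-trans z≤n (proj₂ g)
    mirror-0 : ∀ {z} → Grid m z × ¬ pull σ (M B) z → suc (mirror m 0) ≡ m
    mirror-0 z = trans (sym (+-comm (mirror m 0) 1)) (mirror-+ (0<m z))
    push : ∀ {x y} → Walk Adj (λ z → Grid m z × ¬ pull σ (M B) z) x y → Walk Adj (λ z → Grid m z × ¬ M B z) (to σ x) (to σ y)
    push = mapWalk (to σ) (λ (g , ¬x) → onGrid σ g , λ x → ¬x (g , x)) (λ p q → onAdj σ (proj₁ p) (proj₁ q))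
    eaten′ : ∀ p q → p + s ≤ m → q + s ≤ m → Pack m (λ x → pull σ (T B) x × ¬ Square s p q x) →
             NN (Σ[ P ∈ (Cell → Set) ] (Region m (pull σ (S B)) P × (∀ {x} → pull σ (M B) x → P x → ⊥)) × Eats s (pull σ (T B)) P p q)
    eaten′ p q p≤ q≤ pk K = eaten B p q′ p≤ q′≤ (packFlipped e₂ pk) λ (P , (R , apart) , E) →
      K (pull σ P , (pullRegion σ R , λ (_ , x) (_ , y) → apart x y) , record
        { eatsRow = λ {r} a b h c lo hi → (<-≤-trans b p≤ , <-≤-trans hi q≤) ,
            let u , v = onward hi lo in eatsRow E a b (λ i lo′ hi′ t → let u′ , v′ = back hi′ lo′ in h (mirror m i) u′ v′
              ((<-≤-trans b p≤ , mirror-< (<-≤-trans hi′ q′≤)) , subst (λ k → T B (r , k)) (sym (mirror-invol (<-≤-trans hi′ q′≤))) t)) _ u v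
        ; eatsCol = λ {c} a b h r lo hi → (<-≤-trans hi p≤ , <-≤-trans b q≤) ,
            let u , v = onward b a in eatsCol E u v (λ i lo′ hi′ t → h i lo′ hi′ ((<-≤-trans hi′ p≤ , <-≤-trans b q≤) , t)) r lo hi
        ; someRow = let r , a , b , f = someRow E in r , a , b , λ i lo hi → (<-≤-trans b p≤ , <-≤-trans hi q≤) ,
            let u , v = onward hi lo in f _ u v
        ; someCol = let c , a , b , f = someCol E; u , v = back b a in mirror m c , u , v , λ i lo hi →
            (<-≤-trans hi p≤ , mirror-< (<-≤-trans b q′≤)) , subst (λ k → P (i , k)) (sym (mirror-invol (<-≤-trans b q′≤))) (f i lo hi) })
      where
      q′ = m ∸ (q + s)
      e : q′ + (q + s) ≡ m
      e = m∸n+n≡m q≤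
      e₁ : q + q′ + s ≡ m
      e₁ = lem q′ e
        where
        lem : ∀ q′ → q′ + (q + s) ≡ m → q + q′ + s ≡ m
        lem q′ e = ≤-antisym (by λ neg → clash 0 (≤-reflexive e ⊕ neg) (solve (q ∷ q′ ∷ s ∷ m ∷ []))) (by λ neg → clash 0 (≤-reflexive (sym e) ⊕ neg) (solve (q ∷ q′ ∷ s ∷ m ∷ [])))
      e₂ : q′ + q + s ≡ m
      e₂ = trans (+-assoc q′ q s) e
      q′≤ : q′ + s ≤ m
      q′≤ = ≤-trans (+-monoʳ-≤ q′ (m≤n+m s q)) (≤-reflexive e)
      onward : ∀ {c} → c < q + s → q ≤ c → q′ ≤ mirror m c × mirror m c < q′ + s
      onward hi lo = mirror-window e₁ (<-≤-trans hi q≤) lo hi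
      back : ∀ {c} → c < q′ + s → q′ ≤ c → q ≤ mirror m c × mirror m c < q + s
      back hi lo = mirror-window e₂ (<-≤-trans hi q′≤) lo hi

  upside : Board m s → Board m s
  upside = transposed ∘ flipped ∘ transposed

module Pockets {m s : ℕ} (B : Board m s) where
  open Board B public

  notLR : ∀ {P} → Pocket P → ∀ {x y} → P x → P y → col x ≡ 0 → suc (col y) ≡ m → ⊥
  notLR (R , apart) x y l r = noLR l r (weaken (λ p → inGrid R p , λ z → apart z p) (joined R x y))

  notTB : ∀ {P} → Pocket P → ∀ {x y} → P x → P y → row x ≡ 0 → suc (row y) ≡ m → ⊥
  notTB (R , apart) x y l r = noTB l r (weaken (λ p → inGrid R p , λ z → apart z p) (joined R x y))

  -- A common boundary cell of pockets on opposite sides would complete a walk which cuts M.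
  separated : ∀ {P P′} → Pocket P → Pocket P′ → ∀ {x y z v w} → P x → col x ≡ 0 → P y → Adj y z → S z → Grid m z →
              Adj z v → P′ v → P′ w → suc (col w) ≡ m → ⊥
  separated (R , apart) (R′ , apart′) x l y a sz g a′ v w r =
    noLR l r (weaken (λ p → inGrid R p , λ z → apart z p) (joined R x y) ⊙
      go (inGrid R y , λ z → apart z y) a (go (g , λ z → M-off z sz) a′
        (weaken (λ p → inGrid R′ p , λ z → apart′ z p) (joined R′ v w))))

  fits : s + s ≤ m
  fits = lem m s small
    where
    lem : ∀ m s → suc (5 * s) ≤ 2 * m → s + s ≤ m
    lem m s h = by λ neg → clash (2 + s) (2 ⊛ neg ⊕ h) (solve (m ∷ s ∷ []))

  s≤m : s ≤ m
  s≤m = ≤-trans (m≤m+n s s) fits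

  q : ℕ
  q = m ∸ s

  q+s : q + s ≡ m
  q+s = m∸n+n≡m s≤m

  s≤q : s ≤ q
  s≤q = +-cancelʳ-≤ s s q (≤-trans fits (≤-reflexive (sym q+s)))

  q≤m : q ≤ m
  q≤m = m∸n≤m m s

  tooMany : ∀ {n P} → (∀ {x} → P x → T x) → Pack n P → m + s ≤ n → ⊥
  tooMany f p le = <⇒≱ (few (packWeaken f p)) le

  s<m : s < m
  s<m = lem m s small s>0
    where
    lem : ∀ m s → suc (5 * s) ≤ 2 * m → 1 ≤ s → s < m
    lem m s h h′ = by λ neg → clash 3 (2 ⊛ neg ⊕ h ⊕ 3 ⊛ h′) (solve (m ∷ s ∷ []))

  0<m : 0 < m
  0<m = ≤-<-trans z≤n s<m

  -- All that is kept of an eaten square at the left side is one full row of it. The pocket then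
  -- touches the left side and cannot touch the right one.
  record LeftEater (P : Cell → Set) : Set where
    field
      pocket : Pocket P
      line   : ℕ
      full   : ∀ c → c < s → P (line , c)

    R : Region m S P
    R = proj₁ pocket

    touch : P (line , 0)
    touch = full 0 s>0

    avoidE : ∀ {x} → P x → suc (col x) < m
    avoidE {x} p with suc (col x) ≟ m
    ... | yes e = ⊥-elim (notLR pocket touch p refl e)
    ... | no ¬e = ≤∧≢⇒< (proj₂ (inGrid R p)) ¬e

    avoidS : ∀ {c} → P (0 , c) → ∀ {x} → P x → suc (row x) < m
    avoidS t {x} p with suc (row x) ≟ m
    ... | yes e = ⊥-elim (notTB pocket t p refl e)
    ... | no ¬e = ≤∧≢⇒< (proj₁ (inGrid R p)) ¬e

    avoidN : ∀ {r c} → P (r , c) → suc r ≡ m → ∀ {x} → P x → 0 < row x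
    avoidN t e {zero , _} p = ⊥-elim (notTB pocket p t refl e)
    avoidN t e {suc _ , _} p = s≤s z≤n

  record RightEater (P : Cell → Set) : Set where
    field
      pocket : Pocket P
      line   : ℕ
      full   : ∀ c → q ≤ c → c < m → P (line , c)

    R : Region m S P
    R = proj₁ pocket

  leftEater : ∀ {P p} → Pocket P → Eats s T P p 0 → LeftEater P
  leftEater pk E = let r , _ , _ , f = someRow E in record { pocket = pk ; line = r ; full = λ c → f c z≤n }

  rightEater : ∀ {P p} → Pocket P → Eats s T P p q → RightEater P
  rightEater pk E = let r , _ , _ , f = someRow E in record
    { pocket = pk ; line = r ; full = λ c lo hi → f c lo (subst (c <_) (sym q+s) hi) }

module _ {m s : ℕ} (B : Board m s) where
  open Pockets B using (q; q+s; s≤m)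
  open Pockets using (LeftEater; RightEater)
  open Board using (Pocket)

  private
    q≡ : ∀ {c} → c < m → q ≤ c → mirror m c < s
    q≡ {c} c<m le = lem (mirror m c) q (mirror-+ c<m) q+s le
      where
      lem : ∀ d q → d + suc c ≡ m → q + s ≡ m → q ≤ c → d < s
      lem d q e e′ h = by λ neg → clash 0 (≤-reflexive e ⊕ neg ⊕ h ⊕ ≤-reflexive (sym e′)) (solve (d ∷ q ∷ c ∷ m ∷ s ∷ []))

    s≡ : ∀ {c} → c < s → q ≤ mirror m c
    s≡ {c} lt = lem (mirror m c) q (mirror-+ (<-≤-trans lt s≤m)) q+s
      where
      lem : ∀ d q → d + suc c ≡ m → q + s ≡ m → q ≤ d
      lem d q e e′ = by λ neg → clash 0 (lt ⊕ ≤-reflexive e′ ⊕ neg ⊕ ≤-reflexive (sym e)) (solve (d ∷ q ∷ c ∷ m ∷ s ∷ []))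

  pocketTransposed : ∀ {P} → Pocket B P → Pocket (transposed B) (pull (transpose m) P)
  pocketTransposed (R , apart) = pullRegion (transpose m) R , λ (_ , x) (_ , y) → apart x y

  pocketFlipped : ∀ {P} → Pocket B P → Pocket (flipped B) (pull (flip↔ m) P)
  pocketFlipped (R , apart) = pullRegion (flip↔ m) R , λ (_ , x) (_ , y) → apart x y

  leftFlipped : ∀ {P} → LeftEater B P → RightEater (flipped B) (pull (flip↔ m) P)
  leftFlipped L = record { pocket = pocketFlipped pocket ; line = line
    ; full = λ c lo c<m → (proj₁ (inGrid R touch) , c<m) , full _ (q≡ c<m lo) }
    where open LeftEater L

  rightFlipped : ∀ {P} → RightEater B P → LeftEater (flipped B) (pull (flip↔ m) P)
  rightFlipped L = record { pocket = pocketFlipped pocket ; line = line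
    ; full = λ c c<s → let x = full _ (s≡ c<s) (mirror-< (<-≤-trans c<s s≤m)) in (proj₁ (inGrid R x) , <-≤-trans c<s s≤m) , x }
    where open RightEater L

module _ {m s : ℕ} (B : Board m s) where
  open Pockets B using (q; q+s; s≤m; 0<m; s<m)
  open Pockets using (LeftEater; RightEater)
  open Board using (Pocket)

  Upside : (Cell → Set) → Cell → Set
  Upside P = pull (transpose m) (pull (flip↔ m) (pull (transpose m) P))

  upside-in : ∀ {P : Cell → Set} {r c} → r < m → c < m → P (r , c) → Upside P (mirror m r , c)
  upside-in {P} {c = c} r<m c<m x = (mirror-< r<m , c<m) , (c<m , mirror-< r<m) , (c<m , mirror-< (mirror-< r<m)) ,
    subst (λ k → P (k , c)) (sym (mirror-invol r<m)) x

  pocketUpside : ∀ {P} → Pocket B P → Pocket (upside B) (Upside P)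
  pocketUpside = pocketTransposed (flipped (transposed B)) ∘ pocketFlipped (transposed B) ∘ pocketTransposed B

  leftUpside : ∀ {P} → LeftEater B P → LeftEater (upside B) (Upside P)
  leftUpside {P} L = record { pocket = pocketUpside pocket ; line = mirror m line
    ; full = λ c c<s → upside-in {P} (proj₁ (inGrid R touch)) (<-≤-trans c<s s≤m) (full c c<s) }
    where open LeftEater L

  rightUpside : ∀ {P} → RightEater B P → RightEater (upside B) (Upside P)
  rightUpside {P} L = record { pocket = pocketUpside pocket ; line = mirror m line
    ; full = λ c lo c<m → upside-in {P} (proj₁ (inGrid R (full c lo c<m))) c<m (full c lo c<m) }
    where open RightEater L

  packUpside : ∀ {k p p′ q} → p + p′ + s ≡ m → Pack k (Board.Outside (upside B) p′ q) → Pack k (Board.Outside B p q)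
  packUpside e = packTransposed ∘ packFlipped e ∘ packTransposed

-- King chains from the top to the bottom

record Chain (m : ℕ) (T : Cell → Set) : Set where
  field
    end   : ℕ
    at    : ℕ → Cell
    on    : ∀ {i} → i ≤ end → T (at i)
    king  : ∀ {i} → i < end → King (at i) (at (suc i))
    distinct : ∀ {i j} → i ≤ end → j ≤ end → at i ≡ at j → i ≡ j
    first : row (at 0) ≡ 0
    last  : suc (row (at end)) ≡ m

module _ {T : Cell → Set} where

  private
    size : ∀ {x y} → Walk King T x y → ℕ
    size (stop _) = 0
    size (go _ _ w) = suc (size w)

    cell : ∀ {x y} → Walk King T x y → ℕ → Cell
    cell (stop {x} _) _ = x
    cell (go {x} _ _ _) zero = x
    cell (go _ _ w) (suc i) = cell w i

    cell∈ : ∀ {x y} (w : Walk King T x y) {i} → i ≤ size w → cell w i ∈ cells w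
    cell∈ (stop _) _ = here refl
    cell∈ (go _ _ _) {zero} _ = here refl
    cell∈ (go _ _ w) {suc i} (s≤s le) = there (cell∈ w le)

    cell-start : ∀ {x y} (w : Walk King T x y) → cell w 0 ≡ x
    cell-start (stop _) = refl
    cell-start (go _ _ _) = refl

    cell-end : ∀ {x y} (w : Walk King T x y) → cell w (size w) ≡ y
    cell-end (stop _) = refl
    cell-end (go _ _ w) = cell-end w

    cell-king : ∀ {x y} (w : Walk King T x y) {i} → i < size w → King (cell w i) (cell w (suc i))
    cell-king (go {x} _ a w) {zero} _ = subst (King x) (sym (cell-start w)) a
    cell-king (go _ _ w) {suc i} (s≤s lt) = cell-king w lt

    cell-inj : ∀ {x y} (w : Walk King T x y) → Unique (cells w) → ∀ {i j} → i ≤ size w → j ≤ size w → cell w i ≡ cell w j → i ≡ j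
    cell-inj (stop _) _ z≤n z≤n _ = refl
    cell-inj (go _ _ w) _ {zero} {zero} _ _ _ = refl
    cell-inj (go _ _ w) (n AllPairs.∷ _) {zero} {suc j} _ (s≤s le) e = ⊥-elim (All.lookup n (cell∈ w le) e)
    cell-inj (go _ _ w) (n AllPairs.∷ _) {suc i} {zero} (s≤s le) _ e = ⊥-elim (All.lookup n (cell∈ w le) (sym e))
    cell-inj (go _ _ w) (_ AllPairs.∷ u) {suc i} {suc j} (s≤s a) (s≤s b) e = cong suc (cell-inj w u a b e)

  chain : ∀ {m x y} → row x ≡ 0 → suc (row y) ≡ m → Walk King T x y → Chain m T
  chain top bottom w₀ with simple w₀
  ... | w , u = record
    { end = size w ; at = cell w ; on = λ le → cells-P w (cell∈ w le) ; king = cell-king w ; distinct = cell-inj w u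
    ; first = trans (cong row (cell-start w)) top ; last = trans (cong (suc ∘ row) (cell-end w)) bottom }

-- α and γ are the elements of P next to j, and no element of P is at distance less than d from j.
record Gap (P : ℕ → Set) (i j k d : ℕ) : Set where
  field
    α γ     : ℕ
    i≤α     : i ≤ α
    γ≤k     : γ ≤ k
    pα      : P α
    pγ      : P γ
    α-far   : α + d ≤ j
    γ-far   : j + d ≤ γ
    between : ∀ t → α < t → t < γ → ¬ P t

gap : ∀ {P : ℕ → Set} → (∀ t → Dec (P t)) → ∀ {i j k d} → i < j → j < k → P i → P k → ¬ P j →
      (∀ t → t ≤ j → P t → t + d ≤ j) → (∀ t → j ≤ t → t ≤ k → P t → j + d ≤ t) → Gap P i j k d
gap {P} P? {i} {j} {k} i<j j<k pi pk ¬pj before after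
  with greatest P? j i i<j pi | least (λ t → P? (j + t)) (k ∸ j) (subst P (sym (m+[n∸m]≡n (<⇒≤ j<k))) pk)
... | α , i≤α , α<j , pα , max | e , e≤ , pe , min = record
  { α = α ; γ = j + e ; i≤α = i≤α ; γ≤k = j+e≤k ; pα = pα ; pγ = pe
  ; α-far = before α (<⇒≤ α<j) pα ; γ-far = after (j + e) (m≤m+n j e) j+e≤k pe ; between = mid }
  where
  j+e≤k : j + e ≤ k
  j+e≤k = ≤-trans (+-monoʳ-≤ j e≤) (≤-reflexive (m+[n∸m]≡n (<⇒≤ j<k)))
  mid : ∀ t → α < t → t < j + e → ¬ P t
  mid t α<t t< with <-cmp t j
  ... | tri< t<j _ _ = max t α<t t<j
  ... | tri≈ _ refl _ = ¬pj
  ... | tri> _ _ j<t = λ p → min (t ∸ j) (+-cancelˡ-< j _ _ (subst (_< j + e) (sym e′) t<)) (subst P (sym e′) p)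
    where
    e′ : j + (t ∸ j) ≡ t
    e′ = m+[n∸m]≡n (<⇒≤ j<t)

module Walking {m s : ℕ} (B : Board m s) (C : Chain m (Board.T B)) where
  open Pockets B public
  open Chain C public

  private
    near-row : ∀ d {i} → i + d ≤ end → row (at (i + d)) ≤ row (at i) + d × row (at i) ≤ row (at (i + d)) + d
    near-row zero {i} _ rewrite +-identityʳ i | +-identityʳ (row (at i)) = ≤-refl , ≤-refl
    near-row (suc d) {i} le with near-row d {suc i} (subst (_≤ end) (+-suc i d) le) | king {i} (≤-trans (m<m+n i (s≤s z≤n)) le)
    ... | a , b | (p , p′) , _ rewrite +-suc i d = lem (row (at i)) (row (at (suc i))) (row (at (suc (i + d)))) a b p p′
      where
      lem : ∀ x y z → z ≤ y + d → y ≤ z + d → x ≤ suc y → y ≤ suc x → z ≤ x + suc d × x ≤ z + suc d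
      lem x y z a b p p′ = (by λ neg → clash 0 (neg ⊕ p′ ⊕ a) (solve (x ∷ y ∷ z ∷ d ∷ []))) , (by λ neg → clash 0 (p ⊕ neg ⊕ b) (solve (x ∷ y ∷ z ∷ d ∷ [])))

    near-col : ∀ d {i} → i + d ≤ end → col (at (i + d)) ≤ col (at i) + d × col (at i) ≤ col (at (i + d)) + d
    near-col zero {i} _ rewrite +-identityʳ i | +-identityʳ (col (at i)) = ≤-refl , ≤-refl
    near-col (suc d) {i} le with near-col d {suc i} (subst (_≤ end) (+-suc i d) le) | king {i} (≤-trans (m<m+n i (s≤s z≤n)) le)
    ... | a , b | _ , (p , p′) rewrite +-suc i d = lem (col (at i)) (col (at (suc i))) (col (at (suc (i + d)))) a b p p′
      where
      lem : ∀ x y z → z ≤ y + d → y ≤ z + d → x ≤ suc y → y ≤ suc x → z ≤ x + suc d × x ≤ z + suc d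
      lem x y z a b p p′ = (by λ neg → clash 0 (neg ⊕ p′ ⊕ a) (solve (x ∷ y ∷ z ∷ d ∷ []))) , (by λ neg → clash 0 (p ⊕ neg ⊕ b) (solve (x ∷ y ∷ z ∷ d ∷ [])))

  col-near : ∀ {i j} → i ≤ j → j ≤ end → ∃ λ d → i + d ≡ j × col (at j) ≤ col (at i) + d × col (at i) ≤ col (at j) + d
  col-near {i} {j} i≤j j≤ with near-col (j ∸ i) {i}
  ... | f rewrite m+[n∸m]≡n i≤j = j ∸ i , m+[n∸m]≡n i≤j , f j≤

  ascend : ∀ d i r → i + d ≤ end → row (at i) ≤ r → r ≤ row (at (i + d)) → ∃ λ k → i ≤ k × k ≤ i + d × row (at k) ≡ r
  ascend zero i r le a b rewrite +-identityʳ i = i , ≤-refl , ≤-refl , ≤-antisym a b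
  ascend (suc d) i r le a b with row (at i) ≟ r
  ... | yes e = i , ≤-refl , m≤m+n i _ , e
  ... | no ¬e rewrite +-suc i d with ascend d (suc i) r le (≤-trans (proj₂ (proj₁ (king (≤-trans (s≤s (m≤m+n i d)) le)))) (≤∧≢⇒< a ¬e)) b
  ...   | k , lo , hi , e = k , <⇒≤ lo , hi , e

  descend : ∀ d i r → i + d ≤ end → r ≤ row (at i) → row (at (i + d)) ≤ r → ∃ λ k → i ≤ k × k ≤ i + d × row (at k) ≡ r
  descend zero i r le a b rewrite +-identityʳ i = i , ≤-refl , ≤-refl , ≤-antisym b a
  descend (suc d) i r le a b with r ≟ row (at i)
  ... | yes e = i , ≤-refl , m≤m+n i _ , sym e
  ... | no ¬e rewrite +-suc i d with descend d (suc i) r le (s≤s⁻¹ (≤-trans (≤∧≢⇒< a ¬e) (proj₁ (proj₁ (king (≤-trans (s≤s (m≤m+n i d)) le)))))) b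
  ...   | k , lo , hi , e = k , <⇒≤ lo , hi , e

  ascending : ∀ {i j} r → i ≤ j → j ≤ end → row (at i) ≤ r → r ≤ row (at j) → ∃ λ k → i ≤ k × k ≤ j × row (at k) ≡ r
  ascending {i} {j} r i≤j j≤ with ascend (j ∸ i) i r
  ... | f rewrite m+[n∸m]≡n i≤j = f j≤

  descending : ∀ {i j} r → i ≤ j → j ≤ end → r ≤ row (at i) → row (at j) ≤ r → ∃ λ k → i ≤ k × k ≤ j × row (at k) ≡ r
  descending {i} {j} r i≤j j≤ with descend (j ∸ i) i r
  ... | f rewrite m+[n∸m]≡n i≤j = f j≤

  row< : ∀ {i} → i ≤ end → row (at i) < m
  row< le = proj₁ (T-grid (on le))

  private
    visit : ∀ {r} → r < m → Σ[ i ∈ ℕ ] i ≤ end × row (at i) ≡ r × (∀ k → i < k → k ≤ end → r < row (at k))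
    visit {r} r<m with ascending r z≤n ≤-refl (subst (_≤ r) (sym first) z≤n) (s≤s⁻¹ (subst (r <_) (sym last) r<m))
    ... | k , _ , k≤ , e with greatest (λ i → row (at i) ≟ r) (suc end) k (s≤s k≤) e
    ...   | i , _ , i< , e′ , max = i , s≤s⁻¹ i< , e′ , later
      where
      later : ∀ k → i < k → k ≤ end → r < row (at k)
      later k i<k k≤ = ≰⇒> λ le → let j , lo , hi , e″ = ascending r k≤ ≤-refl le (s≤s⁻¹ (subst (r <_) (sym last) r<m))
                                  in max j (<-≤-trans i<k lo) (s≤s hi) e″

  -- The last visit of the chain to row r, and suc end if r is below the grid.
  τ : ℕ → ℕ
  τ r with r <? m
  ... | yes r<m = proj₁ (visit r<m)
  ... | no _ = suc end

  τ-visit : ∀ {r} → r < m → τ r ≤ end × row (at (τ r)) ≡ r × (∀ k → τ r < k → k ≤ end → r < row (at k))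
  τ-visit {r} r<m with r <? m
  ... | yes p = proj₂ (visit p)
  ... | no ¬p = ⊥-elim (¬p r<m)

  τ≤ : ∀ {r} → r < m → τ r ≤ end
  τ≤ = proj₁ ∘ τ-visit

  τ-row : ∀ {r} → r < m → row (at (τ r)) ≡ r
  τ-row = proj₁ ∘ proj₂ ∘ τ-visit

  after-τ : ∀ {r k} → r < m → τ r < k → k ≤ end → r < row (at k)
  after-τ r<m = proj₂ (proj₂ (τ-visit r<m)) _

  τ-last : τ m ≡ suc end
  τ-last with m <? m
  ... | yes p = ⊥-elim (<-irrefl refl p)
  ... | no _ = refl

  τ-mono : ∀ {r r′} → r < r′ → r′ ≤ m → τ r < τ r′
  τ-mono {r} {r′} lt le with m≤n⇒m<n∨m≡n le
  ... | inj₂ refl = subst (τ r <_) (sym τ-last) (s≤s (τ≤ lt))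
  ... | inj₁ r′<m = ≮⇒≥ λ { (s≤s h) → case (m≤n⇒m<n∨m≡n h) }
    where
    r<m = <-trans lt r′<m
    case : τ r′ < τ r ⊎ τ r′ ≡ τ r → ⊥
    case (inj₂ e) = <-irrefl (trans (sym (τ-row r<m)) (trans (cong (row ∘ at) (sym e)) (τ-row r′<m))) lt
    case (inj₁ lt′) = <-asym lt (subst (r′ <_) (τ-row r<m) (after-τ r′<m lt′ (τ≤ r<m)))

  τ-mono-≤ : ∀ {r r′} → r ≤ r′ → r′ ≤ m → τ r ≤ τ r′
  τ-mono-≤ a b with m≤n⇒m<n∨m≡n a
  ... | inj₁ lt = <⇒≤ (τ-mono lt b)
  ... | inj₂ refl = ≤-refl

  Visited : Cell → Set
  Visited x = T x × x ≡ at (τ (row x))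

  -- Last visits to different rows are different cells, which provides one cell of `T` for each row.
  visits : ∀ {P : Cell → Set} a n → a + n ≤ m → (∀ r → a ≤ r → r < a + n → P (at (τ r))) →
           Pack n (λ x → (Visited x × P x) × (a ≤ row x × row x < a + n))
  visits {P} a n le f = packRows a n λ r lo hi → let r<m = <-≤-trans hi le; e = at-τ r<m in
    col (at (τ r)) , (subst T (sym e) (on (τ≤ r<m)) , e) , subst P (sym e) (f r lo hi)
    where
    at-τ : ∀ {r} → r < m → (r , col (at (τ r))) ≡ at (τ r)
    at-τ {r} r<m = cong (_, col (at (τ r))) (sym (τ-row r<m))

  avoiding : ∀ p q → (∀ i → i ≤ end → ¬ Square s p q (at i)) → Pack m (Outside p q)
  avoiding p q f = packWeaken (λ ((v , ¬sq) , _) → proj₁ v , ¬sq)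
    (visits {λ x → ¬ Square s p q x} 0 m ≤-refl λ r _ r<m → f (τ r) (τ≤ r<m))

  Low High : ℕ → Set
  Low i = col (at i) < s
  High i = q ≤ col (at i)

  high? : ∀ i → Dec (High i)
  high? i = q ≤? col (at i)

  low? : ∀ i → Dec (Low i)
  low? i = col (at i) <? s

  low-high : ∀ {i} → Low i → High i → ⊥
  low-high a b = <⇒≱ (<-≤-trans a s≤q) b

  -- The number of steps which the chain needs between the first s and the last s columns
  d : ℕ
  d = suc (q ∸ s)

  private
    d-eq : q ∸ s + s ≡ q
    d-eq = m∸n+n≡m s≤q

    -- Here s < 2 m / 5 enters: d = m - 2 s + 1, and 2 d = 2 m - 4 s + 2 exceeds s.
    crossing-long : s < d + d
    crossing-long = lem m s q (q ∸ s) q+s d-eq small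
      where
      lem : ∀ m s q e → q + s ≡ m → e + s ≡ q → suc (5 * s) ≤ 2 * m → s < suc e + suc e
      lem m s q e h h′ h″ = by λ neg → clash 2 (2 ⊛ ≤-reflexive (sym h′) ⊕ 2 ⊛ ≤-reflexive (sym h) ⊕ h″ ⊕ neg) (solve (m ∷ s ∷ q ∷ e ∷ []))

    far-lem : ∀ q e x y k → e + s ≡ q → y < s → q ≤ x → x ≤ y + k → suc e ≤ k
    far-lem q e x y k h a b c = by λ neg → clash 0 (c ⊕ b ⊕ ≤-reflexive h ⊕ a ⊕ neg) (solve (s ∷ q ∷ e ∷ x ∷ y ∷ k ∷ []))

  far₁ : ∀ {i j} → i ≤ j → j ≤ end → High i → Low j → i + d ≤ j
  far₁ {i} {j} i≤j j≤ h l with col-near i≤j j≤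
  ... | k , refl , _ , near = +-monoʳ-≤ i (far-lem q (q ∸ s) _ _ k d-eq l h near)

  far₂ : ∀ {i j} → i ≤ j → j ≤ end → Low i → High j → i + d ≤ j
  far₂ {i} {j} i≤j j≤ l h with col-near i≤j j≤
  ... | k , refl , near , _ = +-monoʳ-≤ i (far-lem q (q ∸ s) _ _ k d-eq l h near)

  gap-long : ∀ {P i j k} (g : Gap P i j k d) → Gap.α g + s < Gap.γ g
  gap-long {j = j} g = lem (Gap.α g) (Gap.γ g) j d crossing-long (Gap.α-far g) (Gap.γ-far g)
    where
    lem : ∀ a c j d → s < d + d → a + d ≤ j → j + d ≤ c → a + s < c
    lem a c j d h h′ h″ = by λ neg → clash 0 (h′ ⊕ h ⊕ neg ⊕ h″) (solve (s ∷ a ∷ c ∷ j ∷ d ∷ []))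

  highGap : ∀ {i j k} → i < j → j < k → k ≤ end → High i → Low j → High k → Gap High i j k d
  highGap i<j j<k k≤ hi lj hk = gap high? i<j j<k hi hk (low-high lj)
    (λ t t≤j h → far₁ t≤j (<⇒≤ (<-≤-trans j<k k≤)) h lj) (λ t j≤t t≤k h → far₂ j≤t (≤-trans t≤k k≤) lj h)

  lowGap : ∀ {i j k} → i < j → j < k → k ≤ end → Low i → High j → Low k → Gap Low i j k d
  lowGap i<j j<k k≤ li hj lk = gap low? i<j j<k li lk (λ l → low-high l hj)
    (λ t t≤j l → far₂ t≤j (<⇒≤ (<-≤-trans j<k k≤)) l hj) (λ t j≤t t≤k l → far₁ j≤t (≤-trans t≤k k≤) hj l)

  Between : ℕ → ℕ → Cell → Set
  Between α γ x = ∃ λ t → x ≡ at t × α < t × t < γ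

  interval : ∀ {α γ} → γ ≤ suc end → α + s < γ → Pack s (λ x → T x × Between α γ x)
  interval {α} {γ} γ≤ lt = packIndex (suc α) s (λ t _ _ → at t)
    (λ t _ hi t′ _ hi′ → distinct (≤end hi) (≤end hi′)) (λ t lo hi → on (≤end hi) , t , refl , lo , <-≤-trans hi lt)
    where
    ≤end : ∀ {t} → t < suc α + s → t ≤ end
    ≤end hi = s≤s⁻¹ (≤-trans hi (≤-trans lt γ≤))

  -- If the chain leaves the last s columns between two visits for so long that it reaches the first s
  -- columns, then the square spanned by the last s columns and the rows which are
  -- visited for the last time in between misses at least m cells of the chain.
  private
    module Window {α γ a a′ : ℕ} (γ≤end : γ ≤ end) (wide : α + s < γ)
      (between : ∀ t → α < t → t < γ → ¬ High t) (a′≤m : a′ ≤ m)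
      (α<τ : ∀ {r} → a ≤ r → r < m → α < τ r) (τ<γ : ∀ {r} → r < a′ → τ r < γ)
      (in-interval : ∀ {r} → r < m → α < τ r → τ r < γ → a ≤ r × r < a′) where

      -- The rows of the square have their last visits in the gap, away from the last s columns.
      -- Hence all m last visits are outside of the square.
      long : ∀ p → a ≤ p → p + s ≤ a′ → Pack m (Outside p q)
      long p a≤p p≤ = packWeaken (λ ((v , ¬sq) , _) → proj₁ v , ¬sq) (visits {λ x → ¬ Square s p q x} 0 m ≤-refl out)
        where
        out : ∀ r → 0 ≤ r → r < m → ¬ Square s p q (at (τ r))
        out r _ r<m ((lo , hi) , (h , _)) rewrite τ-row r<m =
          between (τ r) (α<τ (≤-trans a≤p lo) r<m) (τ<γ (<-≤-trans hi p≤)) h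

      Rest : ℕ → Cell → Set
      Rest p x = row x < p ⊎ p + s ≤ row x

      rest : ∀ p → p + s ≤ m → Pack (p + (m ∸ (p + s))) (λ x → Visited x × Rest p x)
      rest p p≤ = packWeaken (λ { (inj₁ ((v , _) , _ , lt)) → v , inj₁ lt ; (inj₂ ((v , _) , le , _)) → v , inj₂ le })
        (packUnion (visits {λ _ → ⊤} 0 p (≤-trans (m≤m+n p s) p≤) (λ _ _ _ → tt))
          (visits {λ _ → ⊤} (p + s) (m ∸ (p + s)) (≤-reflexive (m+[n∸m]≡n p≤)) (λ _ _ _ → tt))
          (λ (_ , _ , lt) (_ , le , _) → <⇒≱ lt (≤-trans (m≤m+n p s) le)))

      -- The last visits to the m - s other rows are supplemented by s cells of the gap, which avoid
      -- the last s columns. The two kinds differ, since a last visit within the gap belongs to a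
      -- row from a to a′, hence of the square.
      short : ∀ p → p ≤ a → a′ ≤ p + s → p + s ≤ m → Pack m (Outside p q)
      short p p≤a a′≤ p≤ = packTake (≤-reflexive (sum (m ∸ (p + s)) (m∸n+n≡m p≤)))
        (packWeaken ok (packUnion (rest p p≤) (interval (m≤n⇒m≤1+n γ≤end) wide) λ {x} ((t , e) , away) (_ , u , e′ , lo , hi) →
          apart {x} away lo hi (distinct (τ≤ (proj₁ (T-grid t))) (<⇒≤ (<-≤-trans hi γ≤end)) (trans (sym e) e′)) (proj₁ (T-grid t))))
        where
        sum : ∀ e → e + (p + s) ≡ m → m ≡ p + e + s
        sum e h = ≤-antisym (by λ neg → clash 0 (≤-reflexive (sym h) ⊕ neg) (solve (p ∷ s ∷ m ∷ e ∷ []))) (by λ neg → clash 0 (≤-reflexive h ⊕ neg) (solve (p ∷ s ∷ m ∷ e ∷ [])))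
        apart : ∀ {x u} → Rest p x → α < u → u < γ → τ (row x) ≡ u → row x < m → ⊥
        apart away lo hi refl r<m with in-interval r<m lo hi | away
        ... | lo′ , _ | inj₁ lt = <⇒≱ lt (≤-trans p≤a lo′)
        ... | _ , hi′ | inj₂ le = <⇒≱ hi′ (≤-trans a′≤ le)
        ok : ∀ {x} → (Visited x × Rest p x) ⊎ (T x × Between α γ x) → Outside p q x
        ok (inj₁ ((t , _) , inj₁ lt)) = t , λ ((lo , _) , _) → <⇒≱ lt lo
        ok (inj₁ ((t , _) , inj₂ le)) = t , λ ((_ , hi) , _) → <⇒≱ hi le
        ok (inj₂ (t , u , refl , lo , hi)) = t , λ (_ , (h , _)) → between u lo hi h

      Goal : ℕ → Set → Set
      Goal r J = Σ[ p ∈ ℕ ] p + s ≤ m × Pack m (Outside p q) × (J → p ≤ r × r < p + s)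

      choose : ∀ {r J} → r < m → (J → a ≤ r × r < a′) → Dec (a + s ≤ a′) → Goal r J
      choose {r} r<m r-in (yes le) with (r ⊔ a) + s ≤? a′
      -- Under `J` the maximum is r itself; otherwise it keeps the square within the rows from a to
      -- a′.
      ... | yes le′ = r ⊔ a , ≤-trans le′ a′≤m , long (r ⊔ a) (m≤n⊔m r a) le′ , λ e →
              let x = m≥n⇒m⊔n≡m (proj₁ (r-in e)) in ≤-reflexive x , ≤-<-trans (≤-reflexive (sym x)) (m<m+n _ s>0)
      ... | no ¬le′ = a′ ∸ s , ≤-trans (≤-reflexive e₀) a′≤m , long (a′ ∸ s) (m+n≤o⇒m≤o∸n a le) (≤-reflexive e₀) , λ e →
              m≤n+o⇒m∸n≤o a′ s (≤-trans (<⇒≤ (≰⇒> ¬le′)) (≤-reflexive (trans (cong (_+ s) (m≥n⇒m⊔n≡m (proj₁ (r-in e)))) (+-comm r s)))) ,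
              <-≤-trans (proj₂ (r-in e)) (≤-reflexive (sym e₀))
        where
        e₀ : a′ ∸ s + s ≡ a′
        e₀ = m∸n+n≡m (≤-trans (m≤n+m s a) le)
      choose {r} r<m r-in (no ¬le) with a + s ≤? m
      ... | yes le′ = a , le′ , short a ≤-refl (<⇒≤ (≰⇒> ¬le)) le′ , λ e → proj₁ (r-in e) , <-trans (proj₂ (r-in e)) (≰⇒> ¬le)
      ... | no ¬le′ = q , ≤-reflexive q+s , short q q≤a (≤-trans a′≤m (≤-reflexive (sym q+s))) (≤-reflexive q+s) , λ e →
              ≤-trans q≤a (proj₁ (r-in e)) , <-≤-trans r<m (≤-reflexive (sym q+s))
        where
        q≤a : q ≤ a
        q≤a = +-cancelʳ-≤ s q a (≤-trans (≤-reflexive q+s) (<⇒≤ (≰⇒> ¬le′)))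

  -- If j is the last visit to row r, the square is placed so as to contain this row: in `BothTop`
  -- its eater has to contain a piece of row r.
  window : ∀ {i j k} → i < j → j < k → k ≤ end → High i → Low j → High k → ∀ r → r < m →
           Σ[ p ∈ ℕ ] p + s ≤ m × Pack m (Outside p q) × (j ≡ τ r → p ≤ r × r < p + s)
  window {i} {j} {k} i<j j<k k≤ hi lj hk r r<m with highGap i<j j<k k≤ hi lj hk
  -- The rows r with a ≤ r < a′ are those with last visit in the gap. `τ m` is `suc end`, so that
  -- both searches succeed.
  ... | g with least (λ r → Gap.α g <? τ r) m (subst (Gap.α g <_) (sym τ-last) (s≤s α≤end))
             | least (λ r → Gap.γ g ≤? τ r) m (subst (Gap.γ g ≤_) (sym τ-last) (m≤n⇒m≤1+n γ≤end))
    where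
    γ≤end : Gap.γ g ≤ end
    γ≤end = ≤-trans (Gap.γ≤k g) k≤
    α≤end : Gap.α g ≤ end
    α≤end = ≤-trans (m≤m+n _ d) (≤-trans (Gap.α-far g) (≤-trans (m≤m+n _ d) (≤-trans (Gap.γ-far g) γ≤end)))
  ...   | a , a≤m , α<τa , mina | a′ , a′≤m , γ≤τa′ , mina′ =
    Window.choose {α} {γ} {a} {a′} (≤-trans γ≤k k≤) (gap-long g) between a′≤m
      (λ a≤r r<m → <-≤-trans α<τa (τ-mono-≤ a≤r (<⇒≤ r<m))) (λ r<a′ → ≰⇒> (mina′ _ r<a′)) in-interval r<m
      (λ e → in-interval r<m (subst (α <_) e (<-≤-trans (m<m+n α (s≤s z≤n)) α-far)) (subst (_< γ) e (<-≤-trans (m<m+n j (s≤s z≤n)) γ-far)))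
      (a + s ≤? a′)
    where
    open Gap g
    in-interval : ∀ {r} → r < m → α < τ r → τ r < γ → a ≤ r × r < a′
    in-interval {r} r<m lo hi = ≮⇒≥ (λ lt → mina r lt lo) , ≰⇒> (λ le → <⇒≱ hi (≤-trans γ≤τa′ (τ-mono-≤ le (<⇒≤ r<m))))

-- A chain with fewer than m cells of the board outside of each side square

Across : ∀ {m s} → Board m s → Set
Across {m} B = Σ[ x ∈ Cell ] Σ[ y ∈ Cell ] row x ≡ 0 × suc (row y) ≡ m × Walk King (Board.T B) x y

module _ {m s : ℕ} (B : Board m s) where
  open Board B

  acrossFlipped : Across B → Across (flipped B)
  acrossFlipped (x , y , t , b , w) = to σ x , to σ y , t , b ,
    mapWalk (to σ) (λ p → pull-to σ {T} (T-grid p) p) (λ p q → onKing σ (T-grid p) (T-grid q)) w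
    where σ = flip↔ m

  acrossUpside : Across B → Across (upside B)
  acrossUpside (x , y , t , b , w) = turn y , turn x
    , trans (cong (mirror m) (suc-injective (trans b (sym m≡)))) (mirror-invol 0<m)
    , trans (cong (suc ∘ mirror m) t) m≡
    , reverse (λ {x} {y} → king-sym {x} {y}) (mapWalk turn (λ p → let a , b = T-grid p in upside-in B {T} a b p) turn-king w)
    where
    0<m : 0 < m
    0<m = ≤-<-trans z≤n (proj₁ (T-grid (start∈ w)))
    m≡ : suc (mirror m 0) ≡ m
    m≡ = trans (sym (+-comm (mirror m 0) 1)) (mirror-+ 0<m)
    turn : Cell → Cell
    turn (r , c) = mirror m r , c
    turn-king : ∀ {x y} → T x → T y → King x y → King (turn x) (turn y)
    turn-king p q (v , h) = swap (onKing (flip↔ m) (swap (T-grid p)) (swap (T-grid q)) (h , v))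

chainFlipped : ∀ {m s} (B : Board m s) → Chain m (Board.T B) → Chain m (Board.T (flipped B))
chainFlipped {m} B C = record
  { end = end ; at = to σ ∘ at ; on = λ le → pull-to σ {T} (T-grid (on le)) (on le)
  ; king = λ lt → onKing σ (T-grid (on (<⇒≤ lt))) (T-grid (on lt)) (king lt)
  ; distinct = λ a b → distinct a b ∘ to-inj σ (T-grid (on a)) (T-grid (on b)) ; first = first ; last = last }
  where
  open Board B
  open Chain C
  σ = flip↔ m

mirror-low : ∀ {m q s c} → q + s ≡ m → c < m → q ≤ c → mirror m c < s
mirror-low {m} {q} {s} {c} e c<m h = lem (mirror m c) (mirror-+ c<m)
  where
  lem : ∀ d → d + suc c ≡ m → d < s
  lem d e′ = by λ neg → clash 0 (neg ⊕ ≤-reflexive (sym e) ⊕ ≤-reflexive e′ ⊕ h) (solve (m ∷ q ∷ s ∷ c ∷ d ∷ []))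

mirror-high : ∀ {m q s c} → q + s ≡ m → c < m → c < s → q ≤ mirror m c
mirror-high {m} {q} {s} {c} e c<m h = lem (mirror m c) (mirror-+ c<m)
  where
  lem : ∀ d → d + suc c ≡ m → q ≤ d
  lem d e′ = by λ neg → clash 0 (≤-reflexive (sym e′) ⊕ ≤-reflexive e ⊕ neg ⊕ h) (solve (m ∷ q ∷ s ∷ c ∷ d ∷ []))

-- By window, the chain changes between the first s and the last s columns at most once. If it changes
-- from the left to the right, then the north-east or the south-west square misses m cells of it.

module _ {m s : ℕ} where

  private
    module Half (B : Board m s) (C : Chain m (Board.T B))
      (noL : ∀ p → p + s ≤ m → ¬ Pack m (Board.Outside B p 0))
      (noR : ∀ p → p + s ≤ m → ¬ Pack m (Board.Outside B p (m ∸ s))) where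
      open Walking B C

      highLowHigh : ∀ {i j k} → i < j → j < k → k ≤ end → High i → Low j → High k → ⊥
      highLowHigh i<j j<k k≤ hi lj hk = let p , p≤ , pk , _ = window i<j j<k k≤ hi lj hk 0 0<m in noR p p≤ pk

      -- Let a be the first row with last visit after α. If s ≤ a, the first s rows have their last
      -- visits before β, where no cell is high, and the north-east square is missed. Otherwise the
      -- last s rows have them after α, where no cell is low, and the south-west square is missed.
      transition : ∀ {α β} → α < β → α ≤ end → (∀ t → α < t → t ≤ end → ¬ Low t) → (∀ t → t < β → ¬ High t) → ⊥
      transition {α} {β} α<β α≤ noLow noHigh with least (λ r → α <? τ r) m (subst (α <_) (sym τ-last) (s≤s α≤))
      ... | a , a≤m , α<τa , min with s ≤? a
      ...   | yes s≤a = noR 0 s≤m (packWeaken (λ ((v , ¬sq) , _) → proj₁ v , ¬sq) (visits {λ x → ¬ Square s 0 q x} 0 m ≤-refl out))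
        where
        out : ∀ r → 0 ≤ r → r < m → ¬ Square s 0 q (at (τ r))
        out r _ r<m ((_ , lt) , (h , _)) rewrite τ-row r<m = noHigh (τ r) (≤-<-trans (≮⇒≥ (min r (<-≤-trans lt s≤a))) α<β) h
      ...   | no s≰a = noL q (≤-reflexive q+s) (packWeaken (λ ((v , ¬sq) , _) → proj₁ v , ¬sq) (visits {λ x → ¬ Square s q 0 x} 0 m ≤-refl out))
        where
        out : ∀ r → 0 ≤ r → r < m → ¬ Square s q 0 (at (τ r))
        out r _ r<m ((le , _) , (_ , l)) rewrite τ-row r<m =
          noLow (τ r) (<-≤-trans α<τa (τ-mono-≤ (≤-trans (<⇒≤ (≰⇒> s≰a)) (≤-trans s≤q le)) (<⇒≤ r<m))) (τ≤ r<m) l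

  noSide : (B : Board m s) → Across B → (∀ p → p + s ≤ m → ¬ Pack m (Board.Outside B p 0)) →
           (∀ p → p + s ≤ m → ¬ Pack m (Board.Outside B p (m ∸ s))) → ⊥
  noSide B (_ , _ , t , b , w) noL noR = start (anyUpTo? high? (suc end)) (anyUpTo? low? (suc end))
    where
    C = chain t b w
    open Walking B C
    B′ = flipped B
    C′ = chainFlipped B C
    noL′ : ∀ p → p + s ≤ m → ¬ Pack m (Board.Outside B′ p 0)
    noL′ p p≤ = noR p p≤ ∘ packFlipped (trans (cong (_+ s) (+-identityʳ q)) q+s)
    noR′ : ∀ p → p + s ≤ m → ¬ Pack m (Board.Outside B′ p q)
    noR′ p p≤ = noL p p≤ ∘ packFlipped q+s
    module H = Half B C noL noR
    module H′ = Half B′ C′ noL′ noR′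
    module W′ = Walking B′ C′
    low′ : ∀ {i} → i ≤ end → High i → W′.Low i
    low′ le = mirror-low q+s (proj₂ (T-grid (on le)))
    high′ : ∀ {i} → i ≤ end → Low i → W′.High i
    high′ le = mirror-high q+s (proj₂ (T-grid (on le)))
    low⁻ : ∀ {i} → i ≤ end → W′.Low i → High i
    low⁻ le l = subst (q ≤_) (mirror-invol (proj₂ (T-grid (on le)))) (mirror-high q+s (mirror-< (proj₂ (T-grid (on le)))) l)
    high⁻ : ∀ {i} → i ≤ end → W′.High i → Low i
    high⁻ le h = subst (_< s) (mirror-invol (proj₂ (T-grid (on le)))) (mirror-low q+s (mirror-< (proj₂ (T-grid (on le)))) h)
    lowHighLow : ∀ {i j k} → i < j → j < k → k ≤ end → Low i → High j → Low k → ⊥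
    lowHighLow i<j j<k k≤ li hj lk = H′.highLowHigh i<j j<k k≤
      (high′ (<⇒≤ (<-trans i<j (<-≤-trans j<k k≤))) li) (low′ (<⇒≤ (<-≤-trans j<k k≤)) hj) (high′ k≤ lk)
    start : Dec (∃ λ i → i < suc end × High i) → Dec (∃ λ i → i < suc end × Low i) → ⊥
    start (no ¬h) _ = noR 0 s≤m (avoiding 0 q λ i i≤ (_ , (h , _)) → ¬h (i , s≤s i≤ , h))
    start _ (no ¬l) = noL 0 s≤m (avoiding 0 0 λ i i≤ (_ , (_ , l)) → ¬l (i , s≤s i≤ , l))
    start (yes (i , i< , hi)) (yes (j , j< , lj))
      with greatest low? (suc end) j j< lj | least high? i hi | greatest high? (suc end) i i< hi | least low? j lj
    ... | α , j≤α , α< , lα , maxα | β , β≤i , hβ , minβ | β′ , i≤β′ , β′< , hβ′ , maxβ′ | α′ , α′≤j , lα′ , minα′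
      with <-cmp α β
    ...   | tri≈ _ refl _ = low-high lα hβ
    ...   | tri< α<β _ _ = H.transition α<β (s≤s⁻¹ α<) (λ t lt le → maxα t lt (s≤s le)) minβ
    ...   | tri> _ _ β<α with <-cmp α′ β
    ...     | tri< α′<β _ _ = lowHighLow α′<β β<α (s≤s⁻¹ α<) lα′ hβ lα
    ...     | tri≈ _ refl _ = low-high lα′ hβ
    ...     | tri> _ _ β<α′ with <-cmp α′ β′
    ...       | tri< α′<β′ _ _ = H.highLowHigh β<α′ α′<β′ (s≤s⁻¹ β′<) hβ lα′ hβ′
    ...       | tri≈ _ refl _ = low-high lα′ hβ′
    ...       | tri> _ _ β′<α′ = H′.transition β′<α′ (s≤s⁻¹ β′<) (λ t lt le l → maxβ′ t lt (s≤s le) (low⁻ le l))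
                (λ t lt h → minα′ t lt (high⁻ (<⇒≤ (<-≤-trans lt (≤-trans α′≤j (s≤s⁻¹ j<)))) h))

-- A chain and a pocket on one side

module Fringe {T : Cell → Set} (T? : ∀ x → Dec (T x)) (m lo w : ℕ) (β : ℕ → ℕ)
              (T-grid : ∀ {x} → T x → Grid m x) (β-T : ∀ c → lo ≤ c → c < lo + w → T (β c , c)) where

  F : Cell → Set
  F x = (lo ≤ col x × col x < lo + w) × row x ≡ β (col x)

  F? : ∀ x → Dec (F x)
  F? x = ((lo ≤? col x) ×-dec (col x <? lo + w)) ×-dec (row x ≟ β (col x))

  More : ℕ → Set
  More r = ∃ λ c → c < m × T (r , c) × ¬ F (r , c)

  more? : ∀ r → Dec (More r)
  more? r = anyUpTo? (λ c → T? (r , c) ×-dec ¬? (F? (r , c))) m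

  only : ∀ {r} → ¬ More r → ∀ {c} → T (r , c) → F (r , c)
  only {r} ¬more {c} t = decidable-stable (F? (r , c)) λ ¬f → ¬more (c , proj₂ (T-grid t) , t , ¬f)

  Wide : ℕ → ℕ → Cell → Set
  Wide a n x = T x × (F x ⊎ (a ≤ row x × row x < a + n))

  -- If each of the n rows had a cell of `T` off the fringe, these cells and the w fringe cells
  -- would form the excluded pack.
  search : ∀ a n → ¬ Pack (w + n) (Wide a n) → ∃ λ r → a ≤ r × r < a + n × ¬ More r
  search a n ¬pk with anyUpTo? (λ i → ¬? (more? (a + i))) n
  ... | yes (i , i<n , ¬more) = a + i , m≤m+n a i , +-monoʳ-< a i<n , ¬more
  ... | no ¬only = ⊥-elim (¬pk (packWeaken [ (λ (f , _) → sound f) , (λ ((t , _) , le , lt) → t , inj₂ (le , lt)) ]′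
      (packUnion fringe (packRows {P = λ x → T x × ¬ F x} a n rows) λ (f , _) ((_ , ¬f) , _) → ¬f f)))
    where
    fringe : Pack w (λ x → F x × (lo ≤ col x × col x < lo + w))
    fringe = packCols lo w λ c lo′ hi → β c , (lo′ , hi) , refl
    sound : ∀ {x} → F x → Wide a n x
    sound {r , c} f@((lo′ , hi) , refl) = β-T c lo′ hi , inj₁ f
    rows : ∀ r → a ≤ r → r < a + n → Σ[ c ∈ ℕ ] T (r , c) × ¬ F (r , c)
    rows r le lt with decidable-stable (more? (a + (r ∸ a))) (λ ¬more → ¬only (r ∸ a , +-cancelˡ-< a _ _ (subst (_< a + n) (sym (m+[n∸m]≡n le)) lt) , ¬more))
    ... | c , _ , t , ¬f rewrite m+[n∸m]≡n le = c , t , ¬f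

module LeftFringe {m s : ℕ} (B : Board m s) {P} (L : Pockets.LeftEater B P)
                  (avoidS : ∀ {x} → P x → suc (row x) < m) where
  open Pockets B
  open LeftEater L hiding (avoidS)

  private
    ends : ∀ {c} → c < s → Σ[ k ∈ ℕ ] line < k × South R k c
    ends c<s = south-end R avoidS (full _ c<s)

  bottom : ℕ → ℕ
  bottom c with c <? s
  ... | yes c<s = proj₁ (ends c<s)
  ... | no _ = 0

  bottom-south : ∀ {c} → c < s → South R (bottom c) c
  bottom-south {c} c<s with c <? s
  ... | yes c<s = proj₂ (proj₂ (ends c<s))
  ... | no ¬lt = ⊥-elim (¬lt c<s)

  bottom-T : ∀ c → 0 ≤ c → c < 0 + s → T (bottom c , c)
  bottom-T c _ c<s = let _ , _ , _ , t , _ = bottom-south c<s in S⊆T t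

  open Fringe T? m 0 s bottom T-grid bottom-T public

  fringe-low : ∀ {x} → F x → col x < s
  fringe-low ((_ , lt) , _) = lt

  fringe-south : ∀ {r c} → F (r , c) → South R r c
  fringe-south ((_ , c<s) , refl) = bottom-south c<s

  outside-north : Pack (s + q) (Wide s q) → Pack m (Outside 0 q)
  outside-north p = packTake (≤-reflexive (trans (sym q+s) (+-comm q s)))
    (packWeaken (λ { (t , inj₁ f) → t , (λ (_ , (h , _)) → <⇒≱ (<-≤-trans (fringe-low f) s≤q) h)
                   ; (t , inj₂ (le , _)) → t , (λ ((_ , lt) , _) → <⇒≱ lt le) }) p)

  outside-south : Pack (s + q) (Wide 0 q) → Pack m (Outside q q)
  outside-south p = packTake (≤-reflexive (trans (sym q+s) (+-comm q s)))
    (packWeaken (λ { (t , inj₁ f) → t , (λ (_ , (h , _)) → <⇒≱ (<-≤-trans (fringe-low f) s≤q) h)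
                   ; (t , inj₂ (_ , lt)) → t , (λ ((le , _) , _) → <⇒≱ lt le) }) p)

-- Counting against the square in the north-east and in the south-east yields rows r₂ ≥ s and r₁ < q
-- all of whose cells in T are southern ends of columns of P. The chain visits the last s columns between
-- these rows, and this detour makes it too long.

module OneSide {m s : ℕ} (B : Board m s) (C : Chain m (Board.T B)) {P} (L : Pockets.LeftEater B P)
  (avoidS : ∀ {x} → P x → suc (row x) < m) (noR : ∀ p → p + s ≤ m → ¬ Pack m (Board.Outside B p (m ∸ s))) where

  private
    open Walking B C
    open LeftEater L hiding (avoidS)
    open LeftFringe B L avoidS

    Only : ℕ → Set
    Only r = ¬ More r

    only-low : ∀ {r i} → Only r → i ≤ end → row (at i) ≡ r → Low i
    only-low o i≤ refl = fringe-low (only o (on i≤))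

    -- Between its two visits to the last s columns the chain passes row r at a low cell, so that
    -- `window` finds a square at the right side.
    sandwich : ∀ {r i j} → Only r → i ≤ end → j ≤ end → High i → High j → row (at i) < r → r < row (at j) → ⊥
    sandwich {r} {i} {j} o i≤ j≤ hi hj lo hi′ = cases (<-cmp i j)
      where
      hlh : ∀ {i j k} → i < k → k < j → j ≤ end → High i → High j → row (at k) ≡ r → ⊥
      hlh i<k k<j j≤ hi hj e = let p , p≤ , pk , _ = window i<k k<j j≤ hi (only-low o (<⇒≤ (<-≤-trans k<j j≤)) e) hj 0 0<m
                               in noR p p≤ pk
      ≢i : ∀ {k} → row (at k) ≡ r → i ≢ k
      ≢i e refl = <-irrefl e lo
      ≢j : ∀ {k} → row (at k) ≡ r → j ≢ k
      ≢j e refl = <-irrefl (sym e) hi′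
      cases : _ → ⊥
      cases (tri≈ _ refl _) = <-asym lo hi′
      cases (tri< i<j _ _) = let k , i≤k , k≤j , e = ascending r (<⇒≤ i<j) j≤ (<⇒≤ lo) (<⇒≤ hi′)
                             in hlh (≤∧≢⇒< i≤k (≢i e)) (≤∧≢⇒< k≤j (≢j e ∘ sym)) j≤ hi hj e
      cases (tri> _ _ j<i) = let k , j≤k , k≤i , e = descending r (<⇒≤ j<i) i≤ (<⇒≤ hi′) (<⇒≤ lo)
                             in hlh (≤∧≢⇒< j≤k (≢j e)) (≤∧≢⇒< k≤i (≢i e ∘ sym)) i≤ hj hi e

    high-below : ∀ {r} → r < q → ∃ λ i → i < suc end × High i × r < row (at i)
    high-below {r} r<q with anyUpTo? (λ i → high? i ×-dec (r <? row (at i))) (suc end)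
    ... | yes h = h
    ... | no ¬h = ⊥-elim (noR q (≤-reflexive q+s) (avoiding q q λ i i≤ ((le , _) , (h , _)) → ¬h (i , s≤s i≤ , h , <-≤-trans r<q le)))

    high-above : ∀ {r} → s ≤ r → ∃ λ i → i < suc end × High i × row (at i) < r
    high-above {r} s≤r with anyUpTo? (λ i → high? i ×-dec (row (at i) <? r)) (suc end)
    ... | yes h = h
    ... | no ¬h = ⊥-elim (noR 0 s≤m (avoiding 0 q λ i i≤ ((_ , lt) , (h , _)) → ¬h (i , s≤s i≤ , h , <-≤-trans lt s≤r)))

    -- Three disjoint sets: the last visits to the rows not strictly between r₁ and r₂, one low cell
    -- for each row strictly between them, and s cells of the detour in these rows which are not
    -- low. Together they are m + s cells of `T`.
    module Detour {r₁ r₂ i h k : ℕ} (o₁ : Only r₁) (o₂ : Only r₂) (i<h : i < h) (h<k : h < k) (k≤ : k ≤ end) (hh : High h)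
      (row-i : row (at i) ≡ r₁) (row-k : row (at k) ≡ r₂) (above : ∀ t → i < t → t ≤ h → r₁ < row (at t))
      (below : ∀ t → h ≤ t → t < k → row (at t) < r₂) where

      r₁<r₂ : r₁ < r₂
      r₁<r₂ = <-trans (above h i<h ≤-refl) (below h ≤-refl h<k)

      r₂<m : r₂ < m
      r₂<m = subst (_< m) row-k (row< k≤)

      i≤ : i ≤ end
      i≤ = <⇒≤ (<-≤-trans (<-trans i<h h<k) k≤)

      g : Gap Low i h k d
      g = lowGap i<h h<k k≤ (only-low o₁ i≤ row-i) hh (only-low o₂ k≤ row-k)
      open Gap g

      Inside Middle Away : Cell → Set
      Inside x = T x × col x < s × (r₁ < row x × row x < r₂)
      Away x = T x × ¬ (r₁ < row x × row x < r₂)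
      Middle x = T x × ¬ col x < s × (r₁ < row x × row x < r₂)

      -- Otherwise the chain would pass row r₁ between h and γ, where it has no low cell, whereas
      -- all its cells in that row are low.
      below′ : ∀ {u} → h ≤ u → u < γ → r₁ < row (at u)
      below′ {u} h≤u u<γ = ≰⇒> λ le → bad (descending r₁ h≤u u≤ (<⇒≤ (above h i<h ≤-refl)) le)
        where
        u≤ = <⇒≤ (<-≤-trans u<γ (≤-trans γ≤k k≤))
        bad : (∃ λ v → h ≤ v × v ≤ u × row (at v) ≡ r₁) → ⊥
        bad (v , h≤v , v≤u , e) = between v (<-≤-trans (<-≤-trans (m<m+n α (s≤s z≤n)) α-far) h≤v) (≤-<-trans v≤u u<γ)
                                          (only-low o₁ (≤-trans v≤u u≤) e)

      above′ : ∀ {u} → α < u → u ≤ h → row (at u) < r₂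
      above′ {u} α<u u≤h = ≰⇒> λ le → bad (descending r₂ u≤h h≤ le (<⇒≤ (below h ≤-refl h<k)))
        where
        h≤ = <⇒≤ (<-≤-trans h<k k≤)
        bad : (∃ λ v → u ≤ v × v ≤ h × row (at v) ≡ r₂) → ⊥
        bad (v , u≤v , v≤h , e) = between v (<-≤-trans α<u u≤v) (≤-<-trans v≤h (<-≤-trans (m<m+n h (s≤s z≤n)) γ-far))
                                          (only-low o₂ (≤-trans v≤h h≤) e)

      middle : Pack s Middle
      middle = packWeaken ok (interval (m≤n⇒m≤1+n (≤-trans γ≤k k≤)) (gap-long g))
        where
        ok : ∀ {x} → T x × Between α γ x → Middle x
        ok (t , u , refl , lo , hi) with ≤-total u h
        ... | inj₁ u≤h = t , between u lo hi , above u (≤-<-trans i≤α lo) u≤h , above′ lo u≤h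
        ... | inj₂ h≤u = t , between u lo hi , below′ h≤u hi , below u h≤u (<-≤-trans hi γ≤k)

      south-i : South R r₁ (col (at i))
      south-i = subst (λ r → South R r (col (at i))) row-i (fringe-south (only (subst Only (sym row-i) o₁) (on i≤)))

      south-k : South R r₂ (col (at k))
      south-k = subst (λ r → South R r (col (at k))) row-k (fringe-south (only (subst Only (sym row-k) o₂) (on k≤)))

      inP : ∀ r → r₁ ≤ r → r < r₂ → Σ[ c ∈ ℕ ] P (r , c)
      inP r le lt with south-i | south-k
      ... | _ , refl , x , _ | _ , refl , y , _ = meetsRow R x y r (≤-trans (n≤1+n _) le) (s≤s⁻¹ lt)

      inside : Pack (r₂ ∸ suc r₁) Inside
      inside = packWeaken (λ ((t , l) , lo , hi) → t , l , lo , <-≤-trans hi (≤-reflexive (m+[n∸m]≡n r₁<r₂)))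
                 (packRows {P = λ x → T x × col x < s} (suc r₁) (r₂ ∸ suc r₁) low-end)
        where
        -- The eastern end of `P` in row r₁ is also a southern end, so that `P` has no cell to the
        -- south-east of it. Eastern ends in the rows below are therefore no further east, and they
        -- are low.
        low-end : ∀ r → suc r₁ ≤ r → r < suc r₁ + (r₂ ∸ suc r₁) → Σ[ c ∈ ℕ ] T (r , c) × c < s
        low-end r r₁<r r< with inP r₁ ≤-refl r₁<r₂ | inP r (<⇒≤ r₁<r) (<-≤-trans r< (≤-reflexive (m+[n∸m]≡n r₁<r₂)))
        ... | _ , x | _ , y with east-end R avoidE x | east-end R avoidE y
        ...   | κ , _ , E | κ′ , _ , (c′ , refl , z , t , _) with only o₁ (S⊆T (proj₁ (proj₂ (proj₂ (proj₂ E)))))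
        ...     | f = suc c′ , S⊆T t , ≤-<-trans (≰⇒> λ le → east-south R E (fringe-south f) z (<⇒≤ r₁<r) le) (fringe-low f)

      away : Pack (suc r₁ + (m ∸ r₂)) Away
      away = packWeaken
        (λ { (inj₁ (((t , _) , _) , _ , lt)) → t , (λ (lo , _) → <⇒≱ lo (s≤s⁻¹ lt))
           ; (inj₂ (((t , _) , _) , le , _)) → t , (λ (_ , hi) → <⇒≱ hi le) })
        (packUnion (visits {λ _ → ⊤} 0 (suc r₁) (<-trans r₁<r₂ r₂<m) (λ _ _ _ → tt))
                   (visits {λ _ → ⊤} r₂ (m ∸ r₂) (≤-reflexive (m+[n∸m]≡n (<⇒≤ r₂<m))) (λ _ _ _ → tt))
                   (λ (_ , _ , lt) (_ , le , _) → <⇒≱ (<-≤-trans lt r₁<r₂) le))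

      impossible : ⊥
      impossible = tooMany (λ { (inj₁ (inj₁ (t , _))) → t ; (inj₁ (inj₂ (t , _))) → t ; (inj₂ (t , _)) → t })
        (packUnion (packUnion away inside λ (_ , ¬in) (_ , _ , in′) → ¬in in′) middle
          λ { (inj₁ (_ , ¬in)) (_ , _ , in′) → ¬in in′ ; (inj₂ (_ , l , _)) (_ , ¬l , _) → ¬l l })
        (≤-reflexive (sum (m ∸ r₂) (r₂ ∸ suc r₁) (m∸n+n≡m (<⇒≤ r₂<m)) (m∸n+n≡m r₁<r₂)))
        where
        sum : ∀ a b → a + r₂ ≡ m → b + suc r₁ ≡ r₂ → m + s ≡ suc r₁ + a + b + s
        sum a b e e′ = ≤-antisym (by λ neg → clash 0 (≤-reflexive (sym e′) ⊕ ≤-reflexive (sym e) ⊕ neg) (solve (m ∷ s ∷ r₁ ∷ r₂ ∷ a ∷ b ∷ []))) (by λ neg → clash 0 (≤-reflexive e ⊕ ≤-reflexive e′ ⊕ neg) (solve (m ∷ s ∷ r₁ ∷ r₂ ∷ a ∷ b ∷ [])))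

    -- i is the last time before h at or above row r₁, and k the first time after h at or below row
    -- r₂. King moves do not skip rows, so that the chain is exactly on these rows at i and k.
    detour : ∀ {r₁ r₂ h} → Only r₁ → Only r₂ → h ≤ end → High h → r₁ < row (at h) → row (at h) < r₂ → r₂ < m → ⊥
    detour {r₁} {r₂} {h} o₁ o₂ h≤ hh r₁< <r₂ r₂<m
      with greatest (λ t → row (at t) ≤? r₁) h 0 (n≢0⇒n>0 λ { refl → n≮0 (subst (r₁ <_) first r₁<) }) (subst (_≤ r₁) (sym first) z≤n)
         | least (λ t → r₂ ≤? row (at (h + t))) (end ∸ h) (subst (λ k → r₂ ≤ row (at k)) (sym (m+[n∸m]≡n h≤)) (s≤s⁻¹ (subst (r₂ <_) (sym last) r₂<m)))
    ... | i , _ , i<h , row-i , max | zero , _ , row-e , _ = <⇒≱ <r₂ (subst (λ u → r₂ ≤ row (at u)) (+-identityʳ h) row-e)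
    ... | i , _ , i<h , row-i , max | suc e , e≤ , row-e , min = Detour.impossible o₁ o₂ i<h h<k k≤ hh
        (≤-antisym row-i (s≤s⁻¹ (≤-trans (above (suc i) ≤-refl i<h) (proj₂ (proj₁ (king (<-≤-trans i<h h≤)))))))
        (≤-antisym row-k≤ row-e) above below
      where
      k≤ : h + suc e ≤ end
      k≤ = ≤-trans (+-monoʳ-≤ h e≤) (≤-reflexive (m+[n∸m]≡n h≤))
      h<k : h < h + suc e
      h<k = m<m+n h (s≤s z≤n)
      above : ∀ t → i < t → t ≤ h → r₁ < row (at t)
      above t i<t t≤h with m≤n⇒m<n∨m≡n t≤h
      ... | inj₁ t<h = ≰⇒> (max t i<t t<h)
      ... | inj₂ refl = r₁<
      below : ∀ t → h ≤ t → t < h + suc e → row (at t) < r₂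
      below t h≤t t<k = ≰⇒> λ le → min (t ∸ h) (+-cancelˡ-< h _ _ (subst (_< h + suc e) (sym e′) t<k)) (subst (λ u → r₂ ≤ row (at u)) (sym e′) le)
        where
        e′ : h + (t ∸ h) ≡ t
        e′ = m+[n∸m]≡n h≤t
      row-k≤ : row (at (h + suc e)) ≤ r₂
      row-k≤ = subst (λ u → row (at u) ≤ r₂) (sym (+-suc h e))
        (≤-trans (proj₂ (proj₁ (king (subst (_≤ end) (+-suc h e) k≤)))) (below (h + e) (m≤m+n h e) (≤-reflexive (sym (+-suc h e)))))

  oneSide : ⊥
  oneSide with search 0 q (noR q (≤-reflexive q+s) ∘ outside-south) | search s q (noR 0 s≤m ∘ outside-north)
  ... | r₁ , _ , r₁<q , o₁ | r₂ , s≤r₂ , r₂< , o₂ with high-below r₁<q | high-above s≤r₂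
  ...   | h , h< , hh , r₁<h | h′ , h′< , hh′ , h′<r₂ = detour o₁ o₂ (s≤s⁻¹ h<) hh r₁<h
            (≰⇒> λ le → beyond (m≤n⇒m<n∨m≡n le)) (<-≤-trans r₂< (≤-reflexive (trans (+-comm s q) q+s)))
    where
    beyond : r₂ < row (at h) ⊎ r₂ ≡ row (at h) → ⊥
    beyond (inj₁ lt) = sandwich o₂ (s≤s⁻¹ h′<) (s≤s⁻¹ h<) hh′ hh h′<r₂ lt
    beyond (inj₂ e) = low-high (only-low o₂ (s≤s⁻¹ h<) (sym e)) hh

-- A chain and pockets on both sides

-- P touches the top, and every pocket on the right lies below the rows all of whose cells in T are
-- southern ends of columns of P. The window around such a row is eaten by a pocket
-- which contains this row, a contradiction.

module BothTop {m s : ℕ} (B : Board m s) (C : Chain m (Board.T B)) {P} (L : Pockets.LeftEater B P) {c₀} (top : P (0 , c₀)) where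

  private
    open Walking B C
    open LeftEater L hiding (avoidS)
    avoidS : ∀ {x} → P x → suc (row x) < m
    avoidS = LeftEater.avoidS L top
    open LeftFringe B L avoidS

    Only : ℕ → Set
    Only r = ¬ More r

    some : ∃ λ r → r < m × Only r
    some = let r , _ , lt , o = search 0 m (λ p → tooMany proj₁ p (≤-reflexive (+-comm m s))) in r , lt , o

    visited : ∀ {r} → r < m → T (r , col (at (τ r)))
    visited {r} r<m = subst T (cong (_, col (at (τ r))) (τ-row r<m)) (on (τ≤ r<m))

    only-south : ∀ {r} → r < m → Only r → Low (τ r) × South R r (col (at (τ r)))
    only-south r<m o = let f = only o (visited r<m) in fringe-low f , fringe-south f

    Lies-below : (Cell → Set) → Set
    Lies-below P′ = Σ[ h ∈ ℕ ] h < m × High (τ h) × (∀ {r} → r < m → Only r → r < h × (∀ {x} → P′ x → r < row x))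

    module Other {P′} (E : RightEater P′) where
      open RightEater E renaming (pocket to pocket′; R to R′; line to line′; full to full′)

      corner-col : suc (m ∸ 1) ≡ m
      corner-col = m+[n∸m]≡n 0<m

      corner : P′ (line′ , m ∸ 1)
      corner = full′ _ (∸-monoʳ-≤ m s>0) (≤-reflexive corner-col)

      noTouch : ∀ {x y z} → P x → Adj x y → S y → Grid m y → Adj y z → P′ z → ⊥
      noTouch x a sy g a′ z = separated pocket pocket′ touch refl x a sy g a′ z corner corner-col

      avoidW′ : ∀ {x} → P′ x → 0 < col x
      avoidW′ {_ , zero} x = ⊥-elim (notLR pocket′ x corner refl corner-col)
      avoidW′ {_ , suc _} _ = s≤s z≤n

      Edge : ℕ → ℕ → Set
      Edge b c = S (b , c) × Σ[ r ∈ ℕ ] P′ (r , c) × Adj (b , c) (r , c)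

      Rim : (ℕ → ℕ) → Set
      Rim β = ∀ c → q ≤ c → c < m → Edge (β c) c

      total : (∀ c → q ≤ c → c < m → ∃ λ b → Edge b c) → Σ[ β ∈ (ℕ → ℕ) ] Rim β
      total f = β , ok
        where
        β : ℕ → ℕ
        β c with q ≤? c | c <? m
        ... | yes lo | yes hi = proj₁ (f c lo hi)
        ... | _ | _ = 0
        ok : Rim β
        ok c lo hi with q ≤? c | c <? m
        ... | yes lo | yes hi = proj₂ (f c lo hi)
        ... | no ¬lo | _ = ⊥-elim (¬lo lo)
        ... | yes _ | no ¬hi = ⊥-elim (¬hi hi)

      upper : (∀ {x} → P′ x → 0 < row x) → ∀ c → q ≤ c → c < m → ∃ λ b → Edge b c
      upper avoid c lo hi = let k , _ , y , sy , _ = north-end R′ avoid (full′ c lo hi) in k , sy , suc k , y , south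

      lower : (∀ {x} → P′ x → suc (row x) < m) → ∀ c → q ≤ c → c < m → ∃ λ b → Edge b c
      lower avoid c lo hi with south-end R′ avoid (full′ c lo hi)
      ... | _ , _ , k , refl , y , sy , _ = suc k , sy , k , y , north

      -- `P′` cannot touch both the top and the bottom. Towards a side which it does not touch, each
      -- of the last s columns ends in a cell of `S`.
      rim : NN (Σ[ β ∈ (ℕ → ℕ) ] Rim β)
      rim K = do
        no ¬bottom ← em (Σ[ x ∈ Cell ] P′ x × suc (row x) ≡ m)
          where yes (x , px , e) → K (total (upper λ y → n≢0⇒n>0 λ e′ → notTB pocket′ y px e′ e))
        K (total (lower λ y → ≤∧≢⇒< (proj₁ (inGrid R′ y)) λ e → ¬bottom (_ , y , e)))

      module Rimmed (β : ℕ → ℕ) (ok : Rim β) where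

        edge : ∀ {c} → q ≤ c → c < q + s → Edge (β c) c
        edge lo hi = ok _ lo (<-≤-trans hi (≤-reflexive q+s))

        module F′ = Fringe T? m q s β T-grid (λ c lo hi → S⊆T (proj₁ (edge lo hi)))

        some′ : ∃ λ r → r < m × ¬ F′.More r
        some′ = let r , _ , lt , o = F′.search 0 m (λ p → tooMany proj₁ p (≤-reflexive (+-comm m s))) in r , lt , o

        module At {h} (h<m : h < m) (o′ : ¬ F′.More h) where

          f′ : F′.F (h , col (at (τ h)))
          f′ = F′.only o′ (visited h<m)

          high : High (τ h)
          high = proj₁ (proj₁ f′)

          -- The eastern end of `P` in row h would be on the rim of `P′`, a common boundary cell of
          -- the two pockets.
          P-misses : ∀ {c} → ¬ P (h , c)
          P-misses x with east-end R avoidE x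
          ... | _ , _ , k , refl , y , sy , g , _ with F′.only o′ (S⊆T sy)
          ...   | (lo , hi) , refl with edge lo hi
          ...     | _ , _ , z , a = noTouch y east sy (proj₁ (inGrid R y) , g) a z

          near : Σ[ z ∈ Cell ] P′ z × h ≤ suc (row z)
          near = beside f′
            where
            beside : ∀ {r c} → F′.F (r , c) → Σ[ z ∈ Cell ] P′ z × r ≤ suc (row z)
            beside ((lo , hi) , refl) = let _ , _ , z , a = edge lo hi in _ , z , adj-row (adj-sym a)

          P′-misses : ∀ {r c} → Only r → ¬ P′ (r , c)
          P′-misses o x with west-end R′ avoidW′ x
          ... | k , _ , y , sy , _ with fringe-south (only o (S⊆T sy))
          ...   | _ , refl , z , _ , g , _ = noTouch z south sy (g , proj₂ (T-grid (S⊆T sy))) east y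

          -- `P` reaches from the top to the row above r without meeting row h. The rows differ
          -- because the last visit is low in r and high in h.
          r<h : ∀ {r} → r < m → Only r → r < h
          r<h {r} r<m o with only-south r<m o
          ... | low , k , refl , x , _ = ≤∧≢⇒< (≰⇒> λ le → P-misses (proj₂ (meetsRow R top x h z≤n le))) λ { refl → low-high low high }

          all : ∀ {r} → r < m → Only r → ∀ {x} → P′ x → r < row x
          all {r} r<m o px = ≰⇒> λ le → let z , pz , lo = near in
            P′-misses o (proj₂ (meetsRow R′ px pz r le (s≤s⁻¹ (≤-trans (r<h r<m o) lo))))

      below : NN (Lies-below P′)
      below K = do
        β , ok ← rim
        let h , h<m , o′ = Rimmed.some′ β ok
        K (h , h<m , Rimmed.At.high β ok h<m o′ , λ r<m o → Rimmed.At.r<h β ok h<m o′ r<m o , Rimmed.At.all β ok h<m o′ r<m o)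

    before : ∀ {r i} → r < m → i ≤ end → row (at i) < r → i < τ r
    before {r} {i} r<m i≤ lt = ≰⇒> λ le → cases (m≤n⇒m<n∨m≡n le)
      where
      cases : τ r < i ⊎ τ r ≡ i → ⊥
      cases (inj₁ τ<i) = <-asym lt (after-τ r<m τ<i i≤)
      cases (inj₂ refl) = <-irrefl (τ-row r<m) lt

    -- An eater of the north-east square has a cell in row 0, yet it would lie below another row.
    northUneaten : ¬ Pack m (Outside 0 q)
    northUneaten pk = do
      P₃ , pocket₃ , E₃ ← eaten 0 q s≤m (≤-reflexive q+s) pk
      _ , _ , _ , below₃ ← Other.below (rightEater pocket₃ E₃)
      let r , r<m , o = some
          _ , _ , _ , f = someCol E₃
      n≮0 (proj₂ (below₃ r<m o) (f 0 z≤n s>0))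

    conclude : ∀ {r h} → s ≤ r → r < m → Only r → h < m → High (τ h) → r < h →
               Dec (∃ λ i → i < suc end × High i × row (at i) < r) → ⊥
    conclude s≤r r<m o h<m hh r<h (no ¬i) =
      northUneaten (avoiding 0 q λ i i≤ ((_ , lt) , (h , _)) → ¬i (i , s≤s i≤ , h , <-≤-trans lt s≤r))
    conclude {r} s≤r r<m o h<m hh r<h (yes (i , i< , hi , i<r)) =
      finish (window (before r<m (s≤s⁻¹ i<) i<r) (τ-mono r<h (<⇒≤ h<m)) (τ≤ h<m) hi (proj₁ (only-south r<m o)) hh r r<m)
      where
      finish : (Σ[ p ∈ ℕ ] p + s ≤ m × Pack m (Outside p q) × (τ r ≡ τ r → p ≤ r × r < p + s)) → ⊥
      finish (p , p≤ , pk , inside) = do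
        P₃ , pocket₃ , E₃ ← eaten p q p≤ (≤-reflexive q+s) pk
        _ , _ , _ , below₃ ← Other.below (rightEater pocket₃ E₃)
        let lo , hi′ = inside refl
        <-irrefl refl (proj₂ (below₃ r<m o) (eatsRow E₃ lo hi′
          (λ c q≤c _ t → <⇒≱ (<-≤-trans (fringe-low (only o t)) s≤q) q≤c) q ≤-refl (m<m+n q s>0)))

  bothTop : ∀ {P′} → RightEater P′ → ⊥
  bothTop E = do
    h , h<m , hh , lies ← Other.below E
    let r , s≤r , r< , o = search s q (northUneaten ∘ outside-north)
        r<m = <-≤-trans r< (≤-reflexive (trans (+-comm s q) q+s))
    conclude s≤r r<m o h<m hh (proj₁ (lies r<m o)) (anyUpTo? (λ i → high? i ×-dec (row (at i) <? r)) (suc end))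

across : ∀ {m s} (B : Board m s) → Across B → Chain m (Board.T B)
across B (_ , _ , top , bottom , w) = chain top bottom w

module _ {m s : ℕ} where

  Rim : (B : Board m s) → (Cell → Set) → Cell → Set
  Rim B P x = Board.S B x × Grid m x × Σ[ y ∈ Cell ] P y × Adj y x

  -- The first s columns have southern and northern ends; the eastern end of the full row lies
  -- beyond these columns and adds one more.
  sideRim : (B : Board m s) → ∀ {P} → Pockets.LeftEater B P → (∀ {x} → P x → suc (row x) < m) → (∀ {x} → P x → 0 < row x) →
            Pack (s + s + 1) (Rim B P)
  sideRim B {P} L avoidS avoidN = packWeaken ok (packUnion (packUnion
      (packCols {P = λ (r , c) → South R r c} 0 s λ c _ c<s → let k , _ , e = south-end R avoidS (full c c<s) in k , e)
      (packCols {P = λ (r , c) → North R r c} 0 s λ c _ c<s → let k , _ , e = north-end R avoidN (full c c<s) in k , e)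
      (λ { ((_ , refl , x , _) , _) ((_ , _ , ¬x) , _) → ¬x _ (n≤1+n _) x }))
      (packOne {λ (r , c) → s ≤ c × East R r c} (line , proj₁ end) (proj₁ (proj₂ end) , proj₂ (proj₂ end)))
      λ { (inj₁ (_ , _ , lt)) (le , _) → <⇒≱ lt le ; (inj₂ (_ , _ , lt)) (le , _) → <⇒≱ lt le })
    where
    open Pockets B
    open LeftEater L hiding (avoidS; avoidN)
    end : Σ[ k ∈ ℕ ] s ≤ k × East R line k
    end = let k , lt , e = east-end R avoidE (full (s ∸ 1) (≤-reflexive (m+[n∸m]≡n s>0)))
          in k , ≤-trans (≤-reflexive (sym (m+[n∸m]≡n s>0))) lt , e
    ok : ∀ {x} → ((South R (row x) (col x) × _) ⊎ (North R (row x) (col x) × _)) ⊎ (s ≤ col x × East R (row x) (col x)) → Rim B P x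
    ok (inj₁ (inj₁ ((_ , refl , x , t , _) , _))) = t , T-grid (S⊆T t) , _ , x , south
    ok (inj₁ (inj₂ ((x , t , _) , _))) = t , T-grid (S⊆T t) , _ , x , north
    ok (inj₂ (_ , _ , refl , x , t , _)) = t , T-grid (S⊆T t) , _ , x , east

  -- Each pocket has 2 s + 1 boundary cells, and m + s ≤ 4 s + 2.
  sidePockets : (B : Board m s) → ∀ {P P′} → (L : Pockets.LeftEater B P) → (E : Pockets.RightEater B P′) →
                (∀ {x} → P x → suc (row x) < m) → (∀ {x} → P x → 0 < row x) →
                (∀ {x} → P′ x → suc (row x) < m) → (∀ {x} → P′ x → 0 < row x) → 5 ≤ m → ⊥
  sidePockets B {P} {P′} L E avoidS avoidN avoidS′ avoidN′ 5≤m = tooMany (λ { (inj₁ (t , _)) → S⊆T t ; (inj₂ (t , _)) → S⊆T t })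
    (packUnion (sideRim B L avoidS avoidN)
      (pullPack σ {Rim (flipped B) (pull σ P′)} {Rim B P′} (λ (_ , g , _) → g)
        (λ ((g , t) , _ , y , (gy , py) , a) → t , onGrid σ g , to σ y , py , onAdj σ gy g a)
        (sideRim (flipped B) (rightFlipped B E) (avoidS′ ∘ proj₂) (avoidN′ ∘ proj₂)))
      λ (t , g , _ , y , a) (_ , _ , _ , y′ , a′) →
        separated (LeftEater.pocket L) (RightEater.pocket E) (LeftEater.touch L) refl y a t g (adj-sym a′) y′ corner corner-col)
    (lem m s large 5≤m)
    where
    open Pockets B
    σ = flip↔ m
    corner-col : suc (m ∸ 1) ≡ m
    corner-col = m+[n∸m]≡n 0<m
    corner : P′ (RightEater.line E , m ∸ 1)
    corner = RightEater.full E _ (∸-monoʳ-≤ m s>0) (≤-reflexive corner-col)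
    lem : ∀ m s → 2 * m ≤ 5 * s + 5 → 5 ≤ m → m + s ≤ s + s + 1 + (s + s + 1)
    lem m s h h′ = by λ neg → clash 4 (5 ⊛ neg ⊕ 3 ⊛ h ⊕ h′) (solve (m ∷ s ∷ []))

  module _ (5≤m : 5 ≤ m) where

    bothSides : (B : Board m s) → Across B → ∀ {P P′} → Pockets.LeftEater B P → Pockets.RightEater B P′ → ⊥
    bothSides B A {P} {P′} L E = do
      no ¬top ← em (Σ[ c ∈ ℕ ] P (0 , c))
        where yes (_ , x) → BothTop.bothTop B (across B A) L x E
      no ¬bottom ← em (Σ[ x ∈ Cell ] P x × suc (row x) ≡ m)
        where yes (x , px , e) → BothTop.bothTop (upside B) (across (upside B) (acrossUpside B A)) (leftUpside B L) (turn {P} (inGrid R px) px e) (rightUpside B E)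
      no ¬top′ ← em (Σ[ c ∈ ℕ ] P′ (0 , c))
        where yes (_ , x) → BothTop.bothTop B′ (across B′ A′) E′ (onGrid σ (inGrid R′ x) , subst P′ (sym (invol σ (inGrid R′ x))) x) L′
      no ¬bottom′ ← em (Σ[ x ∈ Cell ] P′ x × suc (row x) ≡ m)
        where yes (x , px , e) → BothTop.bothTop (upside B′) (across (upside B′) (acrossUpside B′ A′)) (leftUpside B′ E′)
                (turn {pull σ P′} (onGrid σ (inGrid R′ px)) (onGrid σ (inGrid R′ px) , subst P′ (sym (invol σ (inGrid R′ px))) px) e) (rightUpside B′ L′)
      sidePockets B L E (λ x → ≤∧≢⇒< (proj₁ (inGrid R x)) λ e → ¬bottom (_ , x , e)) (λ { {zero , _} x → ⊥-elim (¬top (_ , x)) ; {suc _ , _} _ → s≤s z≤n })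
        (λ x → ≤∧≢⇒< (proj₁ (inGrid R′ x)) λ e → ¬bottom′ (_ , x , e)) (λ { {zero , _} x → ⊥-elim (¬top′ (_ , x)) ; {suc _ , _} _ → s≤s z≤n }) 5≤m
      where
      open Pockets B
      open LeftEater L using (R)
      open RightEater E using () renaming (R to R′)
      σ = flip↔ m
      B′ = flipped B
      A′ = acrossFlipped B A
      L′ = leftFlipped B L
      E′ = rightFlipped B E
      turn : ∀ {P : Cell → Set} {x} → Grid m x → P x → suc (row x) ≡ m → Upside B P (0 , col x)
      turn {P} {r , c} (r<m , c<m) x e = subst (λ i → Upside B P (i , c)) eq (upside-in B {P} r<m c<m x)
        where
        eq : mirror m r ≡ 0
        eq = trans (cong (mirror m) (sym (suc-injective (trans (trans (sym (+-comm (mirror m 0) 1)) (mirror-+ 0<m)) (sym e))))) (mirror-invol 0<m)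

    leftOnly : (B : Board m s) → Across B → ∀ {P} → Pockets.LeftEater B P → (∀ p → p + s ≤ m → ¬ Pack m (Board.Outside B p (m ∸ s))) → ⊥
    leftOnly B A {P} L noR = do
      no ¬bottom ← em (Σ[ x ∈ Cell ] P x × suc (row x) ≡ m)
        where
        yes (x , px , e) → OneSide.oneSide (upside B) (across (upside B) (acrossUpside B A)) (leftUpside B L)
          (λ { {r , c} ((r<m , _) , (_ , _) , _ , y) → lem (mirror m r) (mirror-+ r<m) (n≢0⇒n>0 λ e′ → notTB pocket y px e′ e) })
          (λ p p≤ → noR (m ∸ (p + s)) (m∸[p+s]+s≤m p p≤) ∘ packUpside B (sum (m ∸ (p + s)) p (m∸n+n≡m p≤)))
      OneSide.oneSide B (across B A) L (λ x → ≤∧≢⇒< (proj₁ (inGrid R x)) λ e → ¬bottom (_ , x , e)) noR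
      where
      open Pockets B
      open LeftEater L
      lem : ∀ {r} d → d + suc r ≡ m → 0 < d → suc r < m
      lem {r} d e h = by λ neg → clash 0 (≤-reflexive e ⊕ neg ⊕ h) (solve (r ∷ d ∷ m ∷ []))
      sum : ∀ a p → a + (p + s) ≡ m → a + p + s ≡ m
      sum a p e = trans (+-assoc a p s) e
      m∸[p+s]+s≤m : ∀ p → p + s ≤ m → m ∸ (p + s) + s ≤ m
      m∸[p+s]+s≤m p p≤ = ≤-trans (+-monoʳ-≤ (m ∸ (p + s)) (m≤n+m s p)) (≤-reflexive (m∸n+n≡m p≤))

    noAcross : (B : Board m s) → ¬ Across B
    noAcross B A = do
      no ¬l ← em (Σ[ p ∈ ℕ ] p + s ≤ m × Pack m (Outside p 0))
        where
        yes (p , p≤ , pk) → do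
          P , pocket , E ← eaten p 0 p≤ s≤m pk
          no ¬r ← em (Σ[ p ∈ ℕ ] p + s ≤ m × Pack m (Outside p q))
            where
            yes (p′ , p′≤ , pk′) → do
              P′ , pocket′ , E′ ← eaten p′ q p′≤ (≤-reflexive q+s) pk′
              bothSides B A (leftEater pocket E) (rightEater pocket′ E′)
          leftOnly B A (leftEater pocket E) λ p p≤ pk → ¬r (p , p≤ , pk)
      no ¬r ← em (Σ[ p ∈ ℕ ] p + s ≤ m × Pack m (Outside p q))
        where
        yes (p , p≤ , pk) → do
          P , pocket , E ← eaten p q p≤ (≤-reflexive q+s) pk
          leftOnly (flipped B) (acrossFlipped B A) (rightFlipped B (rightEater pocket E))
            λ p p≤ pk → ¬l (p , p≤ , packFlipped q+s pk)
      noSide B A (λ p p≤ pk → ¬l (p , p≤ , pk)) (λ p p≤ pk → ¬r (p , p≤ , pk))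
      where open Pockets B

-- The final set of m + s - 1 deleted cells

In : ℕ → (Cell → Set) → ℕ → ℕ → Cell → Set
In s T p q x = T x × Square s p q x

-- By |T| = m + s - 1, every square of side s contains s cells of T or misses m of them.
Crowded : ∀ {m s} → Board m s → Set
Crowded {m} {s} B = ∀ p q → p + s ≤ m → q + s ≤ m → Pack s (In s T p q) ⊎ Pack m (Out s T p q)
  where open Board B

module _ {m s : ℕ} {T : Cell → Set} (T-grid : ∀ {x} → T x → Grid m x) where

  private
    σ = flip↔ m

    window-iff : ∀ {p q q′} → q + q′ + s ≡ m → ∀ {x} → T x → Square s p q′ (to σ x) → Square s p q x
    window-iff {p} {q} {q′} e {r , c} t (a , (lo , hi)) = a ,
      (let c<m = proj₂ (T-grid t); u , v = mirror-window {m} {s} e′ (mirror-< c<m) lo hi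
       in subst (λ k → q ≤ k × k < q + s) (mirror-invol c<m) (u , v))
      where
      e′ : q′ + q + s ≡ m
      e′ = trans (cong (_+ s) (+-comm q′ q)) e

    window-iff′ : ∀ {p q q′} → q + q′ + s ≡ m → ∀ {x} → T x → Square s p q x → Square s p q′ (to σ x)
    window-iff′ e t (a , (lo , hi)) = a , mirror-window {m} {s} e (proj₂ (T-grid t)) lo hi

  outFlipped : ∀ {k p q q′} → q + q′ + s ≡ m → Pack k (Out s T p q) → Pack k (Out s (pull σ T) p q′)
  outFlipped e = pullPack σ (T-grid ∘ proj₁) λ (t , ¬sq) → pull-to σ {T} (T-grid t) t , ¬sq ∘ window-iff e t

  inFlipped : ∀ {k p q q′} → q + q′ + s ≡ m → Pack k (In s T p q) → Pack k (In s (pull σ T) p q′)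
  inFlipped e = pullPack σ (T-grid ∘ proj₁) λ (t , sq) → pull-to σ {T} (T-grid t) t , window-iff′ e t sq

  outTransposed : ∀ {k p q} → Pack k (Out s T p q) → Pack k (Out s (pull (transpose m) T) q p)
  outTransposed = pullPack (transpose m) (T-grid ∘ proj₁) λ (t , ¬sq) → (swap (T-grid t) , t) , ¬sq ∘ swap

  inTransposed : ∀ {k p q} → Pack k (In s T p q) → Pack k (In s (pull (transpose m) T) q p)
  inTransposed = pullPack (transpose m) (T-grid ∘ proj₁) λ (t , sq) → (swap (T-grid t) , t) , swap sq

module _ {m s : ℕ} (B : Board m s) where
  open Board B

  crowdedTransposed : Crowded B → Crowded (transposed B)
  crowdedTransposed f p q p≤ q≤ with f q p q≤ p≤
  ... | inj₁ h = inj₁ (inTransposed T-grid h)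
  ... | inj₂ h = inj₂ (outTransposed T-grid h)

  crowdedFlipped : Crowded B → Crowded (flipped B)
  crowdedFlipped f p q p≤ q≤ with f p (m ∸ (q + s)) p≤ (≤-trans (+-monoʳ-≤ (m ∸ (q + s)) (m≤n+m s q)) (≤-reflexive (m∸n+n≡m q≤)))
  ... | inj₁ h = inj₁ (inFlipped T-grid (trans (+-assoc (m ∸ (q + s)) q s) (m∸n+n≡m q≤)) h)
  ... | inj₂ h = inj₂ (outFlipped T-grid (trans (+-assoc (m ∸ (q + s)) q s) (m∸n+n≡m q≤)) h)

module Top {m s : ℕ} (B : Board m s) (crowded : Crowded B) where
  open Pockets B

  Strip : Cell → Set
  Strip x = T x × row x < s

  module _ {P} (R : Region m S P) where

    R-edge : ∀ {r c} → East R r c → S (r , c) × Σ[ y ∈ Cell ] P y × Adj y (r , c)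
    R-edge (_ , refl , x , t , _) = t , _ , x , east

    W-edge : ∀ {r c} → West R r c → S (r , c) × Σ[ y ∈ Cell ] P y × Adj (r , c) y
    W-edge (x , t , _) = t , _ , x , east

    S-edge : ∀ {r c} → South R r c → S (r , c) × Σ[ y ∈ Cell ] P y × Adj y (r , c)
    S-edge (_ , refl , x , t , _) = t , _ , x , south

  module RightPocket {P} (E : RightEater P) where
    open RightEater E public

    corner-col : suc (m ∸ 1) ≡ m
    corner-col = m+[n∸m]≡n 0<m

    corner : P (line , m ∸ 1)
    corner = full _ (∸-monoʳ-≤ m s>0) (≤-reflexive corner-col)

    avoidW : ∀ {x} → P x → 0 < col x
    avoidW {_ , zero} x = ⊥-elim (notLR pocket x corner refl corner-col)
    avoidW {_ , suc _} _ = s≤s z≤n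

    apart : ∀ {P₁} (L : LeftEater P₁) {z} → S z × Σ[ y ∈ Cell ] P₁ y × Adj y z → S z × Σ[ y ∈ Cell ] P y × Adj z y → ⊥
    apart L (t , _ , x , a) (_ , _ , y , a′) = separated (LeftEater.pocket L) pocket (LeftEater.touch L) refl x a t (T-grid (S⊆T t)) a′ y corner corner-col

  -- If `P` ends before column q in each of the first s rows, these ends and the s cells of the
  -- north-east square are the 2 s cells. Otherwise `P` stretches over q columns, and `Wide` finds
  -- too many cells.
  module EatenHeavy {P} (pocket : Pocket P) (E : Eats s T P 0 0) (heavy : Pack s (In s T 0 q)) where
    L : LeftEater P
    L = leftEater pocket E
    open LeftEater L hiding (pocket; avoidS; avoidN)

    column : Σ[ c ∈ ℕ ] (∀ r → r < s → P (r , c))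
    column = let c , _ , _ , f = someCol E in c , λ r → f r z≤n

    avoidS : ∀ {x} → P x → suc (row x) < m
    avoidS = LeftEater.avoidS L (proj₂ column 0 s>0)

    wide? : Dec (∃ λ r → r < s × ∃ λ c → c < m × P (r , c) × q ≤ suc c)
    wide? = anyUpTo? (λ r → anyUpTo? (λ c → dec R (r , c) ×-dec (q ≤? suc c)) m) s

    narrow : ¬ (∃ λ r → r < s × ∃ λ c → c < m × P (r , c) × q ≤ suc c) → Pack (s + s) Strip
    narrow ¬wide = packWeaken (λ { (inj₁ ((t , _) , _ , lt)) → t , lt ; (inj₂ (t , ((_ , lt) , _))) → t , lt })
      (packUnion (packRows {P = λ x → T x × col x < q} 0 s ends) heavy λ ((_ , lt) , _) (_ , _ , (le , _)) → <⇒≱ lt le)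
      where
      ends : ∀ r → 0 ≤ r → r < s → Σ[ c ∈ ℕ ] T (r , c) × c < q
      ends r _ r<s with east-end R avoidE (proj₂ column r r<s)
      ... | _ , _ , k , refl , x , t , _ = suc k , S⊆T t , ≰⇒> λ le → ¬wide (r , r<s , k , proj₂ (inGrid R x) , x , le)

    -- The q southern ends of `P` and the s cells of the north-east square are already m cells of
    -- `T`. The south-east square provides s more, directly or through the boundary of its eater.
    module Wide {r c} (x : P (r , c)) (q≤c : q ≤ suc c) where

      bottoms : Pack q (λ x → South R (row x) (col x) × (0 ≤ col x × col x < q))
      bottoms = packCols {P = λ (r , c) → South R r c} 0 q λ c′ _ c′<q →
        let _ , y = meetsCol R touch x c′ z≤n (s≤s⁻¹ (≤-trans c′<q q≤c)); k , _ , e = south-end R avoidS y in k , e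

      both : Pack (q + s) (λ x → (South R (row x) (col x) × (0 ≤ col x × col x < q)) ⊎ In s T 0 q x)
      both = packUnion bottoms heavy λ (_ , _ , lt) (_ , _ , (le , _)) → <⇒≱ lt le

      inT : ∀ {x} → (South R (row x) (col x) × (0 ≤ col x × col x < q)) ⊎ In s T 0 q x → T x
      inT (inj₁ (e , _)) = S⊆T (proj₁ (S-edge R e))
      inT (inj₂ (t , _)) = t

      enough : ∀ {n} → s ≤ n → m + s ≤ q + s + n
      enough le = ≤-trans (≤-reflexive (cong (_+ s) (sym q+s))) (+-monoʳ-≤ (q + s) le)

      south-east : Pack s (In s T q q) ⊎ Pack m (Out s T q q) → ⊥
      south-east (inj₁ h) = tooMany (λ { (inj₁ p) → inT p ; (inj₂ (t , _)) → t })
        (packUnion both h λ { (inj₁ (_ , _ , lt)) (_ , _ , (le , _)) → <⇒≱ lt le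
                            ; (inj₂ (_ , (_ , lt) , _)) (_ , (le , _) , _) → <⇒≱ (<-≤-trans lt s≤q) le })
        (enough ≤-refl)
      south-east (inj₂ h) = do
        P₃ , pocket₃ , E₃ ← eaten q q (≤-reflexive q+s) (≤-reflexive q+s) h
        corner₃ pocket₃ E₃
        where
        module _ {P₃} (pocket₃ : Pocket P₃) (E₃ : Eats s T P₃ q q) where
          open RightPocket (rightEater pocket₃ E₃) renaming (R to R₃; full to full₃; line to line₃) hiding (pocket)

          bottom : Σ[ c ∈ ℕ ] P₃ (m ∸ 1 , c)
          bottom = let c , _ , _ , f = someCol E₃ in
            c , f (m ∸ 1) (∸-monoʳ-≤ m s>0) (≤-trans (≤-reflexive corner-col) (≤-reflexive (sym q+s)))

          avoidN : ∀ {x} → P₃ x → 0 < row x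
          avoidN {zero , _} y = ⊥-elim (notTB pocket₃ y (proj₂ bottom) refl corner-col)
          avoidN {suc _ , _} _ = s≤s z≤n

          corner₃ : ⊥
          corner₃ = do
            -- A tall eater has q ≥ s western ends in the rows from s on. Otherwise its northern
            -- ends in the last s columns are all below the north-east square.
            no ¬tall ← em (Σ[ x ∈ Cell ] P₃ x × row x ≤ s)
              where
              yes (_ , y , le) → tooMany (λ { (inj₁ p) → inT p ; (inj₂ (e , _)) → S⊆T (proj₁ (W-edge R₃ e)) })
                (packUnion both
                  (packRows {P = λ (r , c) → West R₃ r c} s q λ r lo hi →
                    let _ , z = meetsRow R₃ y (proj₂ bottom) r (≤-trans le lo)
                                  (s≤s⁻¹ (≤-trans hi (≤-reflexive (trans (+-comm s q) (trans q+s (sym corner-col))))))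
                        k , _ , e = west-end R₃ avoidW z in k , e)
                  λ { (inj₁ (e , _)) (e′ , _) → apart L (S-edge R e) (W-edge R₃ e′)
                    ; (inj₂ (_ , (_ , lt) , _)) (_ , le , _) → <⇒≱ lt le })
                (enough s≤q)
            tooMany (λ { (inj₁ p) → inT p ; (inj₂ ((_ , t , _) , _)) → S⊆T t })
              (packUnion both
                (packCols {P = λ (r , c) → North R₃ r c} q s λ c lo hi →
                  let k , _ , e = north-end R₃ avoidN (full₃ c lo (<-≤-trans hi (≤-reflexive q+s))) in k , e)
                λ { (inj₁ (_ , _ , lt)) (_ , le , _) → <⇒≱ lt le
                  ; (inj₂ (_ , (_ , lt) , _)) ((y , _) , _) → ¬tall (_ , y , lt) })
              (enough ≤-refl)

    result : Pack (s + s) Strip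
    result with wide?
    ... | no ¬w = narrow ¬w
    ... | yes (_ , _ , _ , _ , x , le) = ⊥-elim (Wide.south-east x le (crowded q q (≤-reflexive q+s) (≤-reflexive q+s)))

  module BothEaten {P P′} (pocket : Pocket P) (E : Eats s T P 0 0) (pocket′ : Pocket P′) (E′ : Eats s T P′ 0 q) where
    L : LeftEater P
    L = leftEater pocket E
    open LeftEater L using (R; avoidE)
    open RightPocket (rightEater pocket′ E′) using (avoidW; apart) renaming (R to R′)

    result : Pack (s + s) Strip
    result = packWeaken (λ { (inj₁ (e , _ , lt)) → S⊆T (proj₁ (R-edge R e)) , lt ; (inj₂ (e , _ , lt)) → S⊆T (proj₁ (W-edge R′ e)) , lt })
      (packUnion
        (packRows {P = λ (r , c) → East R r c} 0 s λ r _ r<s →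
          let _ , _ , _ , f = someCol E; k , _ , e = east-end R avoidE (f r z≤n r<s) in k , e)
        (packRows {P = λ (r , c) → West R′ r c} 0 s λ r _ r<s →
          let _ , _ , _ , f = someCol E′; k , _ , e = west-end R′ avoidW (f r z≤n r<s) in k , e)
        λ (e , _) (e′ , _) → apart L (R-edge R e) (W-edge R′ e′))

module _ {m s : ℕ} where

  topStrip : (B : Board m s) → Crowded B → NN (Pack (s + s) (λ x → Board.T B x × row x < s))
  topStrip B crowded K = cases (crowded 0 0 s≤m s≤m) (crowded 0 q s≤m (≤-reflexive q+s))
    where
    open Pockets B
    B′ = flipped B
    cases : Pack s (In s T 0 0) ⊎ Pack m (Out s T 0 0) → Pack s (In s T 0 q) ⊎ Pack m (Out s T 0 q) → ⊥
    cases (inj₁ h) (inj₁ h′) = K (packWeaken (λ { (inj₁ (t , (_ , lt) , _)) → t , lt ; (inj₂ (t , (_ , lt) , _)) → t , lt })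
      (packUnion h h′ λ (_ , _ , (_ , lt)) (_ , _ , (le , _)) → <⇒≱ (<-≤-trans lt s≤q) le))
    cases (inj₂ pk) (inj₁ h′) = do
      P , pocket , E ← eaten 0 0 s≤m s≤m pk
      K (Top.EatenHeavy.result B crowded pocket E h′)
    cases (inj₁ h) (inj₂ pk′) = do
      P , pocket , E ← Board.eaten B′ 0 0 s≤m s≤m (outFlipped T-grid (trans (cong (_+ s) (+-identityʳ q)) q+s) pk′)
      K (pullPack (flip↔ m) (proj₁ ∘ proj₁) (λ ((_ , t) , lt) → t , lt)
          (Top.EatenHeavy.result B′ (crowdedFlipped B crowded) pocket E (inFlipped T-grid q+s h)))
    cases (inj₂ pk) (inj₂ pk′) = do
      P , pocket , E ← eaten 0 0 s≤m s≤m pk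
      P′ , pocket′ , E′ ← eaten 0 q s≤m (≤-reflexive q+s) pk′
      K (Top.BothEaten.result B crowded pocket E pocket′ E′)

  -- The s rows at the top and the s rows at the bottom contain 2 s cells each. If 3 s < m, too few
  -- cells remain for the rows in between, and one of these is blank.
  notCrowded : (B : Board m s) → ¬ Crowded B
  notCrowded B crowded = do
    top ← topStrip B crowded
    bottom ← topStrip (upside B) (crowdedTransposed (flipped (transposed B)) (crowdedFlipped (transposed B) (crowdedTransposed B crowded)))
    strips (packUnion top (pullPack turn {λ x → Board.T (upside B) x × row x < s} {λ x → T x × q ≤ row x} (proj₁ ∘ proj₁)
             (λ ((_ , _ , _ , t) , lt) → t , high (proj₁ (T-grid t)) lt) bottom) λ (_ , lt) (_ , le) → <⇒≱ (<-≤-trans lt s≤q) le)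
    where
    open Pockets B
    turn : Symmetry m
    turn = record
      { to = λ (r , c) → mirror m r , c ; onGrid = λ (a , b) → mirror-< a , b
      ; onAdj = λ g g′ a → onAdj τ (onGrid σ (onGrid τ g)) (onGrid σ (onGrid τ g′)) (onAdj σ (onGrid τ g) (onGrid τ g′) (onAdj τ g g′ a))
      ; onKing = λ g g′ a → swap (onKing σ (swap g) (swap g′) (swap a))
      ; invol = λ (a , b) → cong (_, _) (mirror-invol a) }
      where
      σ = flip↔ m
      τ = transpose m
    high : ∀ {r} → mirror m r < m → r < s → q ≤ mirror m r
    high {r} _ lt = lem (mirror m r) (mirror-+ (<-≤-trans lt s≤m)) q q+s
      where
      lem : ∀ d → d + suc r ≡ m → ∀ q → q + s ≡ m → q ≤ d
      lem d e q e′ = by λ neg → clash 0 (lt ⊕ ≤-reflexive e′ ⊕ neg ⊕ ≤-reflexive (sym e)) (solve (d ∷ r ∷ q ∷ m ∷ s ∷ []))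

    Edge : Cell → Set
    Edge x = (T x × row x < s) ⊎ (T x × q ≤ row x)

    inT : ∀ {x} → Edge x → T x
    inT (inj₁ (t , _)) = t
    inT (inj₂ (t , _)) = t

    Blank : ℕ → Set
    Blank r = ∀ c → ¬ T (r , c)

    module Middle (strips : Pack (s + s + (s + s)) Edge) (3s<m : s + s + s < m) where

      2s≤q : s + s ≤ q
      2s≤q = +-cancelʳ-≤ s (s + s) q (≤-trans (<⇒≤ 3s<m) (≤-reflexive (sym q+s)))

      blocked? : ∀ r → Dec (∃ λ c → c < m × T (r , c))
      blocked? r = anyUpTo? (λ c → T? (r , c)) m

      blank : ∃ λ r → s ≤ r × r < q × Blank r
      blank with anyUpTo? (λ i → ¬? (blocked? (s + i))) (q ∸ s)
      ... | yes (i , i< , ¬b) = s + i , m≤m+n s i , <-≤-trans (+-monoʳ-< s i<) (≤-reflexive (m+[n∸m]≡n s≤q)) , λ c t → ¬b (c , proj₂ (T-grid t) , t)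
      ... | no ¬all = ⊥-elim (tooMany (λ { (inj₁ e) → inT e ; (inj₂ (t , _)) → t })
            (packUnion strips (packRows {P = T} s (q ∸ s) pick)
              λ { (inj₁ (_ , lt)) (_ , le , _) → <⇒≱ lt le
                ; (inj₂ (_ , le)) (_ , _ , lt) → <⇒≱ (<-≤-trans lt (≤-reflexive (m+[n∸m]≡n s≤q))) le })
            (lem (q ∸ s) q (m∸n+n≡m s≤q) q+s))
        where
        pick : ∀ r → s ≤ r → r < s + (q ∸ s) → Σ[ c ∈ ℕ ] T (r , c)
        pick r le lt with decidable-stable (blocked? (s + (r ∸ s))) (λ ¬b → ¬all (r ∸ s , +-cancelˡ-< s _ _ (subst (_< s + (q ∸ s)) (sym (m+[n∸m]≡n le)) lt) , ¬b))
        ... | c , _ , t rewrite m+[n∸m]≡n le = c , t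
        lem : ∀ e q → e + s ≡ q → q + s ≡ m → m + s ≤ s + s + (s + s) + e
        lem e q h h′ = by λ neg → clash s (≤-reflexive (sym h′) ⊕ neg ⊕ ≤-reflexive (sym h)) (solve (e ∷ q ∷ m ∷ s ∷ []))

      place : ∀ {r} → s ≤ r → r < q → ∃ λ p → p ≤ r × r < p + s × s ≤ p × p + s ≤ q
      place {r} s≤r r<q with r + s ≤? q
      ... | yes le = r , ≤-refl , m<m+n r s>0 , s≤r , le
      ... | no ¬le = q ∸ s , m≤n+o⇒m∸n≤o q s (≤-trans (<⇒≤ (≰⇒> ¬le)) (≤-reflexive (+-comm r s)))
                   , <-≤-trans r<q (≤-reflexive (sym (m∸n+n≡m s≤q))) , m+n≤o⇒m≤o∸n s 2s≤q , ≤-reflexive (m∸n+n≡m s≤q)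

      whole : ∀ {P r} → Region m S P → Blank r → P (r , 0) → ∀ c → c < m → P (r , c)
      whole R b x zero _ = x
      whole R b x (suc c) lt with dec R (_ , suc c)
      ... | yes y = y
      ... | no ¬y = let z = whole R b x c (<-trans (n<1+n c) lt) in
                    ⊥-elim (b (suc c) (S⊆T (closed R z east (proj₁ (inGrid R z) , lt) ¬y)))

      conclude : ∀ {r p} → Blank r → p ≤ r → r < p + s → s ≤ p → p + s ≤ q → Pack s (In s T p 0) ⊎ Pack m (Out s T p 0) → ⊥
      conclude {r} b p≤r r< s≤p p≤ (inj₂ pk) = do
        P , pocket , E ← eaten _ 0 (≤-trans p≤ q≤m) s≤m pk
        let x = eatsRow E p≤r r< (λ c _ _ → b c) 0 z≤n s>0
        notLR pocket x (whole (proj₁ pocket) b x (m ∸ 1) (≤-reflexive (m+[n∸m]≡n 0<m))) refl (m+[n∸m]≡n 0<m)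
      conclude {r} {p} b p≤r r< s≤p p≤ (inj₁ h) with s ≟ 1
      -- The count 5 s ≥ m + s in the other case relies on s ≥ 2. For s = 1 the square is a single
      -- cell of the blank row.
      ... | yes refl = let t , (lo , hi) , _ = sat h Data.Fin.zero in
              b _ (subst (λ i → T (i , col (entry h Data.Fin.zero))) (one (row (entry h Data.Fin.zero)) lo hi) t)
        where
        one : ∀ i → p ≤ i → i < p + 1 → i ≡ r
        one i lo hi = ≤-antisym (by λ neg → clash 0 (p≤r ⊕ hi ⊕ neg) (solve (p ∷ r ∷ i ∷ []))) (by λ neg → clash 0 (lo ⊕ r< ⊕ neg) (solve (p ∷ r ∷ i ∷ [])))
      ... | no s≢1 = tooMany (λ { (inj₁ e) → inT e ; (inj₂ (t , _)) → t })
              (packUnion strips h λ { (inj₁ (_ , lt)) (_ , (le , _) , _) → <⇒≱ (<-≤-trans lt s≤p) le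
                                    ; (inj₂ (_ , le)) (_ , (_ , lt) , _) → <⇒≱ (<-≤-trans lt p≤) le })
              (lem (≤∧≢⇒< s>0 (s≢1 ∘ sym)) large)
        where
        lem : 1 < s → 2 * m ≤ 5 * s + 5 → m + s ≤ s + s + (s + s) + s
        lem h h′ = by λ neg → clash 2 (h′ ⊕ 2 ⊛ neg ⊕ 3 ⊛ h) (solve (m ∷ s ∷ []))

    strips : Pack (s + s + (s + s)) Edge → ⊥
    strips pk with s + s + s <? m
    ... | no ¬lt = tooMany inT pk (lem (≮⇒≥ ¬lt))
      where
      lem : m ≤ s + s + s → m + s ≤ s + s + (s + s)
      lem h = by λ neg → clash 0 (h ⊕ neg) (solve (m ∷ s ∷ []))
    ... | yes lt = let open Middle pk lt; r , s≤r , r<q , b = blank; p , p≤r , r< , s≤p , p≤ = place s≤r r<q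
                   in conclude b p≤r r< s≤p p≤ (crowded p 0 (≤-trans p≤ q≤m) s≤m)


-- The deletion process

packList : ∀ {L : List Cell} → Unique L → Pack (length L) (_∈ L)
packList {[]} _ = mkPack (λ ()) (λ { {()} }) λ ()
packList {x ∷ L} (x∉ AllPairs.∷ u) = mkPack f f-inj f-sat
  where
  p = packList u
  f : Fin (suc (length L)) → Cell
  f Fin.zero = x
  f (Fin.suc i) = entry p i
  f-inj : ∀ {i k} → f i ≡ f k → i ≡ k
  f-inj {Fin.zero} {Fin.zero} _ = refl
  f-inj {Fin.zero} {Fin.suc k} e = ⊥-elim (All.lookup x∉ (sat p k) e)
  f-inj {Fin.suc i} {Fin.zero} e = ⊥-elim (All.lookup x∉ (sat p i) (sym e))
  f-inj {Fin.suc i} {Fin.suc k} e = cong Fin.suc (inj p e)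
  f-sat : ∀ i → f i ∈ x ∷ L
  f-sat Fin.zero = here refl
  f-sat (Fin.suc i) = there (sat p i)

length-split : ∀ {P : Cell → Set} (P? : ∀ x → Dec (P x)) L → length (filter P? L) + length (filter (¬? ∘ P?) L) ≡ length L
length-split P? [] = refl
length-split P? (x ∷ L) with P? x
... | yes _ = cong suc (length-split P? L)
... | no _ = trans (+-suc _ _) (cong suc (length-split P? L))

square? : ∀ s p q x → Dec (Square s p q x)
square? s p q (r , c) = ((p ≤? r) ×-dec (r <? p + s)) ×-dec ((q ≤? c) ×-dec (c <? q + s))

module Component (F : Cell → Set) where

  Comp : Cell → Cell → Set
  Comp = Walk Adj F

  comp-extend : ∀ {x y z} → Comp x y → F z → Adj y z → Comp x z
  comp-extend w f a = w ⊙ go (end∈ w) a (stop f)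

  within : ∀ {x y z} → Comp x y → Walk Adj F y z → Walk Adj (Comp x) y z
  within w w′ = weaken proj₂ (confine (λ i _ q a → comp-extend i q a) w w′)

  joinedComp : ∀ {x y z} → Comp x y → Comp x z → Walk Adj (Comp x) y z
  joinedComp w w′ = within w (reverse adj-sym w ⊙ w′)

module Game {m s a b : ℕ} (5≤m : 5 ≤ m) (small : suc (5 * s) ≤ 2 * m) (large : 2 * m ≤ 5 * s + 5) (1≤s : 1 ≤ s)
  (minimal : ∀ j → Rankable s s j → b ≤ j) (a<m+b : a < m + b) {g : Cell → ℕ} (ρ : Ranks a g (Grid m)) where

  Free : List Cell → Cell → Set
  Free L x = Grid m x × x ∉ L

  record Stage (n : ℕ) : Set where
    field
      L       : List Cell
      len     : length L ≡ n
      unique  : Unique L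
      onGrid′ : ∀ {x} → x ∈ L → Grid m x
      base    : Cell

    M : Cell → Set
    M = Walk Adj (Free L) base

    field
      j       : ℕ
      labels  : ∀ {x} → M x → g x ≤ j
      budget  : n + j ≤ a
      lr      : Σ[ x ∈ Cell ] Σ[ y ∈ Cell ] col x ≡ 0 × suc (col y) ≡ m × Walk Adj M x y
      tb      : Σ[ x ∈ Cell ] Σ[ y ∈ Cell ] row x ≡ 0 × suc (row y) ≡ m × Walk Adj M x y

  -- Common to both uses of boards: in a step T has the additional vertex v and j′ is g v - 1; at
  -- the end T is L and j′ is j.
  module Play {n} (St : Stage n) (T : List Cell) (T-unique : Unique T) (T-on : ∀ {x} → x ∈ T → Grid m x)
    (L⊆T : ∀ {x} → x ∈ Stage.L St → x ∈ T) (j′ : ℕ) (labels′ : ∀ {x} → Stage.M St x → x ∉ T → g x ≤ j′)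
    (budget′ : length T + j′ ≤ a) (T-short : length T < m + s) where
    open Stage St
    open Component

    M-grid : ∀ {x} → M x → Grid m x
    M-grid = proj₁ ∘ end∈

    module At (p q : ℕ) (p≤ : p + s ≤ m) (q≤ : q + s ≤ m) (out : Pack m (Out s (_∈ T) p q)) where

      shift unshift : Cell → Cell
      shift (r , c) = p + r , q + c
      unshift (r , c) = r ∸ p , c ∸ q

      T′ : Cell → Set
      T′ x = shift x ∈ T

      inner outer local : List Cell
      inner = filter (square? s p q) T
      outer = filter (¬? ∘ square? s p q) T
      local = map unshift inner

      shift-grid : ∀ {x} → Grid s x → Grid m (shift x)
      shift-grid (u , v) = <-≤-trans (+-monoʳ-< p u) p≤ , <-≤-trans (+-monoʳ-< q v) q≤

      shift-square : ∀ {x} → Grid s x → Square s p q (shift x)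
      shift-square (u , v) = (m≤m+n p _ , +-monoʳ-< p u) , (m≤m+n q _ , +-monoʳ-< q v)

      unshift-shift : ∀ x → unshift (shift x) ≡ x
      unshift-shift (r , c) = cong₂ _,_ (m+n∸m≡n p r) (m+n∸m≡n q c)

      shift-inj : ∀ {x y} → shift x ≡ shift y → x ≡ y
      shift-inj {x} {y} e = trans (sym (unshift-shift x)) (trans (cong unshift e) (unshift-shift y))

      shift-adj : ∀ {x y} → Adj x y → Adj (shift x) (shift y)
      shift-adj {_ , c} east rewrite +-suc q c = east
      shift-adj {_} {_ , c} west rewrite +-suc q c = west
      shift-adj {r , _} south rewrite +-suc p r = south
      shift-adj {_} {r , _} north rewrite +-suc p r = north

      complete : ∀ {x} → Grid s x → T′ x → x ∈ local
      complete {x} gx t = subst (_∈ local) (unshift-shift x) (∈-map⁺ unshift (∈-filter⁺ (square? s p q) t (shift-square gx)))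

      outer≥ : m ≤ length outer
      outer≥ = packLength (packWeaken (λ (t , ¬sq) → ∈-filter⁺ (¬? ∘ square? s p q) t ¬sq) out)

      local-outer : length local + length outer ≡ length T
      local-outer = trans (cong (_+ length outer) (length-map unshift inner)) (length-split (square? s p q) T)

      local-short : length local < s
      local-short = lem (length local) (length outer) (length T) local-outer outer≥ T-short
        where
        lem : ∀ x y z → x + y ≡ z → m ≤ y → z < m + s → x < s
        lem x y z e h h′ = by λ neg → clash 0 (≤-reflexive e ⊕ neg ⊕ h ⊕ h′) (solve (x ∷ y ∷ z ∷ m ∷ s ∷ []))

      T′? : ∀ x → Dec (T′ x)
      T′? x = shift x ∈? T

      freeRow : ∃ λ r → r < s × (∀ c → c < s → ¬ T′ (r , c))
      freeRow with anyUpTo? (λ r → ¬? (anyUpTo? (λ c → T′? (r , c)) s)) s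
      ... | yes (r , r<s , ¬t) = r , r<s , λ c c<s t → ¬t (c , c<s , t)
      ... | no ¬all = ⊥-elim (<⇒≱ local-short (packLength (packWeaken proj₁ (packRows {P = _∈ local} 0 s λ r _ r<s →
            let c , c<s , t = decidable-stable (anyUpTo? (λ c → T′? (r , c)) s) (λ ¬t → ¬all (r , r<s , ¬t)) in c , complete (r<s , c<s) t))))

      freeCol : ∃ λ c → c < s × (∀ r → r < s → ¬ T′ (r , c))
      freeCol with anyUpTo? (λ c → ¬? (anyUpTo? (λ r → T′? (r , c)) s)) s
      ... | yes (c , c<s , ¬t) = c , c<s , λ r r<s t → ¬t (r , r<s , t)
      ... | no ¬all = ⊥-elim (<⇒≱ local-short (packLength (packWeaken proj₁ (packCols {P = _∈ local} 0 s λ c _ c<s →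
            let r , r<s , t = decidable-stable (anyUpTo? (λ r → T′? (r , c)) s) (λ ¬t → ¬all (c , c<s , ¬t)) in r , complete (r<s , c<s) t))))

      r₀ c₀ : ℕ
      r₀ = proj₁ freeRow
      c₀ = proj₁ freeCol

      Free′ Main : Cell → Set
      Free′ x = Grid s x × ¬ T′ x
      Main = Walk Adj Free′ (r₀ , 0)

      row₀ : ∀ c → c < s → Main (r₀ , c)
      row₀ c c<s = let _ , r<s , h = freeRow in lineWalk s r₀ (λ i i<s → (r<s , i<s) , h i i<s) 1≤s c<s

      colM : ∀ {c} → c < s → (∀ r → r < s → ¬ T′ (r , c)) → ∀ r → r < s → Main (r , c)
      colM {c} c<s h r r<s = row₀ c c<s ⊙ fileWalk s c (λ i i<s → (i<s , c<s) , h i i<s) (proj₁ (proj₂ freeRow)) r<s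

      rowM : ∀ {r} → r < s → (∀ c → c < s → ¬ T′ (r , c)) → ∀ c → c < s → Main (r , c)
      rowM {r} r<s h c c<s = let _ , c₀<s , h₀ = freeCol in
        colM c₀<s h₀ r r<s ⊙ lineWalk s r (λ i i<s → (r<s , i<s) , h i i<s) c₀<s c<s

      start : Cell
      start = shift (r₀ , 0)

      globalT : ∀ {x} → Main x → Walk Adj (λ y → Free L y × y ∉ T) start (shift x)
      globalT = mapWalk shift (λ (gx , t) → (shift-grid gx , t ∘ L⊆T) , t) (λ _ _ → shift-adj)

      P : Cell → Set
      P = Walk Adj (Free L) start

      global : ∀ {x} → Main x → P (shift x)
      global = weaken proj₁ ∘ globalT

      -- If the dominating component lay in `M`, `dominate` would rank the square with length local
      -- + j′ labels. As m ≤ length outer and length T + j′ ≤ a, this is at most a - m < b.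
      win : ¬ M start
      win mz = do
        _ , R ← dominate T′? local complete local-short rowM colM (λ w a gy ¬t → w ⊙ go (end∈ w) a (stop (gy , ¬t)))
          (ranksPull {j′ = j′} shift (λ w → shift-grid (proj₁ (end∈ w))) (λ _ _ → shift-adj) (λ _ _ → shift-inj)
            (λ w → labels′ (mz ⊙ global w) (proj₂ (end∈ (globalT w)))) ρ)
        lem (length local) (length outer) (length T) local-outer outer≥ budget′ (minimal _ (Ranks→rankable R))
        where
        lem : ∀ x y z → x + y ≡ z → m ≤ y → z + j′ ≤ a → b ≤ x + j′ → ⊥
        lem x y z e h h′ h″ = clash 0 (≤-reflexive e ⊕ h′ ⊕ h″ ⊕ h ⊕ a<m+b) (solve (x ∷ y ∷ z ∷ m ∷ j′ ∷ a ∷ b ∷ []))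

      region : (∀ x → Dec (P x)) → Region m (_∈ L) P
      region dec = record
        { inGrid = proj₁ ∘ end∈ ; dec = dec ; off = proj₂ ∘ end∈
        ; closed = λ {_} {y} w a gy ¬w → decidable-stable (y ∈? L) λ y∉ → ¬w (comp-extend (Free L) w (gy , y∉) a)
        ; joined = joinedComp (Free L) }

      local-row : ∀ {r} → p ≤ r → r < p + s → ∃ λ r′ → r′ < s × p + r′ ≡ r
      local-row {r} lo hi = r ∸ p , +-cancelˡ-< p _ _ (subst (_< p + s) (sym (m+[n∸m]≡n lo)) hi) , m+[n∸m]≡n lo

      local-col : ∀ {c} → q ≤ c → c < q + s → ∃ λ c′ → c′ < s × q + c′ ≡ c
      local-col {c} lo hi = c ∸ q , +-cancelˡ-< q _ _ (subst (_< q + s) (sym (m+[n∸m]≡n lo)) hi) , m+[n∸m]≡n lo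

      eats : Eats s (_∈ T) P p q
      eats = record { eatsRow = er ; eatsCol = ec ; someRow = sr ; someCol = sc }
        where
        er : ∀ {r} → p ≤ r → r < p + s → (∀ c → q ≤ c → c < q + s → (r , c) ∉ T) → ∀ c → q ≤ c → c < q + s → P (r , c)
        er lo hi h c lo′ hi′ with local-row lo hi | local-col lo′ hi′
        ... | r′ , r< , refl | c′ , c< , refl = global (rowM r< (λ i i< → h (q + i) (m≤m+n q i) (+-monoʳ-< q i<)) c′ c<)
        ec : ∀ {c} → q ≤ c → c < q + s → (∀ r → p ≤ r → r < p + s → (r , c) ∉ T) → ∀ r → p ≤ r → r < p + s → P (r , c)
        ec lo hi h r lo′ hi′ with local-col lo hi | local-row lo′ hi′
        ... | c′ , c< , refl | r′ , r< , refl = global (colM c< (λ i i< → h (p + i) (m≤m+n p i) (+-monoʳ-< p i<)) r′ r<)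
        sr : Σ[ r ∈ ℕ ] p ≤ r × r < p + s × (∀ c → q ≤ c → c < q + s → P (r , c))
        sr = p + r₀ , m≤m+n p r₀ , +-monoʳ-< p (proj₁ (proj₂ freeRow)) , λ c lo hi →
          let c′ , c< , e = local-col lo hi in subst (λ i → P (p + r₀ , i)) e (global (row₀ c′ c<))
        sc : Σ[ c ∈ ℕ ] q ≤ c × c < q + s × (∀ r → p ≤ r → r < p + s → P (r , c))
        sc = q + c₀ , m≤m+n q c₀ , +-monoʳ-< q (proj₁ (proj₂ freeCol)) , λ r lo hi →
          let r′ , r< , e = local-row lo hi; _ , c< , h = freeCol in subst (λ i → P (i , q + c₀)) e (global (colM c< h r′ r<))

    board : Board m s
    board = record
      { S = _∈ L ; T = _∈ T ; M = M ; T? = _∈? T ; S⊆T = L⊆T ; T-grid = T-on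
      ; few = λ p → ≤-<-trans (packLength p) T-short
      ; M-off = proj₂ ∘ end∈
      -- `M` joins the top to the bottom, and a walk from left to right off `M` would cross it.
      ; noLR = λ l r w → let _ , _ , t , b , w′ = tb in
          Crossing.crossing {D = M} M-grid {Γ = λ z → Grid m z × ¬ M z} proj₁ (λ x (_ , ¬x) → ¬x x) w′ t b w l r
      ; noTB = λ t b w → let _ , _ , l , r , w′ = lr in
          Crossing.crossing {D = λ z → Grid m z × ¬ M z} proj₁ {Γ = M} M-grid (λ (_ , ¬x) x → ¬x x) w t b w′ l r
      ; small = small ; large = large ; s>0 = 1≤s
      ; eaten = eaten′ }
      where
      eaten′ : ∀ p q → p + s ≤ m → q + s ≤ m → Pack m (Out s (_∈ T) p q) →
               NN (Σ[ P ∈ (Cell → Set) ] (Region m (_∈ L) P × (∀ {x} → M x → P x → ⊥)) × Eats s (_∈ T) P p q)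
      eaten′ p q p≤ q≤ pk K = do
        dec ← decGrid (At.P p q p≤ q≤ pk) m (proj₁ ∘ end∈)
        K (At.P p q p≤ q≤ pk , (At.region p q p≤ q≤ pk dec , λ x y → At.win p q p≤ q≤ pk (x ⊙ reverse adj-sym y)) , At.eats p q p≤ q≤ pk)

  module Step {n} (St : Stage n) (n< : suc n < m + s) {v} (v∈M : Stage.M St v) (v-max : ∀ {y} → Stage.M St y → g y ≤ g v) where
    open Stage St
    open Component

    T : List Cell
    T = v ∷ L

    v-pos : 1 ≤ g v
    v-pos = pos ρ (proj₁ (end∈ v∈M))

    -- `M` is connected and v has its largest label, so that a second vertex with this label would
    -- violate `sep`.
    smaller : ∀ {x} → M x → x ∉ T → g x ≤ g v ∸ 1
    smaller {x} x∈M x∉T = m+n≤o⇒m≤o∸n (g x) (≤-trans (≤-reflexive (+-comm (g x) 1)) (≤∧≢⇒< (v-max x∈M) λ e →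
      sep ρ (proj₁ (end∈ v∈M)) (proj₁ (end∈ x∈M)) (λ { refl → x∉T (here refl) }) (sym e)
        (weaken (λ y∈M → proj₁ (end∈ y∈M) , v-max y∈M) (joinedComp (Free L) v∈M x∈M))))

    unique′ : Unique T
    unique′ = ¬Any⇒All¬ L (proj₂ (end∈ v∈M)) AllPairs.∷ unique

    on′ : ∀ {x} → x ∈ T → Grid m x
    on′ (here refl) = proj₁ (end∈ v∈M)
    on′ (there x∈) = onGrid′ x∈

    budget′ : suc n + (g v ∸ 1) ≤ a
    budget′ = ≤-trans (≤-reflexive (trans (sym (+-suc n _)) (cong (n +_) (m+[n∸m]≡n v-pos)))) (≤-trans (+-monoʳ-≤ n (labels v∈M)) budget)

    B : Board m s
    B = Play.board St T unique′ on′ there (g v ∸ 1) smaller (subst (λ l → suc l + (g v ∸ 1) ≤ a) (sym len) budget′)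
          (subst (λ l → suc l < m + s) (sym len) n<)

    0<m : 0 < m
    0<m = ≤-trans (s≤s z≤n) 5≤m

    -- As `T` contains no king chain between opposite sides, duality yields two walks off `T`, from
    -- left to right and from top to bottom. They meet each other, and the first meets the old `M`;
    -- thus they lie in one component within the old `M`.
    next : NN (Stage (suc n))
    next K = do
      x , y , l , r , γ ← duality m {_∈ T} 0<m (_∈? T) (λ t b w → noAcross 5≤m B (_ , _ , t , b , weaken proj₂ w))
      x′ , y′ , t , b , δ ← duality m {λ z → swap z ∈ T} 0<m (λ z → swap z ∈? T)
        (λ t b w → noAcross 5≤m (transposed B) (_ , _ , t , b , w))
      K′ l r γ t b (mapWalk swap (λ (gz , z∉) → swap gz , z∉) (λ p q → onAdj (transpose m) (proj₁ p) (proj₁ q)) δ)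
      where
      F : Cell → Set
      F = Free T
      K′ : ∀ {x y x′ y′} → col x ≡ 0 → suc (col y) ≡ m → Walk Adj F x y → row x′ ≡ 0 → suc (row y′) ≡ m → Walk Adj F x′ y′ → ⊥
      K′ {x} {y} {x′} {y′} l r γ t b δ = do
        yes meet ← em (Walk Adj F x x′)
          where no ¬meet → Crossing.crossing {D = Comp F x′} (proj₁ ∘ end∈) {Γ = Comp F x} (proj₁ ∘ end∈)
                             (λ w w′ → ¬meet (w′ ⊙ reverse adj-sym w)) (within F (stop (start∈ δ)) δ) t b (within F (stop (start∈ γ)) γ) l r
        yes x∈M ← em (M x)
          where no ¬x → let _ , _ , t′ , b′ , w = tb in
                  Crossing.crossing {D = M} (proj₁ ∘ end∈) {Γ = Comp F x} (proj₁ ∘ end∈)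
                    (λ z w′ → ¬x (z ⊙ reverse adj-sym (weaken old w′))) w t′ b′ (within F (stop (start∈ γ)) γ) l r
        K (record
          { L = T ; len = cong suc len ; unique = unique′ ; onGrid′ = on′ ; base = x ; j = g v ∸ 1
          ; labels = λ w → smaller (x∈M ⊙ weaken old w) (proj₂ (end∈ w)) ; budget = budget′
          ; lr = x , y , l , r , within F (stop (start∈ γ)) γ ; tb = x′ , y′ , t , b , within F meet δ })
        where
        old : ∀ {z} → F z → Free L z
        old (gz , z∉) = gz , z∉ ∘ there

  advance : ∀ {n} → Stage n → suc n < m + s → NN (Stage (suc n))
  advance St n< K = do
    v , v∈M , v-max ← maximum {Stage.M St} g (Stage.j St) (Stage.labels St) (Stage.j St) _ (start∈′ (Stage.lr St)) (m≤m+n _ _)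
    Step.next St n< v∈M v-max K
    where
    start∈′ : (lr : Σ[ x ∈ Cell ] Σ[ y ∈ Cell ] col x ≡ 0 × suc (col y) ≡ m × Walk Adj (Stage.M St) x y) → Stage.M St (proj₁ lr)
    start∈′ (_ , _ , _ , _ , w) = start∈ w

  finish : ∀ {n} → Stage n → suc n ≡ m + s → ⊥
  finish {n} St e = notCrowded B crowded
    where
    open Stage St
    length< : length L < m + s
    length< = ≤-reflexive (trans (cong suc len) e)
    B : Board m s
    B = Play.board St L unique onGrid′ id j (λ w _ → labels w) (subst (λ l → l + j ≤ a) (sym len) budget) length<
    crowded : Crowded B
    crowded p q _ _ with s ≤? length (filter (square? s p q) L)
    ... | yes le = inj₁ (packWeaken (∈-filter⁻ (square? s p q)) (packTake le (packList (filter⁺ (square? s p q) unique))))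
    ... | no ¬le = inj₂ (packWeaken (∈-filter⁻ (¬? ∘ square? s p q))
          (packTake (lem _ _ _ (length-split (square? s p q) L) (≰⇒> ¬le) (trans (cong suc len) e)) (packList (filter⁺ (¬? ∘ square? s p q) unique))))
      where
      lem : ∀ x y z → x + y ≡ z → x < s → suc z ≡ m + s → m ≤ y
      lem x y z h h′ h″ = by λ neg → clash 0 (≤-reflexive (sym h″) ⊕ neg ⊕ h′ ⊕ ≤-reflexive (sym h)) (solve (x ∷ y ∷ z ∷ m ∷ s ∷ []))

  play : ∀ fuel {n} → fuel + suc n ≡ m + s → Stage n → ⊥
  play zero e St = finish St e
  play (suc fuel) {n} e St = do
    St′ ← advance St (≤-trans (s≤s (m≤n+m (suc n) fuel)) (≤-reflexive e))
    play fuel (trans (+-suc fuel (suc n)) e) St′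

  initial : Stage 0
  initial = record
    { L = [] ; len = refl ; unique = AllPairs.[] ; onGrid′ = λ () ; base = 0 , 0 ; j = a
    ; labels = λ w → ub ρ (proj₁ (end∈ w)) ; budget = ≤-refl
    ; lr = (0 , 0) , (0 , m ∸ 1) , refl , last , within (Free []) (stop (free z z)) (lineWalk m 0 (λ i i< → free z i<) z end)
    ; tb = (0 , 0) , (m ∸ 1 , 0) , refl , last , within (Free []) (stop (free z z)) (fileWalk m 0 (λ i i< → free i< z) z end) }
    where
    open Component
    z : 0 < m
    z = ≤-trans (s≤s z≤n) 5≤m
    last : suc (m ∸ 1) ≡ m
    last = m+[n∸m]≡n z
    end : m ∸ 1 < m
    end = ≤-reflexive last
    free : ∀ {r c} → r < m → c < m → Free [] (r , c)
    free a b = (a , b) , λ ()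

  impossible : ⊥
  impossible = play (m + s ∸ 1) (m∸n+n≡m (≤-trans 1≤s (m≤n+m s m))) initial

theorem2 : (m : ℕ) → 5 ≤ m →
    (a b : ℕ) → IsRankNumber m m a →
    IsRankNumber (ceil2m/5 m ∸ 1) (ceil2m/5 m ∸ 1) b →
    m + b ≤ a
theorem2 m 5≤m a b (rankable , _) (_ , minimal) = ≮⇒≥ λ a<m+b →
  Game.impossible 5≤m small large 1≤s minimal a<m+b (proj₂ (ranking→Ranks (proj₂ rankable)))
  where
  -- With 2 m + 4 = rem + 5 k and s = k - 1, `small` expresses rem ≥ 0 and `large` expresses rem ≤
  -- 4.
  k = (2 * m + 4) / 5
  rem = (2 * m + 4) % 5
  division : 2 * m + 4 ≡ rem + k * 5
  division = m≡m%n+[m/n]*n (2 * m + 4) 5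
  rem<5 : rem < 5
  rem<5 = m%n<n (2 * m + 4) 5
  2≤ : ∀ k rem → 2 * m + 4 ≡ rem + k * 5 → rem < 5 → 2 ≤ k
  2≤ k rem e h = by λ neg → clash 4 (h ⊕ 5 ⊛ neg ⊕ ≤-reflexive e ⊕ 2 ⊛ 5≤m) (solve (m ∷ k ∷ rem ∷ []))
  1≤s : 1 ≤ k ∸ 1
  1≤s = ∸-monoˡ-≤ 1 (2≤ k rem division rem<5)
  s-eq : k ∸ 1 + 1 ≡ k
  s-eq = m∸n+n≡m (≤-trans (s≤s z≤n) (2≤ k rem division rem<5))
  small : suc (5 * (k ∸ 1)) ≤ 2 * m
  small = lem (k ∸ 1) k rem s-eq division rem<5
    where
    lem : ∀ s k rem → s + 1 ≡ k → 2 * m + 4 ≡ rem + k * 5 → rem < 5 → suc (5 * s) ≤ 2 * m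
    lem s k rem e e′ h = by λ neg → clash rem (5 ⊛ ≤-reflexive e ⊕ neg ⊕ ≤-reflexive (sym e′)) (solve (m ∷ s ∷ k ∷ rem ∷ []))
  large : 2 * m ≤ 5 * (k ∸ 1) + 5
  large = lem (k ∸ 1) k rem s-eq division rem<5
    where
    lem : ∀ s k rem → s + 1 ≡ k → 2 * m + 4 ≡ rem + k * 5 → rem < 5 → 2 * m ≤ 5 * s + 5
    lem s k rem e e′ h = by λ neg → clash 0 (5 ⊛ ≤-reflexive (sym e) ⊕ h ⊕ ≤-reflexive e′ ⊕ neg) (solve (m ∷ s ∷ k ∷ rem ∷ []))
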